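{- Let $G$ be a finite index subgroup of $\mathbb{Q}^\times$, and let $a,b,c\in\mathbb{Q}^\times$. Then the equation $ax+by+cz=0$ has a solution with $x,y,z\in G$ if and only if, for every finite set $S$ of places of $\mathbb{Q}$, the equation $ax+by+cz=0$ (in the ring $\mathbb{Q}_S$) has a solution with $x,y,z\in G_S$.
   Context: Places of $\mathbb{Q}$ are the primes $p$ and the archimedean place $\infty$, with completions $\mathbb{Q}_p$ and $\mathbb{Q}_\infty=\mathbb{R}$. For a set $S$ of places of $\mathbb{Q}$, $\mathbb{Q}_S:=\prod_{v\in S}\mathbb{Q}_v$, and $G_S$ denotes the closure in $\mathbb{Q}_S^\times$ (for finite $S$, this is $\prod_{v\in S}\mathbb{Q}_v^\times$ with the product topology) of the image of $G$ under the diagonal embedding $\mathbb{Q}^\times\to\mathbb{Q}_S^\times$. The rational numbers $a,b,c$ are viewed in $\mathbb{Q}_S$ via the diagonal embedding. -}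

module Defs where

open import Level using (Level; 0ℓ; _⊔_) renaming (suc to lsuc)
open import Algebra.Bundles using (Group; AbelianGroup; CommutativeRing)
open import Data.Fin.Base using (Fin)
open import Data.Integer.Base as ℤ using (ℤ; +_; +[1+_]; -[1+_])
import Data.Integer.Divisibility.Signed as ℤ using (∣ᵤ⇒∣; ∣⇒∣ᵤ; ∣m∣n⇒∣m+n)
import Data.Integer.Properties as ℤ
open import Data.List.Base using (List; length; lookup)
open import Data.Nat.Base as ℕ using (ℕ; zero; suc; NonZero)
open import Data.Nat.Divisibility using (_∣_; _∣?_; divides; m∣m*n; ∣-trans; *-cancelˡ-∣)
open import Data.Nat.Induction using (<-wellFounded)
open import Data.Nat.Primality using (Prime; prime⇒nonZero; prime⇒nonTrivial; euclidsLemma)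
import Data.Nat.Properties as ℕ
open import Data.Product.Base using (Σ; ∃; ∃₂; _×_; _,_; proj₁; proj₂)
open import Data.Rational.Base as ℚ
  using (ℚ; mkℚ; 0ℚ; 1ℚ; ½; _/_; ↥_; ↧_; ↧ₙ_; toℚᵘ; Positive)
import Data.Rational.Properties as ℚ
open import Data.Rational.Solver using (module +-*-Solver)
import Data.Rational.Unnormalised.Base as ℚᵘ
import Data.Rational.Unnormalised.Properties as ℚᵘ
open import Data.Sum.Base using (_⊎_; inj₁; inj₂)
open import Function.Base using (_$_; it)
open import Function.Bundles using (Inverse)
open import Induction.WellFounded using (Acc; acc)
open import Relation.Binary.Bundles using (Setoid)
open import Relation.Binary.Definitions using (tri<; tri≈; tri>)
open import Relation.Binary.PropositionalEquality
  using (_≡_; _≢_; refl; sym; trans; cong; cong₂; subst; module ≡-Reasoning)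
  renaming (setoid to ≡-setoid)
open import Relation.Nullary using (¬_; yes; no; contradiction)
open import Relation.Unary using (Pred)

record Subgroup {c ℓ} (G : Group c ℓ) (p : Level) : Set (c ⊔ ℓ ⊔ lsuc p) where
  open Group G
  field
    Member    : Pred Carrier p
    resp      : ∀ {x y} → x ≈ y → Member x → Member y
    ε-closed  : Member ε
    ∙-closed  : ∀ {x y} → Member x → Member y → Member (x ∙ y)
    ⁻¹-closed : ∀ {x} → Member x → Member (x ⁻¹)

module _ {c ℓ p} (G : Group c ℓ) (H : Subgroup G p) where
  open Group G renaming (refl to ≈-refl; sym to ≈-sym; trans to ≈-trans)
  open Subgroup H
  open import Algebra.Properties.Group G using (⁻¹-anti-homo-∙; ⁻¹-involutive)

  leftCosets : Setoid c p
  leftCosets = record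
    { Carrier       = Carrier
    ; _≈_           = λ x y → Member (x ⁻¹ ∙ y)
    ; isEquivalence = record
      { refl  = λ {x} → resp (≈-sym (inverseˡ x)) ε-closed
      ; sym   = λ {x} {y} h → resp
                  (≈-trans (⁻¹-anti-homo-∙ (x ⁻¹) y) (∙-congˡ (⁻¹-involutive x)))
                  (⁻¹-closed h)
      ; trans = λ {x} {y} {z} h k → resp
                  (≈-trans (assoc (x ⁻¹) y (y ⁻¹ ∙ z))
                    (∙-congˡ (≈-trans (≈-sym (assoc y (y ⁻¹) z))
                      (≈-trans (∙-congʳ (inverseʳ y)) (identityˡ z)))))
                  (∙-closed h k)
      }
    }

  FiniteIndex : Set (c ⊔ p)
  FiniteIndex = ∃ λ n → Inverse leftCosets (≡-setoid (Fin n))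

module _ {r ℓ} (R : CommutativeRing r ℓ) where
  open CommutativeRing R renaming (refl to ≈-refl; sym to ≈-sym; trans to ≈-trans)
  open import Relation.Binary.Reasoning.Setoid setoid
    using (begin_; step-≈-⟩; step-≈-⟨; _∎)

  Unit : Set (r ⊔ ℓ)
  Unit = ∃₂ λ u v → u * v ≈ 1#

  private
    interchange : ∀ u v u′ v′ → (u * u′) * (v * v′) ≈ (u * v) * (u′ * v′)
    interchange u v u′ v′ = begin
      (u * u′) * (v * v′) ≈⟨ *-assoc u u′ (v * v′) ⟩
      u * (u′ * (v * v′)) ≈⟨ *-congˡ (*-assoc u′ v v′) ⟨
      u * ((u′ * v) * v′) ≈⟨ *-congˡ (*-congʳ (*-comm u′ v)) ⟩
      u * ((v * u′) * v′) ≈⟨ *-congˡ (*-assoc v u′ v′) ⟩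
      u * (v * (u′ * v′)) ≈⟨ *-assoc u v (u′ * v′) ⟨
      (u * v) * (u′ * v′) ∎

    inverse-cong : ∀ {u v u′ v′} → u * v ≈ 1# → u′ * v′ ≈ 1# → u ≈ u′ → v ≈ v′
    inverse-cong {u} {v} {u′} {v′} p p′ u≈u′ = begin
      v              ≈⟨ *-identityʳ v ⟨
      v * 1#         ≈⟨ *-congˡ p′ ⟨
      v * (u′ * v′)  ≈⟨ *-assoc v u′ v′ ⟨
      (v * u′) * v′  ≈⟨ *-congʳ (*-congˡ u≈u′) ⟨
      (v * u) * v′   ≈⟨ *-congʳ (*-comm v u) ⟩
      (u * v) * v′   ≈⟨ *-congʳ p ⟩
      1# * v′        ≈⟨ *-identityˡ v′ ⟩
      v′             ∎

  units : AbelianGroup (r ⊔ ℓ) ℓ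
  units = record
    { Carrier = Unit
    ; _≈_     = λ x y → proj₁ x ≈ proj₁ y
    ; _∙_     = λ (u , v , p) (u′ , v′ , p′) →
                  u * u′ , v * v′ ,
                  ≈-trans (interchange u v u′ v′) (≈-trans (*-cong p p′) (*-identityˡ 1#))
    ; ε       = 1# , 1# , *-identityˡ 1#
    ; _⁻¹     = λ (u , v , p) → v , u , ≈-trans (*-comm v u) p
    ; isAbelianGroup = record
      { isGroup = record
        { isMonoid = record
          { isSemigroup = record
            { isMagma = record
              { isEquivalence = record { refl = ≈-refl ; sym = ≈-sym ; trans = ≈-trans }
              ; ∙-cong        = *-cong
              }
            ; assoc = λ x y z → *-assoc (proj₁ x) (proj₁ y) (proj₁ z)
            }
          ; identity = (λ x → *-identityˡ (proj₁ x)) , (λ x → *-identityʳ (proj₁ x))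
          }
        ; inverse = (λ (u , v , p) → ≈-trans (*-comm v u) p) , (λ (_ , _ , p) → p)
        ; ⁻¹-cong = λ { {_ , _ , p} {_ , _ , p′} → inverse-cong p p′ }
        }
      ; comm = λ x y → *-comm (proj₁ x) (proj₁ y)
      }
    }

  HasSolutionIn : ∀ {p} → Pred Unit p → (a b c : Carrier) → Set (r ⊔ ℓ ⊔ p)
  HasSolutionIn P a b c = ∃ λ x → ∃ λ y → ∃ λ z →
    P x × P y × P z × (a * proj₁ x + b * proj₁ y) + c * proj₁ z ≈ 0#

productRing : ∀ {i c ℓ} {I : Set i} → (I → CommutativeRing c ℓ) →
              CommutativeRing (i ⊔ c) (i ⊔ ℓ)
productRing {I = I} R = record
  { Carrier = ∀ i → R.Carrier i
  ; _≈_     = λ x y → ∀ i → R._≈_ i (x i) (y i)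
  ; _+_     = λ x y i → R._+_ i (x i) (y i)
  ; _*_     = λ x y i → R._*_ i (x i) (y i)
  ; -_      = λ x i → R.-_ i (x i)
  ; 0#      = λ i → R.0# i
  ; 1#      = λ i → R.1# i
  ; isCommutativeRing = record
    { isRing = record
      { +-isAbelianGroup = record
        { isGroup = record
          { isMonoid = record
            { isSemigroup = record
              { isMagma = record
                { isEquivalence = record
                  { refl  = λ i → R.refl i
                  ; sym   = λ p i → R.sym i (p i)
                  ; trans = λ p q i → R.trans i (p i) (q i)
                  }
                ; ∙-cong = λ p q i → R.+-cong i (p i) (q i)
                }
              ; assoc = λ x y z i → R.+-assoc i (x i) (y i) (z i)
              }
            ; identity = (λ x i → R.+-identityˡ i (x i)) , (λ x i → R.+-identityʳ i (x i))
            }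
          ; inverse = (λ x i → R.-‿inverseˡ i (x i)) , (λ x i → R.-‿inverseʳ i (x i))
          ; ⁻¹-cong = λ p i → R.-‿cong i (p i)
          }
        ; comm = λ x y i → R.+-comm i (x i) (y i)
        }
      ; *-cong     = λ p q i → R.*-cong i (p i) (q i)
      ; *-assoc    = λ x y z i → R.*-assoc i (x i) (y i) (z i)
      ; *-identity = (λ x i → R.*-identityˡ i (x i)) , (λ x i → R.*-identityʳ i (x i))
      ; distrib    = (λ x y z i → R.distribˡ i (x i) (y i) (z i))
                   , (λ x y z i → R.distribʳ i (x i) (y i) (z i))
      }
    ; *-comm = λ x y i → R.*-comm i (x i) (y i)
    }
  }
  where module R (i : I) = CommutativeRing (R i)

-- The normalised absolute values of ℚ take rational values, so no reals
-- are needed here.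
record AbsoluteValue : Set where
  field
    ∥_∥       : ℚ → ℚ
    0≤∥_∥     : ∀ x → 0ℚ ℚ.≤ ∥ x ∥
    ∥0∥≡0     : ∥ 0ℚ ∥ ≡ 0ℚ
    ∥x∥≡0⇒x≡0 : ∀ x → ∥ x ∥ ≡ 0ℚ → x ≡ 0ℚ
    *-homo    : ∀ x y → ∥ x ℚ.* y ∥ ≡ ∥ x ∥ ℚ.* ∥ y ∥
    triangle  : ∀ x y → ∥ x ℚ.+ y ∥ ℚ.≤ ∥ x ∥ ℚ.+ ∥ y ∥

archimedean : AbsoluteValue
archimedean = record
  { ∥_∥       = ℚ.∣_∣
  ; 0≤∥_∥     = ℚ.0≤∣p∣
  ; ∥0∥≡0     = refl
  ; ∥x∥≡0⇒x≡0 = ℚ.∣p∣≡0⇒p≡0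
  ; *-homo    = ℚ.∣p*q∣≡∣p∣*∣q∣
  ; triangle  = ℚ.∣p+q∣≤∣p∣+∣q∣
  }

module _ (p : ℕ) (pr : Prime p) where
  open import Data.Nat.Base using (_^_; _*_; _<_; _≤_)

  private instance
    p≢0 : NonZero p
    p≢0 = prime⇒nonZero pr

  primePowerFactor : ∀ n .{{_ : NonZero n}} → Acc _<_ n →
                     ∃₂ λ k m → n ≡ p ^ k * m × ¬ p ∣ m
  primePowerFactor n _ with p ∣? n
  primePowerFactor n _        | no p∤n = 0 , n , sym (ℕ.*-identityˡ n) , p∤n
  primePowerFactor n (acc rs) | yes (divides q n≡qp) =
    let k , m , q≡ , p∤m = primePowerFactor q {{q≢0}} (rs q<n)
    in suc k , m , eq k q≡ , p∤m
    where
    q≢0 : NonZero q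
    q≢0 = ℕ.≢-nonZero λ { refl → ℕ.≢-nonZero⁻¹ n n≡qp }

    q<n : q < n
    q<n = subst (q <_) (sym n≡qp)
      (ℕ.m<m*n q p {{q≢0}} (ℕ.nonTrivial⇒n>1 p {{prime⇒nonTrivial pr}}))

    eq : ∀ k {m} → q ≡ p ^ k * m → n ≡ p * p ^ k * m
    eq k {m} q≡ = trans n≡qp (trans (ℕ.*-comm q p)
      (trans (cong (p *_) q≡) (sym (ℕ.*-assoc p (p ^ k) m))))

  ord : ∀ n .{{_ : NonZero n}} → ℕ
  ord n = proj₁ (primePowerFactor n (<-wellFounded n))

  padicAbs : ℚ → ℚ
  padicAbs (mkℚ (+ zero) d _) = 0ℚ
  padicAbs (mkℚ +[1+ n ] d _) = (+ (p ^ ord (suc d)) / (p ^ ord (suc n))) {{ℕ.m^n≢0 p (ord (suc n))}}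
  padicAbs (mkℚ -[1+ n ] d _) = (+ (p ^ ord (suc d)) / (p ^ ord (suc n))) {{ℕ.m^n≢0 p (ord (suc n))}}

  private
    N : ∀ n → .{{_ : NonZero n}} → ℕ
    N n = p ^ ord n

    N≢0 : ∀ n .{{_ : NonZero n}} → NonZero (N n)
    N≢0 n = ℕ.m^n≢0 p (ord n)

    cofactor : ∀ n .{{_ : NonZero n}} → ∃ λ m → n ≡ N n * m × ¬ p ∣ m
    cofactor n = proj₂ (primePowerFactor n (<-wellFounded n))

    exponent-unique : ∀ a b {m r} → p ^ a * m ≡ p ^ b * r → ¬ p ∣ m → ¬ p ∣ r → a ≡ b
    exponent-unique zero    zero    eq p∤m p∤r = refl
    exponent-unique zero    (suc b) {m} {r} eq p∤m p∤r = contradiction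
      (subst (p ∣_) (trans (sym (ℕ.*-assoc p (p ^ b) r)) (trans (sym eq) (ℕ.*-identityˡ m)))
        (m∣m*n (p ^ b * r))) p∤m
    exponent-unique (suc a) zero    {m} {r} eq p∤m p∤r = contradiction
      (subst (p ∣_) (trans (sym (ℕ.*-assoc p (p ^ a) m)) (trans eq (ℕ.*-identityˡ r)))
        (m∣m*n (p ^ a * m))) p∤r
    exponent-unique (suc a) (suc b) {m} {r} eq p∤m p∤r = cong suc
      (exponent-unique a b
        (ℕ.*-cancelˡ-≡ _ _ p
          (trans (sym (ℕ.*-assoc p (p ^ a) m)) (trans eq (ℕ.*-assoc p (p ^ b) r))))
        p∤m p∤r)

    N-* : ∀ m n .{{_ : NonZero m}} .{{_ : NonZero n}} .{{_ : NonZero (m * n)}} →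
          N (m * n) ≡ N m * N n
    N-* m n with cofactor m | cofactor n | cofactor (m * n)
    ... | m′ , m≡ , p∤m′ | n′ , n≡ , p∤n′ | k′ , k≡ , p∤k′ =
      trans (cong (p ^_) (exponent-unique (ord (m * n)) (ord m ℕ.+ ord n) eq p∤k′ p∤m′n′))
            (ℕ.^-distribˡ-+-* p (ord m) (ord n))
      where
      p∤m′n′ : ¬ p ∣ m′ * n′
      p∤m′n′ d with euclidsLemma m′ n′ pr d
      ... | inj₁ d = p∤m′ d
      ... | inj₂ d = p∤n′ d

      open ≡-Reasoning
      eq : N (m * n) * k′ ≡ p ^ (ord m ℕ.+ ord n) * (m′ * n′)
      eq = begin
        N (m * n) * k′                    ≡⟨ k≡ ⟨
        m * n                             ≡⟨ cong₂ _*_ m≡ n≡ ⟩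
        (N m * m′) * (N n * n′)           ≡⟨ ℕ.[m*n]*[o*p]≡[m*o]*[n*p] (N m) m′ (N n) n′ ⟩
        (N m * N n) * (m′ * n′)           ≡⟨ cong (_* (m′ * n′)) (ℕ.^-distribˡ-+-* p (ord m) (ord n)) ⟨
        p ^ (ord m ℕ.+ ord n) * (m′ * n′) ∎

    N-cong : ∀ {m n} .{{_ : NonZero m}} .{{_ : NonZero n}} → m ≡ n → N m ≡ N n
    N-cong refl = refl

    p^k∣n⇒k≤ord : ∀ k n .{{_ : NonZero n}} → p ^ k ∣ n → k ≤ ord n
    p^k∣n⇒k≤ord k n d with cofactor n
    ... | m , n≡ , p∤m = ℕ.≮⇒≥ λ o<k → p∤m
      (*-cancelˡ-∣ (N n) {{N≢0 n}} (subst (_∣ N n * m) (ℕ.*-comm p (N n))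
        (subst (p ^ suc (ord n) ∣_) n≡ (∣-trans (p^-mono-∣ o<k) d))))
      where
      p^-mono-∣ : ∀ {a b} → a ≤ b → p ^ a ∣ p ^ b
      p^-mono-∣ {a} a≤b = subst (λ c → p ^ a ∣ p ^ c) (ℕ.m+[n∸m]≡n a≤b)
        (subst (p ^ a ∣_) (sym (ℕ.^-distribˡ-+-* p a _)) (m∣m*n _))

    N∣ : ∀ k n .{{_ : NonZero n}} → k ≤ ord n → p ^ k ∣ n
    N∣ k n k≤o with cofactor n
    ... | m , n≡ , _ = subst (p ^ k ∣_) (sym n≡)
      (∣-trans (subst (λ c → p ^ k ∣ p ^ c) (ℕ.m+[n∸m]≡n k≤o)
                 (subst (p ^ k ∣_) (sym (ℕ.^-distribˡ-+-* p k _)) (m∣m*n _)))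
               (m∣m*n m))

    N-sum : ∀ i j .{{_ : NonZero ℤ.∣ i ∣}} .{{_ : NonZero ℤ.∣ j ∣}}
            .{{_ : NonZero ℤ.∣ i ℤ.+ j ∣}} → ord ℤ.∣ i ∣ ≤ ord ℤ.∣ j ∣ →
            N ℤ.∣ i ∣ ≤ N ℤ.∣ i ℤ.+ j ∣
    N-sum i j i≤j = ℕ.^-monoʳ-≤ p (p^k∣n⇒k≤ord (ord ℤ.∣ i ∣) ℤ.∣ i ℤ.+ j ∣
      (ℤ.∣⇒∣ᵤ {+ N ℤ.∣ i ∣} {i ℤ.+ j} (ℤ.∣m∣n⇒∣m+n
        (ℤ.∣ᵤ⇒∣ {+ N ℤ.∣ i ∣} {i} (N∣ (ord ℤ.∣ i ∣) ℤ.∣ i ∣ ℕ.≤-refl))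
        (ℤ.∣ᵤ⇒∣ {+ N ℤ.∣ i ∣} {j} (N∣ (ord ℤ.∣ i ∣) ℤ.∣ j ∣ i≤j)))))

    ι : ℕ → ℚ
    ι n = + n / 1

    toℚᵘ-/ : ∀ i n .{{_ : NonZero n}} → toℚᵘ (i / n) ℚᵘ.≃ i ℚᵘ./ n
    toℚᵘ-/ i (suc n) = ℚ.toℚᵘ-fromℚᵘ (ℚᵘ.mkℚᵘ i n)

    ι-* : ∀ m n → ι (m * n) ≡ ι m ℚ.* ι n
    ι-* m n = ℚ.toℚᵘ-injective (ℚᵘ.≃-trans (toℚᵘ-/ (+ (m * n)) 1) (ℚᵘ.≃-trans
      (ℚᵘ.*≡* (cong (ℤ._* (+ 1)) (ℤ.pos-* m n)))
      (ℚᵘ.≃-sym (ℚᵘ.≃-trans (ℚ.toℚᵘ-homo-* (ι m) (ι n))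
        (ℚᵘ.*-cong (toℚᵘ-/ (+ m) 1) (toℚᵘ-/ (+ n) 1))))))

    ι-mono : ∀ {m n} → m ≤ n → ι m ℚ.≤ ι n
    ι-mono {m} {n} m≤n = ℚ.toℚᵘ-cancel-≤
      (ℚᵘ.≤-respˡ-≃ (ℚᵘ.≃-sym (toℚᵘ-/ (+ m) 1)) (ℚᵘ.≤-respʳ-≃ (ℚᵘ.≃-sym (toℚᵘ-/ (+ n) 1))
        (ℚᵘ.*≤* (ℤ.*-monoʳ-≤-nonNeg (+ 1) (ℤ.+≤+ m≤n)))))

    ι-pos : ∀ n .{{_ : NonZero n}} → Positive (ι n)
    ι-pos (suc n) = ℚ.normalize-pos (suc n) 1

    /-* : ∀ m n .{{_ : NonZero n}} → (+ m / n) ℚ.* ι n ≡ ι m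
    /-* m n@(suc _) = ℚ.toℚᵘ-injective (ℚᵘ.≃-trans (ℚ.toℚᵘ-homo-* (+ m / n) (ι n))
      (ℚᵘ.≃-trans (ℚᵘ.*-cong (toℚᵘ-/ (+ m) n) (toℚᵘ-/ (+ n) 1)) (ℚᵘ.≃-trans
        (ℚᵘ.*≡* eq) (ℚᵘ.≃-sym (toℚᵘ-/ (+ m) 1)))))
      where
      eq : ((+ m) ℤ.* (+ n)) ℤ.* (+ 1) ≡ (+ m) ℤ.* (+ (n * 1))
      eq = trans (ℤ.*-identityʳ _) (cong (λ k → (+ m) ℤ.* (+ k)) (sym (ℕ.*-identityʳ n)))

    abs-↥↧ : ∀ x .{{_ : NonZero ℤ.∣ ↥ x ∣}} → padicAbs x ℚ.* ι (N ℤ.∣ ↥ x ∣) ≡ ι (N (↧ₙ x))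
    abs-↥↧ (mkℚ +[1+ n ] d _) = /-* (N (suc d)) (N (suc n)) {{N≢0 (suc n)}}
    abs-↥↧ (mkℚ -[1+ n ] d _) = /-* (N (suc d)) (N (suc n)) {{N≢0 (suc n)}}

    *-cancelʳ : ∀ {x y} r .{{_ : Positive r}} → x ℚ.* r ≡ y ℚ.* r → x ≡ y
    *-cancelʳ r eq = ℚ.≤-antisym (ℚ.*-cancelʳ-≤-pos r (ℚ.≤-reflexive eq))
                                 (ℚ.*-cancelʳ-≤-pos r (ℚ.≤-reflexive (sym eq)))

    -- ∣ i / d ∣ₚ = p ^ ord d / p ^ ord i, for any representation i / d.
    abs-rep : ∀ x i d .{{_ : NonZero ℤ.∣ ↥ x ∣}} .{{_ : NonZero ℤ.∣ i ∣}} .{{_ : NonZero d}} →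
              ↥ x ℤ.* (+ d) ≡ i ℤ.* ↧ x → padicAbs x ℚ.* ι (N ℤ.∣ i ∣) ≡ ι (N d)
    abs-rep x i d eq = *-cancelʳ (ι (N (↧ₙ x))) {{ι-pos (N (↧ₙ x)) {{N≢0 (↧ₙ x)}}}} $ begin
      padicAbs x ℚ.* ι (N ∣i∣) ℚ.* ι (N (↧ₙ x))   ≡⟨ ℚ.*-assoc (padicAbs x) _ _ ⟩
      padicAbs x ℚ.* (ι (N ∣i∣) ℚ.* ι (N (↧ₙ x))) ≡⟨ cong (padicAbs x ℚ.*_) Neq ⟨
      padicAbs x ℚ.* (ι (N ∣↥∣) ℚ.* ι (N d))      ≡⟨ ℚ.*-assoc (padicAbs x) _ _ ⟨
      padicAbs x ℚ.* ι (N ∣↥∣) ℚ.* ι (N d)        ≡⟨ cong (ℚ._* ι (N d)) (abs-↥↧ x) ⟩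
      ι (N (↧ₙ x)) ℚ.* ι (N d)                     ≡⟨ ℚ.*-comm (ι (N (↧ₙ x))) (ι (N d)) ⟩
      ι (N d) ℚ.* ι (N (↧ₙ x))                     ∎
      where
      open ≡-Reasoning
      ∣i∣ = ℤ.∣ i ∣
      ∣↥∣ = ℤ.∣ ↥ x ∣
      Neq : ι (N ∣↥∣) ℚ.* ι (N d) ≡ ι (N ∣i∣) ℚ.* ι (N (↧ₙ x))
      Neq = begin
        ι (N ∣↥∣) ℚ.* ι (N d)      ≡⟨ ι-* (N ∣↥∣) (N d) ⟨
        ι (N ∣↥∣ * N d)            ≡⟨ cong ι (N-* ∣↥∣ d {{it}} {{it}} {{ℕ.m*n≢0 ∣↥∣ d}}) ⟨
        ι (N (∣↥∣ * d) {{ℕ.m*n≢0 ∣↥∣ d}}) ≡⟨ cong ι (N-cong {{ℕ.m*n≢0 ∣↥∣ d}} {{ℕ.m*n≢0 ∣i∣ (↧ₙ x)}}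
            (trans (sym (ℤ.∣i*j∣≡∣i∣*∣j∣ (↥ x) (+ d)))
              (trans (cong ℤ.∣_∣ eq) (ℤ.∣i*j∣≡∣i∣*∣j∣ i (↧ x))))) ⟩
        ι (N (∣i∣ * ↧ₙ x) {{ℕ.m*n≢0 ∣i∣ (↧ₙ x)}}) ≡⟨ cong ι (N-* ∣i∣ (↧ₙ x) {{it}} {{it}} {{ℕ.m*n≢0 ∣i∣ (↧ₙ x)}}) ⟩
        ι (N ∣i∣ * N (↧ₙ x))       ≡⟨ ι-* (N ∣i∣) (N (↧ₙ x)) ⟩
        ι (N ∣i∣) ℚ.* ι (N (↧ₙ x)) ∎

    drop-≃ : ∀ x q → toℚᵘ x ℚᵘ.≃ q → ↥ x ℤ.* ℚᵘ.↧ q ≡ ℚᵘ.↥ q ℤ.* ↧ x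
    drop-≃ x@record{} q = ℚᵘ.drop-*≡*

    0≤padicAbs : ∀ x → 0ℚ ℚ.≤ padicAbs x
    0≤padicAbs (mkℚ (+ zero) d _) = ℚ.≤-refl
    0≤padicAbs (mkℚ +[1+ n ] d _) = ℚ.nonNegative⁻¹ _
      {{ℚ.normalize-nonNeg (N (suc d)) (N (suc n)) {{N≢0 (suc n)}}}}
    0≤padicAbs (mkℚ -[1+ n ] d _) = ℚ.nonNegative⁻¹ _
      {{ℚ.normalize-nonNeg (N (suc d)) (N (suc n)) {{N≢0 (suc n)}}}}

    ↥≢0 : ∀ x → x ≢ 0ℚ → NonZero ℤ.∣ ↥ x ∣
    ↥≢0 x x≢0 = ℕ.≢-nonZero λ e → x≢0 (ℚ.↥p≡0⇒p≡0 x (ℤ.∣i∣≡0⇒i≡0 e))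

    rep≢0 : ∀ x i d → x ≢ 0ℚ → .{{_ : NonZero d}} →
            ↥ x ℤ.* (+ d) ≡ i ℤ.* ↧ x → NonZero ℤ.∣ i ∣
    rep≢0 x i d@(suc _) x≢0 eq = ℕ.≢-nonZero λ e →
      x≢0 (ℚ.↥p≡0⇒p≡0 x (ℤ.*-cancelʳ-≡ (↥ x) (+ 0) (+ d)
        (trans eq (cong (ℤ._* ↧ x) (ℤ.∣i∣≡0⇒i≡0 {i} e)))))

    padicAbs≡0⇒x≡0 : ∀ x → padicAbs x ≡ 0ℚ → x ≡ 0ℚ
    padicAbs≡0⇒x≡0 x e with x ℚ.≟ 0ℚ
    ... | yes x≡0 = x≡0
    ... | no  x≢0 = contradiction
      (trans (sym (ℚ.*-zeroˡ (ι (N ℤ.∣ ↥ x ∣ {{nz}}))))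
        (trans (cong (ℚ._* ι (N ℤ.∣ ↥ x ∣ {{nz}})) (sym e)) (abs-↥↧ x {{nz}})))
      (ℚ.<⇒≢ (ℚ.positive⁻¹ _ {{ι-pos (N (↧ₙ x)) {{N≢0 (↧ₙ x)}}}}))
      where nz = ↥≢0 x x≢0

    padicAbs-* : ∀ x y → padicAbs (x ℚ.* y) ≡ padicAbs x ℚ.* padicAbs y
    padicAbs-* x y with x ℚ.≟ 0ℚ | y ℚ.≟ 0ℚ
    ... | yes refl | _        =
      trans (cong padicAbs (ℚ.*-zeroˡ y)) (sym (ℚ.*-zeroˡ (padicAbs y)))
    ... | no _     | yes refl =
      trans (cong padicAbs (ℚ.*-zeroʳ x)) (sym (ℚ.*-zeroʳ (padicAbs x)))
    ... | no x≢0   | no y≢0   = *-cancelʳ (ι (N m ℕ.* N n))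
        {{ι-pos (N m ℕ.* N n) {{ℕ.m*n≢0 (N m) (N n) {{N≢0 m}} {{N≢0 n}}}}}} $ begin
      padicAbs (x ℚ.* y) ℚ.* ι (N m ℕ.* N n)
        ≡⟨ cong (λ k → padicAbs (x ℚ.* y) ℚ.* ι k) mn ⟩
      padicAbs (x ℚ.* y) ℚ.* ι (N ℤ.∣ i ∣)
        ≡⟨ abs-rep (x ℚ.* y) i (d ℕ.* e) {{↥≢0 _ xy≢0}} eq ⟩
      ι (N (d ℕ.* e))                 ≡⟨ cong ι (N-* d e) ⟩
      ι (N d ℕ.* N e)                 ≡⟨ ι-* (N d) (N e) ⟩
      ι (N d) ℚ.* ι (N e)             ≡⟨ cong₂ ℚ._*_ (abs-↥↧ x) (abs-↥↧ y) ⟨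
      (padicAbs x ℚ.* ι (N m)) ℚ.* (padicAbs y ℚ.* ι (N n))
        ≡⟨ solve 4 (λ a b c d → (a :* b) :* (c :* d) := (a :* c) :* (b :* d)) refl
             (padicAbs x) (ι (N m)) (padicAbs y) (ι (N n)) ⟩
      (padicAbs x ℚ.* padicAbs y) ℚ.* (ι (N m) ℚ.* ι (N n))
        ≡⟨ cong (padicAbs x ℚ.* padicAbs y ℚ.*_) (ι-* (N m) (N n)) ⟨
      padicAbs x ℚ.* padicAbs y ℚ.* ι (N m ℕ.* N n) ∎
      where
      open ≡-Reasoning
      open +-*-Solver
      m = ℤ.∣ ↥ x ∣
      n = ℤ.∣ ↥ y ∣
      d = ↧ₙ x
      e = ↧ₙ y
      i = ↥ x ℤ.* ↥ y
      instance
        m≢0 : NonZero m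
        m≢0 = ↥≢0 x x≢0
        n≢0 : NonZero n
        n≢0 = ↥≢0 y y≢0
        i≢0 : NonZero ℤ.∣ i ∣
        i≢0 = subst NonZero (sym (ℤ.∣i*j∣≡∣i∣*∣j∣ (↥ x) (↥ y))) (ℕ.m*n≢0 m n)
      mn : N m ℕ.* N n ≡ N ℤ.∣ i ∣
      mn = trans (sym (N-* m n {{m≢0}} {{n≢0}} {{ℕ.m*n≢0 m n}}))
                 (N-cong {{ℕ.m*n≢0 m n}} (sym (ℤ.∣i*j∣≡∣i∣*∣j∣ (↥ x) (↥ y))))
      eq : ↥ (x ℚ.* y) ℤ.* (+ (d ℕ.* e)) ≡ i ℤ.* ↧ (x ℚ.* y)
      eq = *-rep x y
        where
        *-rep : ∀ x y → ↥ (x ℚ.* y) ℤ.* (+ (↧ₙ x ℕ.* ↧ₙ y)) ≡ (↥ x ℤ.* ↥ y) ℤ.* ↧ (x ℚ.* y)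
        *-rep x@record{} y@record{} = drop-≃ (x ℚ.* y) _ (ℚ.toℚᵘ-homo-* x y)
      xy≢0 : x ℚ.* y ≢ 0ℚ
      xy≢0 xy≡0 = ℕ.≢-nonZero⁻¹ ℤ.∣ i ∣ (cong ℤ.∣_∣ (ℤ.*-cancelʳ-≡ i (+ 0) (↧ (x ℚ.* y))
        (trans (sym eq) (cong (λ z → ↥ z ℤ.* (+ (d ℕ.* e))) xy≡0))))

    padicAbs-ultra-rep : ∀ x z i j d → .{{_ : NonZero d}} →
      .{{_ : NonZero ℤ.∣ i ∣}} → .{{_ : NonZero ℤ.∣ j ∣}} → .{{_ : NonZero ℤ.∣ i ℤ.+ j ∣}} →
      x ≢ 0ℚ → z ≢ 0ℚ →
      ↥ x ℤ.* (+ d) ≡ i ℤ.* ↧ x → ↥ z ℤ.* (+ d) ≡ (i ℤ.+ j) ℤ.* ↧ z →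
      ord ℤ.∣ i ∣ ≤ ord ℤ.∣ j ∣ → padicAbs z ℚ.≤ padicAbs x
    padicAbs-ultra-rep x z i j d x≢0 z≢0 x≡ z≡ i≤j =
      ℚ.*-cancelʳ-≤-pos (ι (N ℤ.∣ i ∣)) {{ι-pos (N ℤ.∣ i ∣) {{N≢0 ℤ.∣ i ∣}}}} (begin
        padicAbs z ℚ.* ι (N ℤ.∣ i ∣)
          ≤⟨ ℚ.*-monoˡ-≤-nonNeg (padicAbs z) {{ℚ.nonNegative (0≤padicAbs z)}}
               (ι-mono (N-sum i j i≤j)) ⟩
        padicAbs z ℚ.* ι (N ℤ.∣ i ℤ.+ j ∣) ≡⟨ abs-rep z (i ℤ.+ j) d {{↥≢0 z z≢0}} z≡ ⟩
        ι (N d)                            ≡⟨ abs-rep x i d {{↥≢0 x x≢0}} x≡ ⟨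
        padicAbs x ℚ.* ι (N ℤ.∣ i ∣)       ∎)
      where open ℚ.≤-Reasoning

    padicAbs-ultra : ∀ x y → padicAbs (x ℚ.+ y) ℚ.≤ padicAbs x ⊎ padicAbs (x ℚ.+ y) ℚ.≤ padicAbs y
    padicAbs-ultra x y with x ℚ.≟ 0ℚ | y ℚ.≟ 0ℚ | x ℚ.+ y ℚ.≟ 0ℚ
    ... | yes refl | _        | _ = inj₂ (ℚ.≤-reflexive (cong padicAbs (ℚ.+-identityˡ y)))
    ... | no _     | yes refl | _ = inj₁ (ℚ.≤-reflexive (cong padicAbs (ℚ.+-identityʳ x)))
    ... | no _     | no _     | yes e =
      inj₁ (subst (ℚ._≤ padicAbs x) (sym (cong padicAbs e)) (0≤padicAbs x))
    ... | no x≢0   | no y≢0   | no z≢0 = result (ℕ.≤-total (ord ℤ.∣ i ∣) (ord ℤ.∣ j ∣))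
      where
      d = ↧ₙ x ℕ.* ↧ₙ y
      i = ↥ x ℤ.* ↧ y
      j = ↥ y ℤ.* ↧ x
      x≡ : ↥ x ℤ.* (+ d) ≡ i ℤ.* ↧ x
      x≡ = trans (cong (λ k → ↥ x ℤ.* (+ k)) (ℕ.*-comm (↧ₙ x) (↧ₙ y)))
        (trans (cong (↥ x ℤ.*_) (ℤ.pos-* (↧ₙ y) (↧ₙ x))) (sym (ℤ.*-assoc (↥ x) (↧ y) (↧ x))))
      y≡ : ↥ y ℤ.* (+ d) ≡ j ℤ.* ↧ y
      y≡ = trans (cong (↥ y ℤ.*_) (ℤ.pos-* (↧ₙ x) (↧ₙ y))) (sym (ℤ.*-assoc (↥ y) (↧ x) (↧ y)))
      z≡ : ↥ (x ℚ.+ y) ℤ.* (+ d) ≡ (i ℤ.+ j) ℤ.* ↧ (x ℚ.+ y)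
      z≡ = +-rep x y
        where
        +-rep : ∀ x y → ↥ (x ℚ.+ y) ℤ.* (+ (↧ₙ x ℕ.* ↧ₙ y)) ≡
                        (↥ x ℤ.* ↧ y ℤ.+ ↥ y ℤ.* ↧ x) ℤ.* ↧ (x ℚ.+ y)
        +-rep x@record{} y@record{} = drop-≃ (x ℚ.+ y) _ (ℚ.toℚᵘ-homo-+ x y)
      z≡′ : ↥ (x ℚ.+ y) ℤ.* (+ d) ≡ (j ℤ.+ i) ℤ.* ↧ (x ℚ.+ y)
      z≡′ = trans z≡ (cong (ℤ._* ↧ (x ℚ.+ y)) (ℤ.+-comm i j))
      instance
        i≢0 : NonZero ℤ.∣ i ∣
        i≢0 = rep≢0 x i d x≢0 x≡
        j≢0 : NonZero ℤ.∣ j ∣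
        j≢0 = rep≢0 y j d y≢0 y≡
      result : ord ℤ.∣ i ∣ ≤ ord ℤ.∣ j ∣ ⊎ ord ℤ.∣ j ∣ ≤ ord ℤ.∣ i ∣ →
               padicAbs (x ℚ.+ y) ℚ.≤ padicAbs x ⊎ padicAbs (x ℚ.+ y) ℚ.≤ padicAbs y
      result (inj₁ i≤j) = inj₁ (padicAbs-ultra-rep x (x ℚ.+ y) i j d
        {{it}} {{i≢0}} {{j≢0}} {{rep≢0 (x ℚ.+ y) (i ℤ.+ j) d z≢0 z≡}} x≢0 z≢0 x≡ z≡ i≤j)
      result (inj₂ j≤i) = inj₂ (padicAbs-ultra-rep y (x ℚ.+ y) j i d
        {{it}} {{j≢0}} {{i≢0}} {{rep≢0 (x ℚ.+ y) (j ℤ.+ i) d z≢0 z≡′}} y≢0 z≢0 y≡ z≡′ j≤i)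

    padicAbs-triangle : ∀ x y → padicAbs (x ℚ.+ y) ℚ.≤ padicAbs x ℚ.+ padicAbs y
    padicAbs-triangle x y with padicAbs-ultra x y
    ... | inj₁ ≤x = ℚ.≤-trans (ℚ.≤-trans ≤x (ℚ.≤-reflexive (sym (ℚ.+-identityʳ _))))
                              (ℚ.+-monoʳ-≤ (padicAbs x) (0≤padicAbs y))
    ... | inj₂ ≤y = ℚ.≤-trans (ℚ.≤-trans ≤y (ℚ.≤-reflexive (sym (ℚ.+-identityˡ _))))
                              (ℚ.+-monoˡ-≤ (padicAbs y) (0≤padicAbs x))

  padic : AbsoluteValue
  padic = record
    { ∥_∥       = padicAbs
    ; 0≤∥_∥     = 0≤padicAbs
    ; ∥0∥≡0     = refl
    ; ∥x∥≡0⇒x≡0 = padicAbs≡0⇒x≡0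
    ; *-homo    = padicAbs-*
    ; triangle  = padicAbs-triangle
    }

module Completion (A : AbsoluteValue) where
  open AbsoluteValue A

  Cauchy : Pred (ℕ → ℚ) 0ℓ
  Cauchy s = ∀ ε → 0ℚ ℚ.< ε → ∃ λ K → ∀ m n → K ℕ.≤ m → K ℕ.≤ n → ∥ s m ℚ.- s n ∥ ℚ.< ε

  Null : Pred (ℕ → ℚ) 0ℓ
  Null s = ∀ ε → 0ℚ ℚ.< ε → ∃ λ K → ∀ n → K ℕ.≤ n → ∥ s n ∥ ℚ.< ε

  Point : Set
  Point = Σ (ℕ → ℚ) Cauchy

  private
    square-mono : ∀ {a b} → 0ℚ ℚ.≤ a → a ℚ.< b → a ℚ.* a ℚ.< b ℚ.* b
    square-mono {a} {b} 0≤a a<b = ℚ.≤-<-trans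
      (ℚ.*-monoˡ-≤-nonNeg a {{ℚ.nonNegative 0≤a}} (ℚ.<⇒≤ a<b))
      (ℚ.*-monoˡ-<-pos b {{ℚ.positive (ℚ.≤-<-trans 0≤a a<b)}} a<b)

    square-injective : ∀ {a b} → 0ℚ ℚ.≤ a → 0ℚ ℚ.≤ b → a ℚ.* a ≡ b ℚ.* b → a ≡ b
    square-injective {a} {b} 0≤a 0≤b eq with ℚ.<-cmp a b
    ... | tri≈ _ a≡b _ = a≡b
    ... | tri< a<b _ _ = contradiction eq (ℚ.<⇒≢ (square-mono 0≤a a<b))
    ... | tri> _ _ b<a = contradiction (sym eq) (ℚ.<⇒≢ (square-mono 0≤b b<a))

    ∥-x∥≡∥x∥ : ∀ x → ∥ ℚ.- x ∥ ≡ ∥ x ∥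
    ∥-x∥≡∥x∥ x = square-injective (0≤∥ ℚ.- x ∥) (0≤∥ x ∥)
      (trans (sym (*-homo (ℚ.- x) (ℚ.- x)))
        (trans (cong ∥_∥ (solve 1 (λ x → (:- x) :* (:- x) := x :* x) refl x)) (*-homo x x)))
      where open +-*-Solver

    -- Cauchy and null sequences are both handled as double sequences
    -- tending to 0.
    Small : Pred (ℕ → ℕ → ℚ) 0ℓ
    Small f = ∀ ε → 0ℚ ℚ.< ε → ∃ λ K → ∀ m n → K ℕ.≤ m → K ℕ.≤ n → ∥ f m n ∥ ℚ.< ε

    Bounded : Pred (ℕ → ℕ → ℚ) 0ℓ
    Bounded f = ∃ λ B → 0ℚ ℚ.< B × ∃ λ K → ∀ m n → K ℕ.≤ m → K ℕ.≤ n → ∥ f m n ∥ ℚ.≤ B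

    null⇒small : ∀ {s} → Null s → Small (λ m n → s m)
    null⇒small h ε ε>0 = let K , H = h ε ε>0 in K , λ m n K≤m K≤n → H m K≤m

    small⇒null : ∀ {s} → Small (λ m n → s m) → Null s
    small⇒null h ε ε>0 = let K , H = h ε ε>0 in K , λ n K≤n → H n n K≤n K≤n

    small-ext : ∀ {f g} → (∀ m n → f m n ≡ g m n) → Small f → Small g
    small-ext eq h ε ε>0 = let K , H = h ε ε>0 in
      K , λ m n K≤m K≤n → subst (λ x → ∥ x ∥ ℚ.< ε) (eq m n) (H m n K≤m K≤n)

    small-0 : Small (λ m n → 0ℚ)
    small-0 ε ε>0 = 0 , λ _ _ _ _ → subst (ℚ._< ε) (sym ∥0∥≡0) ε>0

    small-neg : ∀ {f} → Small f → Small (λ m n → ℚ.- f m n)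
    small-neg {f} h ε ε>0 = let K , H = h ε ε>0 in
      K , λ m n K≤m K≤n → subst (ℚ._< ε) (sym (∥-x∥≡∥x∥ (f m n))) (H m n K≤m K≤n)

    half-pos : ∀ {ε} → 0ℚ ℚ.< ε → 0ℚ ℚ.< ε ℚ.* ½
    half-pos {ε} ε>0 = subst (ℚ._< ε ℚ.* ½) (ℚ.*-zeroˡ ½) (ℚ.*-monoˡ-<-pos ½ ε>0)

    halves : ∀ ε → ε ℚ.* ½ ℚ.+ ε ℚ.* ½ ≡ ε
    halves ε = trans (sym (ℚ.*-distribˡ-+ ε ½ ½)) (ℚ.*-identityʳ ε)

    small-+ : ∀ {f g} → Small f → Small g → Small (λ m n → f m n ℚ.+ g m n)
    small-+ {f} {g} h k ε ε>0 =
      let K , H = h (ε ℚ.* ½) (half-pos ε>0)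
          L , J = k (ε ℚ.* ½) (half-pos ε>0)
      in K ℕ.⊔ L , λ m n ≤m ≤n → ℚ.≤-<-trans (triangle (f m n) (g m n))
        (subst (∥ f m n ∥ ℚ.+ ∥ g m n ∥ ℚ.<_) (halves ε) (ℚ.+-mono-<
          (H m n (ℕ.m⊔n≤o⇒m≤o K L ≤m) (ℕ.m⊔n≤o⇒m≤o K L ≤n))
          (J m n (ℕ.m⊔n≤o⇒n≤o K L ≤m) (ℕ.m⊔n≤o⇒n≤o K L ≤n))))

    small-* : ∀ {f g} → Bounded f → Small g → Small (λ m n → f m n ℚ.* g m n)
    small-* {f} {g} (B , B>0 , K , H) k ε ε>0 =
      let L , J = k δ δ>0
      in K ℕ.⊔ L , λ m n ≤m ≤n → subst (ℚ._< ε) (sym (*-homo (f m n) (g m n)))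
        (ℚ.≤-<-trans
          (ℚ.*-monoʳ-≤-nonNeg ∥ g m n ∥ {{ℚ.nonNegative (0≤∥ g m n ∥)}}
            (H m n (ℕ.m⊔n≤o⇒m≤o K L ≤m) (ℕ.m⊔n≤o⇒m≤o K L ≤n)))
          (subst (B ℚ.* ∥ g m n ∥ ℚ.<_) Bδ≡ε (ℚ.*-monoʳ-<-pos B
            (J m n (ℕ.m⊔n≤o⇒n≤o K L ≤m) (ℕ.m⊔n≤o⇒n≤o K L ≤n)))))
      where
      instance
        B-pos : Positive B
        B-pos = ℚ.positive B>0
        B≢0 : ℚ.NonZero B
        B≢0 = ℚ.pos⇒nonZero B
        1/B-pos : Positive (ℚ.1/ B)
        1/B-pos = ℚ.1/pos⇒pos B
      δ = ε ℚ.* ℚ.1/ B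
      δ>0 : 0ℚ ℚ.< δ
      δ>0 = subst (ℚ._< δ) (ℚ.*-zeroˡ (ℚ.1/ B)) (ℚ.*-monoˡ-<-pos (ℚ.1/ B) ε>0)
      Bδ≡ε : B ℚ.* δ ≡ ε
      Bδ≡ε = trans (ℚ.*-comm B δ) (trans (ℚ.*-assoc ε (ℚ.1/ B) B)
        (trans (cong (ε ℚ.*_) (ℚ.*-inverseˡ B)) (ℚ.*-identityʳ ε)))

    cauchy-bounded : ∀ {s} → Cauchy s → ∃ λ B → 0ℚ ℚ.< B ×
                     ∃ λ K → ∀ n → K ℕ.≤ n → ∥ s n ∥ ℚ.≤ B
    cauchy-bounded {s} h with h 1ℚ (ℚ.positive⁻¹ 1ℚ)
    ... | K , H = 1ℚ ℚ.+ ∥ s K ∥ ,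
      ℚ.<-≤-trans (ℚ.positive⁻¹ 1ℚ)
        (ℚ.≤-trans (ℚ.≤-reflexive (sym (ℚ.+-identityʳ 1ℚ))) (ℚ.+-monoʳ-≤ 1ℚ (0≤∥ s K ∥))) ,
      K , λ n K≤n → ℚ.≤-trans
        (ℚ.≤-reflexive (cong ∥_∥ (solve 2 (λ x y → x := (x :- y) :+ y) refl (s n) (s K))))
        (ℚ.≤-trans (triangle (s n ℚ.- s K) (s K))
          (ℚ.+-monoˡ-≤ ∥ s K ∥ (ℚ.<⇒≤ (H n K K≤n ℕ.≤-refl))))
      where open +-*-Solver

    boundedˡ : ∀ s → Cauchy s → Bounded (λ m n → s m)
    boundedˡ s c = let B , B>0 , K , H = cauchy-bounded c in B , B>0 , K , λ m n ≤m ≤n → H m ≤m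

    boundedʳ : ∀ s → Cauchy s → Bounded (λ m n → s n)
    boundedʳ s c = let B , B>0 , K , H = cauchy-bounded c in B , B>0 , K , λ m n ≤m ≤n → H n ≤n

    cauchy-+ : ∀ {s t} → Cauchy s → Cauchy t → Cauchy (λ n → s n ℚ.+ t n)
    cauchy-+ {s} {t} c d = small-ext
      (λ m n → solve 4 (λ a b c d → (a :- b) :+ (c :- d) := (a :+ c) :- (b :+ d)) refl
        (s m) (s n) (t m) (t n))
      (small-+ c d)
      where open +-*-Solver

    cauchy-neg : ∀ {s} → Cauchy s → Cauchy (λ n → ℚ.- s n)
    cauchy-neg {s} c = small-ext
      (λ m n → solve 2 (λ a b → :- (a :- b) := (:- a) :- (:- b)) refl (s m) (s n))
      (small-neg c)
      where open +-*-Solver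

    cauchy-* : ∀ {s t} → Cauchy s → Cauchy t → Cauchy (λ n → s n ℚ.* t n)
    cauchy-* {s} {t} c d = small-ext
      (λ m n → solve 4 (λ a b c d → a :* (c :- d) :+ d :* (a :- b) := a :* c :- b :* d) refl
        (s m) (s n) (t m) (t n))
      (small-+ (small-* (boundedˡ s c) d) (small-* (boundedʳ t d) c))
      where open +-*-Solver

  fromℚ : ℚ → Point
  fromℚ q = (λ _ → q) , small-ext (λ m n → sym (ℚ.+-inverseʳ q)) small-0

  infix 4 _≈_
  _≈_ : Point → Point → Set
  (s , _) ≈ (t , _) = Null (λ n → s n ℚ.- t n)

  private
    pointwise : ∀ {s t : Point} → (∀ n → proj₁ s n ≡ proj₁ t n) → s ≈ t
    pointwise {s , _} {t , _} eq = small⇒null (small-ext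
      (λ m n → sym (trans (cong (ℚ._- t m) (eq m)) (ℚ.+-inverseʳ (t m)))) small-0)

  completion : CommutativeRing 0ℓ 0ℓ
  completion = record
    { Carrier = Point
    ; _≈_     = _≈_
    ; _+_     = _+_
    ; _*_     = _*_
    ; -_      = -_
    ; 0#      = fromℚ 0ℚ
    ; 1#      = fromℚ 1ℚ
    ; isCommutativeRing = record
      { isRing = record
        { +-isAbelianGroup = record
          { isGroup = record
            { isMonoid = record
              { isSemigroup = record
                { isMagma = record
                  { isEquivalence = record
                    { refl  = λ {x} → pointwise {x} {x} λ _ → refl
                    ; sym   = λ {x} {y} → ≈-sym {x} {y}
                    ; trans = λ {x} {y} {z} → ≈-trans {x} {y} {z}
                    }
                  ; ∙-cong = λ {x} {y} {u} {v} → +-cong {x} {y} {u} {v}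
                  }
                ; assoc = λ x y z → pointwise {(x + y) + z} {x + (y + z)}
                    λ n → ℚ.+-assoc (proj₁ x n) (proj₁ y n) (proj₁ z n)
                }
              ; identity = (λ x → pointwise {fromℚ 0ℚ + x} {x} λ n → ℚ.+-identityˡ (proj₁ x n))
                         , (λ x → pointwise {x + fromℚ 0ℚ} {x} λ n → ℚ.+-identityʳ (proj₁ x n))
              }
            ; inverse = (λ x → pointwise {(- x) + x} {fromℚ 0ℚ} λ n → ℚ.+-inverseˡ (proj₁ x n))
                      , (λ x → pointwise {x + (- x)} {fromℚ 0ℚ} λ n → ℚ.+-inverseʳ (proj₁ x n))
            ; ⁻¹-cong = λ {x} {y} → neg-cong {x} {y}
            }
          ; comm = λ x y → pointwise {x + y} {y + x} λ n → ℚ.+-comm (proj₁ x n) (proj₁ y n)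
          }
        ; *-cong     = λ {x} {y} {u} {v} → *-cong {x} {y} {u} {v}
        ; *-assoc    = λ x y z → pointwise {(x * y) * z} {x * (y * z)}
            λ n → ℚ.*-assoc (proj₁ x n) (proj₁ y n) (proj₁ z n)
        ; *-identity = (λ x → pointwise {fromℚ 1ℚ * x} {x} λ n → ℚ.*-identityˡ (proj₁ x n))
                     , (λ x → pointwise {x * fromℚ 1ℚ} {x} λ n → ℚ.*-identityʳ (proj₁ x n))
        ; distrib    = (λ x y z → pointwise {x * (y + z)} {x * y + x * z}
                          λ n → ℚ.*-distribˡ-+ (proj₁ x n) (proj₁ y n) (proj₁ z n))
                     , (λ x y z → pointwise {(y + z) * x} {y * x + z * x}
                          λ n → ℚ.*-distribʳ-+ (proj₁ x n) (proj₁ y n) (proj₁ z n))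
        }
      ; *-comm = λ x y → pointwise {x * y} {y * x} λ n → ℚ.*-comm (proj₁ x n) (proj₁ y n)
      }
    }
    where
    open +-*-Solver
    infixl 6 _+_
    infixl 7 _*_

    _+_ : Point → Point → Point
    (s , c) + (t , d) = (λ n → s n ℚ.+ t n) , cauchy-+ {s} {t} c d

    _*_ : Point → Point → Point
    (s , c) * (t , d) = (λ n → s n ℚ.* t n) , cauchy-* {s} {t} c d

    -_ : Point → Point
    - (s , c) = (λ n → ℚ.- s n) , cauchy-neg {s} c

    ≈-sym : ∀ {x y} → x ≈ y → y ≈ x
    ≈-sym {s , _} {t , _} h = small⇒null (small-ext
      (λ m n → solve 2 (λ a b → :- (a :- b) := b :- a) refl (s m) (t m))
      (small-neg (null⇒small h)))

    ≈-trans : ∀ {x y z} → x ≈ y → y ≈ z → x ≈ z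
    ≈-trans {s , _} {t , _} {u , _} h k = small⇒null (small-ext
      (λ m n → solve 3 (λ a b c → (a :- b) :+ (b :- c) := a :- c) refl (s m) (t m) (u m))
      (small-+ (null⇒small h) (null⇒small k)))

    +-cong : ∀ {x y u v} → x ≈ y → u ≈ v → x + u ≈ y + v
    +-cong {s , _} {t , _} {u , _} {v , _} h k = small⇒null (small-ext
      (λ m n → solve 4 (λ a b c d → (a :- b) :+ (c :- d) := (a :+ c) :- (b :+ d)) refl
        (s m) (t m) (u m) (v m))
      (small-+ (null⇒small h) (null⇒small k)))

    neg-cong : ∀ {x y} → x ≈ y → - x ≈ - y
    neg-cong {s , _} {t , _} h = small⇒null (small-ext
      (λ m n → solve 2 (λ a b → :- (a :- b) := (:- a) :- (:- b)) refl (s m) (t m))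
      (small-neg (null⇒small h)))

    *-cong : ∀ {x y u v} → x ≈ y → u ≈ v → x * u ≈ y * v
    *-cong {s , c} {t , _} {u , _} {v , d} h k = small⇒null (small-ext
      (λ m n → solve 4 (λ a b c d → a :* (c :- d) :+ d :* (a :- b) := a :* c :- b :* d) refl
        (s m) (t m) (u m) (v m))
      (small-+ (small-* (boundedˡ s c) (null⇒small k)) (small-* (boundedˡ v d) (null⇒small h))))

  fromℚ-inverse : ∀ {u v} → u ℚ.* v ≡ 1ℚ →
                  CommutativeRing._*_ completion (fromℚ u) (fromℚ v) ≈ fromℚ 1ℚ
  fromℚ-inverse {u} {v} uv≡1 =
    pointwise {CommutativeRing._*_ completion (fromℚ u) (fromℚ v)} {fromℚ 1ℚ} λ _ → uv≡1

  -- lim ∥ s n - t n ∥ < ε, stated without forming the (in general real)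
  -- limit.
  _within_of_ : Point → ℚ → Point → Set
  (s , _) within ε of (t , _) =
    ∃ λ δ → δ ℚ.< ε × ∃ λ K → ∀ n → K ℕ.≤ n → ∥ s n ℚ.- t n ∥ ℚ.≤ δ

open Completion using (fromℚ; fromℚ-inverse; completion; _within_of_)

data Place : Set where
  ∞     : Place
  prime : (p : ℕ) → Prime p → Place

absoluteValue : Place → AbsoluteValue
absoluteValue ∞            = archimedean
absoluteValue (prime p pr) = padic p pr

ℚ-ring : CommutativeRing 0ℓ 0ℓ
ℚ-ring = ℚ.+-*-commutativeRing

ℚˣ : AbelianGroup 0ℓ 0ℓ
ℚˣ = units ℚ-ring

ℚ⟨_⟩ : Place → CommutativeRing 0ℓ 0ℓ
ℚ⟨ v ⟩ = completion (absoluteValue v)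

-- A finite set of places is a list without repetitions; with a
-- repetition, a factor would occur twice.
ℚ[_] : List Place → CommutativeRing 0ℓ 0ℓ
ℚ[ S ] = productRing (λ i → ℚ⟨ lookup S i ⟩)

module _ (S : List Place) where

  diagonal : ℚ → CommutativeRing.Carrier ℚ[ S ]
  diagonal q i = fromℚ (absoluteValue (lookup S i)) q

  diagonalˣ : Unit ℚ-ring → Unit ℚ[ S ]
  diagonalˣ (u , v , uv≡1) = diagonal u , diagonal v ,
    λ i → fromℚ-inverse (absoluteValue (lookup S i)) {u} {v} uv≡1

  image : Pred (Unit ℚ-ring) 0ℓ → Pred (Unit ℚ[ S ]) 0ℓ
  image P y = ∃ λ g → P g × AbelianGroup._≈_ (units ℚ[ S ]) (diagonalˣ g) y

  -- The balls of radius ε i around x i give a basic neighbourhood of x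
  -- in the product of the ℚᵥˣ.  Each ℚᵥˣ has the topology induced from
  -- ℚᵥ, which is also its topology as a unit group, as inversion is
  -- continuous on ℚᵥˣ.
  closure : Pred (Unit ℚ[ S ]) 0ℓ → Pred (Unit ℚ[ S ]) 0ℓ
  closure P (x , _) = ∀ (ε : Fin (length S) → ℚ) → (∀ i → 0ℚ ℚ.< ε i) →
    ∃ λ y → P y × ∀ i →
      _within_of_ (absoluteValue (lookup S i)) (proj₁ y i) (ε i) (x i)

  closureIn : Subgroup (AbelianGroup.group ℚˣ) 0ℓ → Pred (Unit ℚ[ S ]) 0ℓ
  closureIn G = closure (image (Subgroup.Member G))

{-# OPTIONS --safe #-}
module Submission where

-- Choose M such that each class of ℚˣ / G found close to 1, as measured
-- by M, at ∞ and at the primes dividing M is found arbitrarily close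
-- to 1.  A local solution at these places yields X ∈ a G, Y ∈ b G and
-- Z ∈ c G whose sum E is small compared with X; say X and Y have the
-- same sign.  As (X - E) + Y + Z = 0, one may write X - E and Y as A and
-- B up to a common factor.  It remains to solve A u + B w = (A + B) v in
-- positive integers with v and w in one class g and u in the class of
-- g X / (X - E), which is g times a class found close to 1.
--
-- Among the progressions of integers ≡ 1 mod M, which are long but short
-- compared with their terms, take one in which the density of some class
-- g is nearly maximal.  Subprogressions then have nearly the same
-- density.  Let u run over the products e s x with s in a finite set and
-- x in a long progression.  The differences of the corresponding shifts
-- run over progressions in x for each pair of values of s, so the second
-- moment method (van der Corput's inequality) shows that the average of
-- the indicator function of g over these shifts is almost everywhere
-- close to the density.  So some u allows v and w in g.  Here x and s are
-- restricted to popular classes, and as the finitely many candidates for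
-- e are close to each other, the choice of e does not affect the ranges
-- of s and x; hence e can be chosen last, to put u into its class.

open import Defs
open import Algebra.Bundles using (AbelianGroup)
open import Data.List.Base using (List)
open import Data.List.Relation.Unary.Unique.Propositional using (Unique)
open import Data.Product.Base using (proj₁)
open import Function.Bundles using (_⇔_; mk⇔)
open import Level using (0ℓ)

-- The class of an integer may depend on its prime factors arbitrarily: any choice of signs at the
-- primes defines a subgroup of index at most 2. So in general no congruence controls the classes,
-- and counting finds integers only in a class that happens to be dense. Hence v and w share a class
-- that is not prescribed, and the one prescribed class, that of u, is reached by dilation.
--
-- The order of the choices shapes the rest. An upper bound for the density of subprogressions is
-- available only for finitely many steps at a time, and only beyond a length that depends on them.
-- So all steps must be bounded before the window is known; this is the purpose of the many explicit
-- bounds.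
--
-- Densities are counted in units of 1 / Q: the density q / Q occurs in arbitrarily long windows of
-- some fixed shape, (q + 1) / Q does not. This bounds the density from below in the window and from
-- above in its subprogressions, and the variance estimate needs only these one-sided bounds. The
-- unit has to be fine compared with 1 / n and with the coefficients, whence p₀ = 40 (A + B) n³ and
-- Q = n p₀.

-- Finite sums, the pigeonhole principle and the second moment estimate.

module Sums where
  open import Data.Integer.Base using (ℤ; +_; _+_; _*_; _-_; -_; _≤_; 0ℤ; 1ℤ; nonNegative)
  import Data.Integer.Properties as ℤ
  open import Data.Integer.Tactic.RingSolver using (solve-∀)
  open import Data.Nat.Base as ℕ using (ℕ; zero; suc; s≤s; z≤n)
  import Data.Nat.Properties as ℕ
  open import Data.Product.Base using (∃; _×_; _,_; proj₁; proj₂)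
  open import Data.Sum.Base using (_⊎_; inj₁; inj₂)
  open import Function.Base using (_∘_)
  open import Relation.Binary.Definitions using (tri<; tri≈; tri>)
  open import Relation.Binary.PropositionalEquality
  open import Relation.Nullary using (yes; no; contradiction)

  mul-≤ : ∀ {a b} c → 0ℤ ≤ c → a ≤ b → c * a ≤ c * b
  mul-≤ c 0≤c = ℤ.*-monoˡ-≤-nonNeg c {{nonNegative 0≤c}}

  mul-≤ʳ : ∀ {a b} c → 0ℤ ≤ c → a ≤ b → a * c ≤ b * c
  mul-≤ʳ c 0≤c = ℤ.*-monoʳ-≤-nonNeg c {{nonNegative 0≤c}}

  0≤* : ∀ {a b} → 0ℤ ≤ a → 0ℤ ≤ b → 0ℤ ≤ a * b
  0≤* {a} {b} 0≤a 0≤b = subst (_≤ a * b) (ℤ.*-zeroʳ a) (mul-≤ a 0≤a 0≤b)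

  0≤+ : ∀ {a b} → 0ℤ ≤ a → 0ℤ ≤ b → 0ℤ ≤ a + b
  0≤+ = ℤ.+-mono-≤

  0≤⁺ : ∀ n → 0ℤ ≤ + n
  0≤⁺ n = _≤_.+≤+ z≤n

  Σ : ℕ → (ℕ → ℤ) → ℤ
  Σ zero    f = 0ℤ
  Σ (suc n) f = f 0 + Σ n (f ∘ suc)

  Σ-cong : ∀ n {f g} → (∀ i → i ℕ.< n → f i ≡ g i) → Σ n f ≡ Σ n g
  Σ-cong zero    eq = refl
  Σ-cong (suc n) eq = cong₂ _+_ (eq 0 (s≤s z≤n)) (Σ-cong n λ i i<n → eq (suc i) (s≤s i<n))

  Σ-mono : ∀ n {f g} → (∀ i → i ℕ.< n → f i ≤ g i) → Σ n f ≤ Σ n g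
  Σ-mono zero    le = ℤ.≤-refl
  Σ-mono (suc n) le = ℤ.+-mono-≤ (le 0 (s≤s z≤n)) (Σ-mono n λ i i<n → le (suc i) (s≤s i<n))

  Σ-+ : ∀ n f g → Σ n (λ i → f i + g i) ≡ Σ n f + Σ n g
  Σ-+ zero    f g = refl
  Σ-+ (suc n) f g = trans (cong (_+_ (f 0 + g 0)) (Σ-+ n (f ∘ suc) (g ∘ suc)))
    (interchange (f 0) (g 0) (Σ n (f ∘ suc)) (Σ n (g ∘ suc)))
    where
    interchange : ∀ a b c d → (a + b) + (c + d) ≡ (a + c) + (b + d)
    interchange = solve-∀

  Σ-*ˡ : ∀ n c f → Σ n (λ i → c * f i) ≡ c * Σ n f
  Σ-*ˡ zero    c f = sym (ℤ.*-zeroʳ c)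
  Σ-*ˡ (suc n) c f = trans (cong (_+_ (c * f 0)) (Σ-*ˡ n c (f ∘ suc))) (sym (ℤ.*-distribˡ-+ c (f 0) _))

  Σ-*ʳ : ∀ n c f → Σ n (λ i → f i * c) ≡ Σ n f * c
  Σ-*ʳ n c f = trans (Σ-cong n λ i _ → ℤ.*-comm (f i) c) (trans (Σ-*ˡ n c f) (ℤ.*-comm c _))

  Σ-const : ∀ n c → Σ n (λ _ → c) ≡ + n * c
  Σ-const zero    c = sym (ℤ.*-zeroˡ c)
  Σ-const (suc n) c = trans (cong (_+_ c) (Σ-const n c)) (sym (ℤ.suc-* (+ n) c))

  Σ-≤const : ∀ n {f} c → (∀ i → i ℕ.< n → f i ≤ c) → Σ n f ≤ + n * c
  Σ-≤const n c le = ℤ.≤-trans (Σ-mono n le) (ℤ.≤-reflexive (Σ-const n c))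

  Σ-nonneg : ∀ n {f} → (∀ i → i ℕ.< n → 0ℤ ≤ f i) → 0ℤ ≤ Σ n f
  Σ-nonneg zero    h = ℤ.≤-refl
  Σ-nonneg (suc n) h = 0≤+ (h 0 (s≤s z≤n)) (Σ-nonneg n λ i i<n → h (suc i) (s≤s i<n))

  Σ-swap : ∀ m n (f : ℕ → ℕ → ℤ) → Σ m (λ i → Σ n (f i)) ≡ Σ n (λ j → Σ m (λ i → f i j))
  Σ-swap zero    n f = sym (trans (Σ-const n 0ℤ) (ℤ.*-zeroʳ (+ n)))
  Σ-swap (suc m) n f = trans (cong (_+_ (Σ n (f 0))) (Σ-swap m n (f ∘ suc)))
    (sym (Σ-+ n (f 0) (λ j → Σ m (λ i → f (suc i) j))))

  Σ-split : ∀ m n f → Σ (m ℕ.+ n) f ≡ Σ m f + Σ n (λ i → f (m ℕ.+ i))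
  Σ-split zero    n f = sym (ℤ.+-identityˡ _)
  Σ-split (suc m) n f = trans (cong (_+_ (f 0)) (Σ-split m n (f ∘ suc))) (sym (ℤ.+-assoc (f 0) _ _))

  Σ-block : ∀ D K f → Σ (K ℕ.* D) f ≡ Σ D (λ b → Σ K (λ k → f (k ℕ.* D ℕ.+ b)))
  Σ-block D K f = trans (rows K f) (Σ-swap K D (λ k b → f (k ℕ.* D ℕ.+ b)))
    where
    rows : ∀ K f → Σ (K ℕ.* D) f ≡ Σ K (λ k → Σ D (λ b → f (k ℕ.* D ℕ.+ b)))
    rows zero    f = refl
    rows (suc K) f = trans (Σ-split D (K ℕ.* D) f) (cong (_+_ (Σ D f))
      (trans (rows K (λ i → f (D ℕ.+ i))) (Σ-cong K λ k _ → Σ-cong D λ b _ →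
        cong f (sym (ℕ.+-assoc D (k ℕ.* D) b)))))

  Σ-first : ∀ n {f} → 0 ℕ.< n → (∀ i → i ℕ.< n → 0ℤ ≤ f i) → f 0 ≤ Σ n f
  Σ-first (suc n) {f} _ h = ℤ.≤-trans (ℤ.≤-reflexive (sym (ℤ.+-identityʳ (f 0))))
    (ℤ.+-monoʳ-≤ (f 0) (Σ-nonneg n λ i i<n → h (suc i) (s≤s i<n)))

  Bounded : ℤ → (ℕ → ℤ) → Set
  Bounded B f = ∀ m → - B ≤ f m × f m ≤ B

  -- Each unit of shift drops one term of the sum and adds another, at a cost of at most B + B.
  Σ-shift : ∀ K α {f B} → Bounded B f → Σ K (λ k → f (k ℕ.+ α)) ≤ Σ K f + + α * (B + B)
  Σ-shift K zero {f} {B} b = ℤ.≤-reflexive (trans (Σ-cong K λ k _ → cong f (ℕ.+-identityʳ k))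
    (trans (sym (ℤ.+-identityʳ _)) (cong (_+_ (Σ K f)) (sym (ℤ.*-zeroˡ (B + B))))))
  Σ-shift K (suc α) {f} {B} b = begin
    Σ K (λ k → f (k ℕ.+ suc α))              ≡⟨ Σ-cong K (λ k _ → cong f (ℕ.+-suc k α)) ⟩
    Σ K (λ k → f (suc (k ℕ.+ α)))            ≤⟨ Σ-shift K α (b ∘ suc) ⟩
    Σ K (f ∘ suc) + + α * (B + B)            ≡⟨ regroup (f 0) (Σ K (f ∘ suc)) (+ α) B ⟩
    (Σ (suc K) f + - f 0) + + α * (B + B)    ≡⟨ cong (λ z → (z + - f 0) + + α * (B + B)) (last K f) ⟩
    (Σ K f + f K + - f 0) + + α * (B + B)
      ≤⟨ ℤ.+-monoˡ-≤ (+ α * (B + B)) (ℤ.+-mono-≤ (ℤ.+-monoʳ-≤ (Σ K f) (proj₂ (b K)))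
           (ℤ.≤-trans (ℤ.neg-mono-≤ (proj₁ (b 0))) (ℤ.≤-reflexive (ℤ.neg-involutive B)))) ⟩
    (Σ K f + B + B) + + α * (B + B)          ≡⟨ collect (Σ K f) B (+ α) ⟩
    Σ K f + (1ℤ + + α) * (B + B)             ∎
    where
    open ℤ.≤-Reasoning
    last : ∀ K f → Σ (suc K) f ≡ Σ K f + f K
    last K f = trans (cong (λ n → Σ n f) (ℕ.+-comm 1 K)) (trans (Σ-split K 1 f)
      (cong (_+_ (Σ K f)) (trans (ℤ.+-identityʳ _) (cong f (ℕ.+-identityʳ K)))))
    regroup : ∀ x s a B → s + a * (B + B) ≡ ((x + s) + - x) + a * (B + B)
    regroup = solve-∀
    collect : ∀ s B a → (s + B + B) + a * (B + B) ≡ s + (1ℤ + a) * (B + B)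
    collect = solve-∀

  ind : ℕ → ℕ → ℤ
  ind x c with x ℕ.≟ c
  ... | yes _ = 1ℤ
  ... | no  _ = 0ℤ

  ind-01 : ∀ x c → (ind x c ≡ 0ℤ × x ≢ c) ⊎ (ind x c ≡ 1ℤ × x ≡ c)
  ind-01 x c with x ℕ.≟ c
  ... | yes x≡c = inj₂ (refl , x≡c)
  ... | no  x≢c = inj₁ (refl , x≢c)

  0≤ind : ∀ x c → 0ℤ ≤ ind x c
  0≤ind x c with x ℕ.≟ c
  ... | yes _ = 0≤⁺ 1
  ... | no  _ = 0≤⁺ 0

  ind≤1 : ∀ x c → ind x c ≤ 1ℤ
  ind≤1 x c with x ℕ.≟ c
  ... | yes _ = ℤ.≤-refl
  ... | no  _ = 0≤⁺ 1

  ind-refl : ∀ x → ind x x ≡ 1ℤ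
  ind-refl x with x ℕ.≟ x
  ... | yes _   = refl
  ... | no  x≢x = contradiction refl x≢x

  Σ-ind : ∀ n x → x ℕ.< n → Σ n (ind x) ≡ 1ℤ
  Σ-ind (suc n) zero    _         = trans (cong₂ _+_ (ind-refl 0)
    (trans (Σ-cong n λ i _ → zero-suc i) (trans (Σ-const n 0ℤ) (ℤ.*-zeroʳ (+ n))))) refl
    where
    zero-suc : ∀ i → ind 0 (suc i) ≡ 0ℤ
    zero-suc i = refl
  Σ-ind (suc n) (suc x) (s≤s x<n) = trans (ℤ.+-identityˡ _)
    (trans (Σ-cong n λ i _ → suc-suc i) (Σ-ind n x x<n))
    where
    suc-suc : ∀ i → ind (suc x) (suc i) ≡ ind x i
    suc-suc i with ind-01 (suc x) (suc i) | ind-01 x i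
    ... | inj₁ (p , _) | inj₁ (q , _) = trans p (sym q)
    ... | inj₂ (p , _) | inj₂ (q , _) = trans p (sym q)
    ... | inj₁ (_ , p) | inj₂ (_ , q) = contradiction (cong suc q) p
    ... | inj₂ (_ , p) | inj₁ (_ , q) = contradiction (ℕ.suc-injective p) q

  -- Pigeonhole: the counts of the n values add up to I, so the largest of them is at least I / n.
  popular : ∀ n I (f : ℕ → ℕ) → 0 ℕ.< I → (∀ i → f i ℕ.< n) →
            ∃ λ g → g ℕ.< n × + I ≤ + n * Σ I (λ i → ind (f i) g)
  popular n I f I>0 f<n = let g , g<n , max = maximum n count (ℕ.≤-<-trans z≤n (f<n 0)) in
    g , g<n , (begin
      + I                                       ≡⟨ ℤ.*-identityʳ (+ I) ⟨
      + I * 1ℤ                                  ≡⟨ Σ-const I 1ℤ ⟨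
      Σ I (λ i → 1ℤ)                            ≡⟨ Σ-cong I (λ i _ → Σ-ind n (f i) (f<n i)) ⟨
      Σ I (λ i → Σ n (ind (f i)))               ≡⟨ Σ-swap I n (λ i → ind (f i)) ⟩
      Σ n count                                 ≤⟨ Σ-≤const n (count g) max ⟩
      + n * count g                             ∎)
    where
    open ℤ.≤-Reasoning
    count : ℕ → ℤ
    count g = Σ I (λ i → ind (f i) g)
    maximum : ∀ n (h : ℕ → ℤ) → 0 ℕ.< n → ∃ λ g → g ℕ.< n × (∀ i → i ℕ.< n → h i ≤ h g)
    maximum (suc zero)      h _ = 0 , s≤s z≤n , λ { zero _ → ℤ.≤-refl ; (suc _) (s≤s ()) }
    maximum (suc n@(suc _)) h _ with maximum n (h ∘ suc) (s≤s z≤n)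
    ... | g , g<n , max with ℤ.≤-total (h 0) (h (suc g))
    ...   | inj₁ le = suc g , s≤s g<n , λ { zero _ → le ; (suc i) (s≤s i<n) → max i i<n }
    ...   | inj₂ ge = 0 , s≤s z≤n , λ { zero _ → ℤ.≤-refl ; (suc i) (s≤s i<n) → ℤ.≤-trans (max i i<n) ge }

  Σ-pos⇒∃ : ∀ I (f : ℕ → ℕ) g → 1ℤ ≤ Σ I (λ i → ind (f i) g) → ∃ λ i → i ℕ.< I × f i ≡ g
  Σ-pos⇒∃ (suc I) f g h with ind-01 (f 0) g
  ... | inj₂ (_ , e) = 0 , s≤s z≤n , e
  ... | inj₁ (e , _) =
    let i , i<I , eq = Σ-pos⇒∃ I (f ∘ suc) g
          (subst (1ℤ ≤_) (trans (cong (_+ Σ I (λ i → ind (f (suc i)) g)) e) (ℤ.+-identityˡ _)) h)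
    in suc i , s≤s i<I , eq
  Σ-pos⇒∃ zero f g (_≤_.+≤+ ())

  -- In the application `ψ` is p minus Q times the indicator function of a class, where the density
  -- p / Q is not reached along long progressions. This is the origin of the two one-sided
  -- hypotheses: `pos` for the progressions, and `ψ-total`, by which the whole sum is nevertheless
  -- small. The average over y is essential: a single translate of `ψ` is not controlled, but k + β
  -- i j y runs along a progression as y varies.
  module Variance
    (ψ : ℕ → ℤ) (Ψ : ℤ) (0≤Ψ : 0ℤ ≤ Ψ) (ψ-bounded : Bounded Ψ ψ)
    (K H S D : ℕ) (θ : ℕ → ℤ) (0≤θ : ∀ i → 0ℤ ≤ θ i) (θ≤1 : ∀ i → θ i ≤ 1ℤ)
    (α : ℕ → ℕ → ℕ) (α≤D : ∀ i y → i ℕ.< S → y ℕ.< H → α i y ℕ.≤ D)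
    (β : ℕ → ℕ → ℕ → ℕ)
    (α+β : ∀ i j y → i ℕ.< j → α j y ≡ α i y ℕ.+ β i j y)
    (pos : ∀ i j k → i ℕ.< j → j ℕ.< S → k ℕ.< K → 0ℤ ≤ Σ H (λ y → ψ (k ℕ.+ β i j y)))
    (Z : ℤ) (0≤Z : 0ℤ ≤ Z) (ψ-total : Σ K ψ ≤ Z) where

    private
      U : ℤ
      U = + K * (+ H * (Ψ * Ψ))

      V : ℤ
      V = Ψ * (Z + + D * (Ψ + Ψ)) + + D * (Ψ * Ψ + Ψ * Ψ)

      W : ℤ
      W = + H * V

      0≤V : 0ℤ ≤ V
      0≤V = 0≤+ (0≤* 0≤Ψ (0≤+ 0≤Z (0≤* (0≤⁺ D) (0≤+ 0≤Ψ 0≤Ψ))))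
                (0≤* (0≤⁺ D) (0≤+ (0≤* 0≤Ψ 0≤Ψ) (0≤* 0≤Ψ 0≤Ψ)))

      0≤W : 0ℤ ≤ W
      0≤W = 0≤* (0≤⁺ H) 0≤V

      0≤U : 0ℤ ≤ U
      0≤U = 0≤* (0≤⁺ K) (0≤* (0≤⁺ H) (0≤* 0≤Ψ 0≤Ψ))

      -- Adding (Ψ + x) (Ψ + y) and (Ψ - x) (Ψ - y) gives twice Ψ² + x y, and the mixed products
      -- give twice Ψ² - x y. This avoids distinguishing signs.
      product-bounded : ∀ {x y} → - Ψ ≤ x → x ≤ Ψ → - Ψ ≤ y → y ≤ Ψ → - (Ψ * Ψ) ≤ x * y × x * y ≤ Ψ * Ψ
      product-bounded {x} {y} lx ux ly uy =
        ℤ.0≤i-j⇒j≤i (halve s t) ,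
        ℤ.0≤i-j⇒j≤i (halve′ s′ t′)
        where
        a+ : 0ℤ ≤ Ψ + x
        a+ = subst (0ℤ ≤_) (flip Ψ x) (ℤ.i≤j⇒0≤j-i lx)
          where flip : ∀ Ψ x → x - (- Ψ) ≡ Ψ + x
                flip = solve-∀
        b+ : 0ℤ ≤ Ψ + y
        b+ = subst (0ℤ ≤_) (flip Ψ y) (ℤ.i≤j⇒0≤j-i ly)
          where flip : ∀ Ψ x → x - (- Ψ) ≡ Ψ + x
                flip = solve-∀
        a- : 0ℤ ≤ Ψ - x
        a- = ℤ.i≤j⇒0≤j-i ux
        b- : 0ℤ ≤ Ψ - y
        b- = ℤ.i≤j⇒0≤j-i uy
        s = 0≤* a+ b+
        t = 0≤* a- b-
        s′ = 0≤* a+ b-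
        t′ = 0≤* a- b+
        double : ∀ z → 0ℤ ≤ z + z → 0ℤ ≤ z
        double z h = ℤ.*-cancelˡ-≤-pos 0ℤ z (+ 2) (subst (0ℤ ≤_) (two z) h)
          where two : ∀ z → z + z ≡ + 2 * z
                two = solve-∀
        halve : 0ℤ ≤ (Ψ + x) * (Ψ + y) → 0ℤ ≤ (Ψ - x) * (Ψ - y) → 0ℤ ≤ x * y - - (Ψ * Ψ)
        halve p q = double _ (subst (0ℤ ≤_) (eq Ψ x y) (0≤+ p q))
          where eq : ∀ Ψ x y → (Ψ + x) * (Ψ + y) + (Ψ - x) * (Ψ - y) ≡ (x * y - - (Ψ * Ψ)) + (x * y - - (Ψ * Ψ))
                eq = solve-∀
        halve′ : 0ℤ ≤ (Ψ + x) * (Ψ - y) → 0ℤ ≤ (Ψ - x) * (Ψ + y) → 0ℤ ≤ Ψ * Ψ - x * y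
        halve′ p q = double _ (subst (0ℤ ≤_) (eq Ψ x y) (0≤+ p q))
          where eq : ∀ Ψ x y → (Ψ + x) * (Ψ - y) + (Ψ - x) * (Ψ + y) ≡ (Ψ * Ψ - x * y) + (Ψ * Ψ - x * y)
                eq = solve-∀

      pair-bounded : ∀ m m′ → - (Ψ * Ψ) ≤ ψ m * ψ m′ × ψ m * ψ m′ ≤ Ψ * Ψ
      pair-bounded m m′ = product-bounded (proj₁ (ψ-bounded m)) (proj₂ (ψ-bounded m))
                                          (proj₁ (ψ-bounded m′)) (proj₂ (ψ-bounded m′))

      corr : ℕ → ℕ → ℤ
      corr i j = Σ K (λ k → Σ H (λ y → ψ (k ℕ.+ α i y) * ψ (k ℕ.+ α j y)))

      corr-diag : ∀ i → corr i i ≤ U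
      corr-diag i = Σ-≤const K (+ H * (Ψ * Ψ)) λ k _ → Σ-≤const H (Ψ * Ψ) λ y _ → proj₂ (pair-bounded (k ℕ.+ α i y) (k ℕ.+ α i y))

      corr-sym : ∀ i j → corr i j ≡ corr j i
      corr-sym i j = Σ-cong K λ k _ → Σ-cong H λ y _ → ℤ.*-comm (ψ (k ℕ.+ α i y)) _

      -- The sum over y of ψ is nonnegative along each progression, so the
      -- factor ψ k can be replaced by its upper bound Ψ.
      corr-off : ∀ i j → i ℕ.< j → j ℕ.< S → corr i j ≤ W
      corr-off i j i<j j<S = begin
        corr i j
          ≡⟨ Σ-swap K H (λ k y → ψ (k ℕ.+ α i y) * ψ (k ℕ.+ α j y)) ⟩
        Σ H (λ y → Σ K (λ k → ψ (k ℕ.+ α i y) * ψ (k ℕ.+ α j y)))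
          ≡⟨ Σ-cong H (λ y _ → Σ-cong K λ k _ → cong (λ m → ψ (k ℕ.+ α i y) * ψ m)
               (trans (cong (k ℕ.+_) (α+β i j y i<j)) (sym (ℕ.+-assoc k (α i y) _)))) ⟩
        Σ H (λ y → Σ K (λ k → F y (k ℕ.+ α i y)))
          ≤⟨ Σ-mono H (λ y y<H → ℤ.≤-trans (Σ-shift K (α i y) λ m → pair-bounded m (m ℕ.+ β i j y))
               (ℤ.+-monoʳ-≤ (Σ K (F y)) (mul-≤ʳ (Ψ * Ψ + Ψ * Ψ) (0≤+ (0≤* 0≤Ψ 0≤Ψ) (0≤* 0≤Ψ 0≤Ψ))
                 (_≤_.+≤+ (α≤D i y (ℕ.<-trans i<j j<S) y<H))))) ⟩
        Σ H (λ y → Σ K (F y) + + D * (Ψ * Ψ + Ψ * Ψ))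
          ≡⟨ trans (Σ-+ H (λ y → Σ K (F y)) _) (cong (_+_ (Σ H (λ y → Σ K (F y)))) (Σ-const H _)) ⟩
        Σ H (λ y → Σ K (F y)) + + H * (+ D * (Ψ * Ψ + Ψ * Ψ))
          ≤⟨ ℤ.+-monoˡ-≤ _ main ⟩
        + H * (Ψ * (Z + + D * (Ψ + Ψ))) + + H * (+ D * (Ψ * Ψ + Ψ * Ψ))
          ≡⟨ ℤ.*-distribˡ-+ (+ H) _ _ ⟨
        W ∎
        where
        open ℤ.≤-Reasoning
        F : ℕ → ℕ → ℤ
        F y m = ψ m * ψ (m ℕ.+ β i j y)
        β≤D : ∀ y → y ℕ.< H → β i j y ℕ.≤ D
        β≤D y y<H = ℕ.≤-trans (ℕ.m≤n+m _ (α i y)) (subst (ℕ._≤ D) (α+β i j y i<j) (α≤D j y j<S y<H))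
        main : Σ H (λ y → Σ K (F y)) ≤ + H * (Ψ * (Z + + D * (Ψ + Ψ)))
        main = begin
          Σ H (λ y → Σ K (F y))
            ≡⟨ Σ-swap H K F ⟩
          Σ K (λ k → Σ H (λ y → F y k))
            ≡⟨ Σ-cong K (λ k _ → Σ-*ˡ H (ψ k) (λ y → ψ (k ℕ.+ β i j y))) ⟩
          Σ K (λ k → ψ k * Σ H (λ y → ψ (k ℕ.+ β i j y)))
            ≤⟨ Σ-mono K (λ k k<K → mul-≤ʳ _ (pos i j k i<j j<S k<K) (proj₂ (ψ-bounded k))) ⟩
          Σ K (λ k → Ψ * Σ H (λ y → ψ (k ℕ.+ β i j y)))
            ≡⟨ trans (Σ-*ˡ K Ψ _) (cong (Ψ *_) (Σ-swap K H (λ k y → ψ (k ℕ.+ β i j y)))) ⟩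
          Ψ * Σ H (λ y → Σ K (λ k → ψ (k ℕ.+ β i j y)))
            ≤⟨ mul-≤ Ψ 0≤Ψ (Σ-≤const H _ λ y y<H → ℤ.≤-trans (Σ-shift K (β i j y) ψ-bounded)
                 (ℤ.+-mono-≤ ψ-total (mul-≤ʳ (Ψ + Ψ) (0≤+ 0≤Ψ 0≤Ψ) (_≤_.+≤+ (β≤D y y<H))))) ⟩
          Ψ * (+ H * (Z + + D * (Ψ + Ψ)))
            ≡⟨ swap Ψ (+ H) _ ⟩
          + H * (Ψ * (Z + + D * (Ψ + Ψ))) ∎
          where
          swap : ∀ a b c → a * (b * c) ≡ b * (a * c)
          swap = solve-∀

      -- On the diagonal there is no cancellation, only the trivial bound `U`. The indicator lets
      -- both cases share one formula, in which summation over j meets `U` just once.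
      corr-bound : ∀ i j → i ℕ.< S → j ℕ.< S → corr i j ≤ ind i j * U + W
      corr-bound i j i<S j<S with ℕ.<-cmp i j
      ... | tri< i<j _ _ = ℤ.≤-trans (corr-off i j i<j j<S) (ℤ.≤-trans (ℤ.≤-reflexive (sym (ℤ.+-identityˡ W)))
                             (ℤ.+-monoˡ-≤ W (0≤* (0≤ind i j) 0≤U)))
      ... | tri> _ _ j<i = ℤ.≤-trans (ℤ.≤-reflexive (corr-sym i j))
                           (ℤ.≤-trans (corr-off j i j<i i<S) (ℤ.≤-trans (ℤ.≤-reflexive (sym (ℤ.+-identityˡ W)))
                             (ℤ.+-monoˡ-≤ W (0≤* (0≤ind i j) 0≤U))))
      ... | tri≈ _ refl _ = ℤ.≤-trans (corr-diag i) (ℤ.≤-trans (ℤ.≤-reflexive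
                             (sym (trans (ℤ.+-identityʳ (ind i i * U)) (trans (cong (_* U) (ind-refl i)) (ℤ.*-identityˡ U)))))
                             (ℤ.+-monoʳ-≤ (ind i i * U) 0≤W))

    average : ℕ → ℕ → ℤ
    average k y = Σ S (λ i → θ i * ψ (k ℕ.+ α i y))

    Λ : ℤ
    Λ = Σ S θ

    -- Opening the square leads to the correlations of pairs of shifts. The trivial diagonal bound
    -- enters with weight Λ and the good bound with weight Λ², so the diagonal becomes harmless once
    -- Λ is large.
    second-moment : Σ K (λ k → Σ H (λ y → average k y * average k y)) ≤
                    Λ * (+ K * (+ H * (Ψ * Ψ))) +
                    Λ * (Λ * (+ H * (Ψ * (Z + + D * (Ψ + Ψ)) + + D * (Ψ * Ψ + Ψ * Ψ))))
    second-moment = begin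
      Σ K (λ k → Σ H (λ y → average k y * average k y))
        ≡⟨ Σ-cong K (λ k _ → Σ-cong H λ y _ → expand k y) ⟩
      Σ K (λ k → Σ H (λ y → Σ S (λ i → Σ S (λ j → term k y i j))))
        ≡⟨ Σ-cong K (λ k _ → trans (Σ-swap H S (λ y i → Σ S (term k y i))) (Σ-cong S λ i _ → Σ-swap H S (λ y j → term k y i j))) ⟩
      Σ K (λ k → Σ S (λ i → Σ S (λ j → Σ H (λ y → term k y i j))))
        ≡⟨ trans (Σ-swap K S (λ k i → Σ S (λ j → Σ H (λ y → term k y i j)))) (Σ-cong S λ i _ → Σ-swap K S (λ k j → Σ H (λ y → term k y i j))) ⟩
      Σ S (λ i → Σ S (λ j → Σ K (λ k → Σ H (λ y → term k y i j))))
        ≡⟨ Σ-cong S (λ i _ → Σ-cong S λ j _ → trans (Σ-cong K λ k _ → Σ-*ˡ H (θ i * θ j) _) (Σ-*ˡ K (θ i * θ j) _)) ⟩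
      Σ S (λ i → Σ S (λ j → (θ i * θ j) * corr i j))
        ≤⟨ Σ-mono S (λ i i<S → Σ-mono S λ j j<S → mul-≤ _ (0≤* (0≤θ i) (0≤θ j)) (corr-bound i j i<S j<S)) ⟩
      Σ S (λ i → Σ S (λ j → (θ i * θ j) * (ind i j * U + W)))
        ≤⟨ Σ-mono S (λ i i<S → row i i<S) ⟩
      Σ S (λ i → θ i * (U + Λ * W))
        ≡⟨ Σ-*ʳ S (U + Λ * W) θ ⟩
      Λ * (U + Λ * W)
        ≡⟨ ℤ.*-distribˡ-+ Λ U (Λ * W) ⟩
      Λ * U + Λ * (Λ * W) ∎
      where
      open ℤ.≤-Reasoning
      term : ℕ → ℕ → ℕ → ℕ → ℤ
      term k y i j = (θ i * θ j) * (ψ (k ℕ.+ α i y) * ψ (k ℕ.+ α j y))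
      expand : ∀ k y → average k y * average k y ≡ Σ S (λ i → Σ S (λ j → term k y i j))
      expand k y = trans (sym (Σ-*ʳ S (average k y) _)) (Σ-cong S λ i _ →
        trans (sym (Σ-*ˡ S (θ i * ψ (k ℕ.+ α i y)) _)) (Σ-cong S λ j _ → four (θ i) _ (θ j) _))
        where
        four : ∀ a b c d → (a * b) * (c * d) ≡ (a * c) * (b * d)
        four = solve-∀
      row : ∀ i → i ℕ.< S → Σ S (λ j → (θ i * θ j) * (ind i j * U + W)) ≤ θ i * (U + Λ * W)
      row i i<S = begin
        Σ S (λ j → (θ i * θ j) * (ind i j * U + W))
          ≡⟨ trans (Σ-cong S λ j _ → ℤ.*-assoc (θ i) (θ j) _) (Σ-*ˡ S (θ i) _) ⟩
        θ i * Σ S (λ j → θ j * (ind i j * U + W))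
          ≤⟨ mul-≤ (θ i) (0≤θ i) inner ⟩
        θ i * (U + Λ * W) ∎
        where
        drop-θ : ∀ j → θ j * (ind i j * U + W) ≤ ind i j * U + θ j * W
        drop-θ j = begin
          θ j * (ind i j * U + W)            ≡⟨ ℤ.*-distribˡ-+ (θ j) _ W ⟩
          θ j * (ind i j * U) + θ j * W      ≤⟨ ℤ.+-monoˡ-≤ (θ j * W) (mul-≤ʳ (ind i j * U) (0≤* (0≤ind i j) 0≤U) (θ≤1 j)) ⟩
          1ℤ * (ind i j * U) + θ j * W       ≡⟨ cong (_+ θ j * W) (ℤ.*-identityˡ (ind i j * U)) ⟩
          ind i j * U + θ j * W              ∎
        inner : Σ S (λ j → θ j * (ind i j * U + W)) ≤ U + Λ * W
        inner = begin
          Σ S (λ j → θ j * (ind i j * U + W))  ≤⟨ Σ-mono S (λ j _ → drop-θ j) ⟩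
          Σ S (λ j → ind i j * U + θ j * W)    ≡⟨ Σ-+ S _ _ ⟩
          Σ S (λ j → ind i j * U) + Σ S (λ j → θ j * W)
            ≡⟨ cong₂ _+_ (Σ-*ʳ S U (ind i)) (Σ-*ʳ S W θ) ⟩
          Σ S (ind i) * U + Λ * W              ≡⟨ cong (λ z → z * U + Λ * W) (Σ-ind S i i<S) ⟩
          1ℤ * U + Λ * W                       ≡⟨ cong (_+ Λ * W) (ℤ.*-identityˡ U) ⟩
          U + Λ * W                            ∎

-- The progressions for u, v and w, and the contradiction between counts and second moment.

module Averaging where
  open Sums
  open import Data.Integer.Base as ℤ using (ℤ; +_; 0ℤ; 1ℤ)
  import Data.Integer.Properties as ℤ
  import Data.Integer.Tactic.RingSolver as ℤ-Solver
  open import Data.Nat.Base using (ℕ; suc; _+_; _*_; _∸_; _≤_; _<_; s≤s; z≤n; >-nonZero)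
  import Data.Nat.Properties as ℕ
  open import Data.Nat.Tactic.RingSolver using (solve-∀)
  open import Data.Product.Base using (∃; _×_; _,_)
  open import Data.Sum.Base using (inj₁; inj₂)
  open import Data.Empty using (⊥; ⊥-elim)
  open import Relation.Binary.PropositionalEquality
  open import Relation.Nullary using (yes; no; contradiction; _×-dec_)

  private
    ℕ-identity1 : ∀ N C → suc (suc N * (16 * suc C + 12) + 8 * suc C) + (3 + 16 * C + 12 * N + 24 * (N * C)) ≡ 40 * (suc C * suc N)
    ℕ-identity1 = solve-∀

    ℕ-identity2 : ∀ e T S i x y → e * (1 + T * (S + i)) * (x + T * y) ≡ e * (1 + T * (S + 0)) * x + T * (e * (1 + T * (S + 0)) * y + e * i * (x + T * y))
    ℕ-identity2 = solve-∀

    ℕ-identity3 : ∀ a T J b c → a + T * J + T * (b + c) ≡ a + T * (J + b + c)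
    ℕ-identity3 = solve-∀

    ℕ-identity4 : ∀ A B d a j k → A * (a + d * (B * (A + B)) * j) + B * (a + d * (A + B) * k) ≡ (A + B) * (a + d * B * (k + A * j))
    ℕ-identity4 = solve-∀

    ℕ-identity5 : ∀ A J c e i k x → A * (J + c + e * (i + k) * x) ≡ A * (J + c + e * i * x) + A * (e * k * x)
    ℕ-identity5 = solve-∀

    ℕ-identity6 : ∀ a b c → a * b * c ≡ a * c * b
    ℕ-identity6 = solve-∀

  private
    ℤ-identity1 : ∀ p K Q W C → + 8 ℤ.* (C ℤ.* K) ℤ.- (p ℤ.* K ℤ.- Q ℤ.* W) ≡ Q ℤ.* W ℤ.- (p ℤ.- + 8 ℤ.* C) ℤ.* K
    ℤ-identity1 = ℤ-Solver.solve-∀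

    ℤ-identity2 : ∀ q p L K H → (q ℤ.* (p ℤ.* p) ℤ.* L) ℤ.* (L ℤ.* (K ℤ.* H)) ≡ (q ℤ.* K) ℤ.* (H ℤ.* ((p ℤ.* L) ℤ.* (p ℤ.* L)))
    ℤ-identity2 = ℤ-Solver.solve-∀

    ℤ-identity3 : ∀ Q W n X b → (Q ℤ.* W) ℤ.* ((n ℤ.* X) ℤ.* b) ≡ (n ℤ.* Q) ℤ.* (W ℤ.* (X ℤ.* b))
    ℤ-identity3 = ℤ-Solver.solve-∀

    ℤ-identity4 : ∀ m L K H Ψ c → m ℤ.* (L ℤ.* (K ℤ.* (H ℤ.* (Ψ ℤ.* Ψ))) ℤ.+ L ℤ.* (L ℤ.* (H ℤ.* (K ℤ.* (c ℤ.* Ψ))))) ≡ (m ℤ.* (Ψ ℤ.* Ψ ℤ.+ L ℤ.* (c ℤ.* Ψ))) ℤ.* (L ℤ.* (K ℤ.* H))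
    ℤ-identity4 = ℤ-Solver.solve-∀

    ℤ-identity5 : ∀ Q L C → (+ 2 ℤ.* Q) ℤ.* (+ 2 ℤ.* Q) ℤ.+ L ℤ.* ((+ 8 ℤ.* C ℤ.+ + 4) ℤ.* (+ 2 ℤ.* Q)) ≡ (+ 4 ℤ.* Q) ℤ.* Q ℤ.+ L ℤ.* ((+ 8 ℤ.* C ℤ.+ + 4) ℤ.* (+ 2 ℤ.* Q))
    ℤ-identity5 = ℤ-Solver.solve-∀

    ℤ-identity6 : ∀ Q L C → (+ 4 ℤ.* Q) ℤ.* L ℤ.+ L ℤ.* ((+ 8 ℤ.* C ℤ.+ + 4) ℤ.* (+ 2 ℤ.* Q)) ≡ Q ℤ.* (+ 16 ℤ.* C ℤ.+ + 12) ℤ.* L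
    ℤ-identity6 = ℤ-Solver.solve-∀

    ℤ-identity7 : ∀ n Q c → (n ℤ.* Q) ℤ.* (Q ℤ.* c) ≡ (n ℤ.* c) ℤ.* (Q ℤ.* Q)
    ℤ-identity7 = ℤ-Solver.solve-∀

    ℤ-identity8 : ∀ n c p → (n ℤ.* c) ℤ.* ((n ℤ.* p) ℤ.* (n ℤ.* p)) ≡ n ℤ.* (n ℤ.* n) ℤ.* c ℤ.* (p ℤ.* p)
    ℤ-identity8 = ℤ-Solver.solve-∀

    ℤ-identity9 : ∀ p x → p ≡ (p ℤ.- x) ℤ.+ x
    ℤ-identity9 = ℤ-Solver.solve-∀

    ℤ-identity10 : ∀ Ψ C K D → Ψ ℤ.* (+ 8 ℤ.* (C ℤ.* K) ℤ.+ D ℤ.* (Ψ ℤ.+ Ψ)) ℤ.+ D ℤ.* (Ψ ℤ.* Ψ ℤ.+ Ψ ℤ.* Ψ) ≡ (+ 8 ℤ.* C ℤ.* Ψ) ℤ.* K ℤ.+ (+ 4 ℤ.* Ψ) ℤ.* (D ℤ.* Ψ)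
    ℤ-identity10 = ℤ-Solver.solve-∀

    ℤ-identity11 : ∀ Ψ C K → (+ 8 ℤ.* C ℤ.* Ψ) ℤ.* K ℤ.+ (+ 4 ℤ.* Ψ) ℤ.* K ≡ K ℤ.* ((+ 8 ℤ.* C ℤ.+ + 4) ℤ.* Ψ)
    ℤ-identity11 = ℤ-Solver.solve-∀

  square≥0 : ∀ x → 0ℤ ℤ.≤ x ℤ.* x
  square≥0 (+ n)       = subst (0ℤ ℤ.≤_) (ℤ.pos-* n n) (0≤⁺ (n * n))
  square≥0 ℤ.-[1+ n ]  = 0≤⁺ (suc n * suc n)

  module _ (n C Q p : ℕ) (n>0 : 0 < n) (C>0 : 0 < C) (Q>0 : 0 < Q)
           (Q≤np : Q ≤ n * p) (p-large : 40 * (C * (n * (n * n))) ≤ p) where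

    private
      C′ n′ Q′ p′ Ψ : ℤ
      C′ = + C
      n′ = + n
      Q′ = + Q
      p′ = + p
      Ψ = + suc Q

      pos : ∀ {m} → 0 < m → ℤ.Positive (+ m)
      pos (s≤s _) = _

      cancel : ∀ {a b} c → 0 < c → a ℤ.* + c ℤ.≤ b ℤ.* + c → a ℤ.≤ b
      cancel c c>0 = ℤ.*-cancelʳ-≤-pos _ _ (+ c) {{pos c>0}}

      toℕ : ∀ {x m} → + m ℤ.≤ x → ∃ λ k → x ≡ + k × m ≤ k
      toℕ {+ k} (ℤ.+≤+ le) = k , refl , le

    -- Division by Λ K H, together with Ψ ≤ 2 Q and Q ≤ Λ, leads to (p - 8 C) p² ≤ n Q² (16 C + 12).
    -- By Q ≤ n p this becomes p ≤ n³ (16 C + 12) + 8 C ≤ 36 C n³, contrary to `p-large`.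
    counts-contradict : ∀ K H → 0 < K → 0 < H → ∀ W X Λ → 0ℤ ℤ.≤ W → 0ℤ ℤ.≤ X →
      p′ ℤ.* + K ℤ.- Q′ ℤ.* W ℤ.≤ + (8 * (C * K)) →
      + H ℤ.≤ n′ ℤ.* X →
      Q′ ℤ.≤ Λ →
      W ℤ.* (X ℤ.* ((p′ ℤ.* Λ) ℤ.* (p′ ℤ.* Λ))) ℤ.≤
        Λ ℤ.* (+ K ℤ.* (+ H ℤ.* (Ψ ℤ.* Ψ))) ℤ.+
        Λ ℤ.* (Λ ℤ.* (+ H ℤ.* (+ K ℤ.* ((+ 8 ℤ.* C′ ℤ.+ + 4) ℤ.* Ψ)))) →
      ⊥
    counts-contradict K H K>0 H>0 W X Λ 0≤W 0≤X W-large X-large Λ-large bound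
      with toℕ Λ-large
    ... | L , refl , Q≤L = ℕ.<⇒≱ too-big small
      where
      open ℤ.≤-Reasoning
      K′ = + K
      H′ = + H
      L′ = + L
      q = p′ ℤ.- + 8 ℤ.* C′
      L>0 : 0 < L
      L>0 = ℕ.<-≤-trans Q>0 Q≤L
      0≤p = 0≤⁺ p
      8C≤p : 8 * C ≤ p
      8C≤p = ℕ.≤-trans (ℕ.*-monoˡ-≤ C (ℕ.m≤m+n 8 32)) (ℕ.≤-trans (ℕ.*-monoʳ-≤ 40 (ℕ.m≤m*n C (n * (n * n)) {{>-nonZero (ℕ.*-mono-≤ n>0 (ℕ.*-mono-≤ n>0 n>0))}})) p-large)
      0≤q : 0ℤ ℤ.≤ q
      0≤q = ℤ.i≤j⇒0≤j-i (ℤ.≤-trans (ℤ.≤-reflexive (sym (ℤ.pos-* 8 C))) (ℤ.+≤+ 8C≤p))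
      qK≤QW : q ℤ.* K′ ℤ.≤ Q′ ℤ.* W
      qK≤QW = ℤ.0≤i-j⇒j≤i (subst (0ℤ ℤ.≤_) (trans (cong (ℤ._- (p′ ℤ.* K′ ℤ.- Q′ ℤ.* W)) (trans (ℤ.pos-* 8 (C * K)) (cong (+ 8 ℤ.*_) (ℤ.pos-* C K)))) (ℤ-identity1 p′ K′ Q′ W C′)) (ℤ.i≤j⇒0≤j-i W-large))
      b = (p′ ℤ.* L′) ℤ.* (p′ ℤ.* L′)
      0≤b = 0≤* (0≤* 0≤p (0≤⁺ L)) (0≤* 0≤p (0≤⁺ L))
      nQ = n′ ℤ.* Q′
      0≤nQ = 0≤* (0≤⁺ n) (0≤⁺ Q)
      rhs = Ψ ℤ.* Ψ ℤ.+ L′ ℤ.* ((+ 8 ℤ.* C′ ℤ.+ + 4) ℤ.* Ψ)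
      step₁ : (q ℤ.* (p′ ℤ.* p′) ℤ.* L′) ℤ.* + (L * (K * H)) ℤ.≤ (nQ ℤ.* rhs) ℤ.* + (L * (K * H))
      step₁ = begin
        (q ℤ.* (p′ ℤ.* p′) ℤ.* L′) ℤ.* + (L * (K * H)) ≡⟨ cong ((q ℤ.* (p′ ℤ.* p′) ℤ.* L′) ℤ.*_) LKH ⟩
        (q ℤ.* (p′ ℤ.* p′) ℤ.* L′) ℤ.* (L′ ℤ.* (K′ ℤ.* H′)) ≡⟨ ℤ-identity2 q p′ L′ K′ H′ ⟩
        (q ℤ.* K′) ℤ.* (H′ ℤ.* b)             ≤⟨ mul-≤ʳ (H′ ℤ.* b) (0≤* (0≤⁺ H) 0≤b) qK≤QW ⟩
        (Q′ ℤ.* W) ℤ.* (H′ ℤ.* b)             ≤⟨ mul-≤ (Q′ ℤ.* W) (0≤* (0≤⁺ Q) 0≤W) (mul-≤ʳ b 0≤b X-large) ⟩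
        (Q′ ℤ.* W) ℤ.* ((n′ ℤ.* X) ℤ.* b)     ≡⟨ ℤ-identity3 Q′ W n′ X b ⟩
        nQ ℤ.* (W ℤ.* (X ℤ.* b))              ≤⟨ mul-≤ nQ 0≤nQ bound ⟩
        nQ ℤ.* _                              ≡⟨ ℤ-identity4 nQ L′ K′ H′ Ψ (+ 8 ℤ.* C′ ℤ.+ + 4) ⟩
        (nQ ℤ.* rhs) ℤ.* (L′ ℤ.* (K′ ℤ.* H′)) ≡⟨ cong ((nQ ℤ.* rhs) ℤ.*_) LKH ⟨
        (nQ ℤ.* rhs) ℤ.* + (L * (K * H))      ∎
        where
        LKH : + (L * (K * H)) ≡ L′ ℤ.* (K′ ℤ.* H′)
        LKH = trans (ℤ.pos-* L (K * H)) (cong (L′ ℤ.*_) (ℤ.pos-* K H))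
      step₂ : q ℤ.* (p′ ℤ.* p′) ℤ.* L′ ℤ.≤ nQ ℤ.* rhs
      step₂ = cancel (L * (K * H)) (ℕ.*-mono-≤ L>0 (ℕ.*-mono-≤ K>0 H>0)) step₁
      0≤8C+4 : 0ℤ ℤ.≤ + 8 ℤ.* C′ ℤ.+ + 4
      0≤8C+4 = 0≤+ (0≤* (0≤⁺ 8) (0≤⁺ C)) (0≤⁺ 4)
      Ψ≤2Q : Ψ ℤ.≤ + 2 ℤ.* Q′
      Ψ≤2Q = ℤ.≤-trans (ℤ.+≤+ (ℕ.+-mono-≤ Q>0 (ℕ.m≤m+n Q 0))) (ℤ.≤-reflexive (ℤ.pos-* 2 Q))
      0≤2Q = 0≤* (0≤⁺ 2) (0≤⁺ Q)
      rhs≤ : rhs ℤ.≤ Q′ ℤ.* (+ 16 ℤ.* C′ ℤ.+ + 12) ℤ.* L′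
      rhs≤ = begin
        rhs ≤⟨ ℤ.+-mono-≤ (ℤ.≤-trans (mul-≤ Ψ (0≤⁺ (suc Q)) Ψ≤2Q) (mul-≤ʳ (+ 2 ℤ.* Q′) 0≤2Q Ψ≤2Q))
                 (mul-≤ L′ (0≤⁺ L) (mul-≤ (+ 8 ℤ.* C′ ℤ.+ + 4) 0≤8C+4 Ψ≤2Q)) ⟩
        (+ 2 ℤ.* Q′) ℤ.* (+ 2 ℤ.* Q′) ℤ.+ L′ ℤ.* ((+ 8 ℤ.* C′ ℤ.+ + 4) ℤ.* (+ 2 ℤ.* Q′))
          ≡⟨ ℤ-identity5 Q′ L′ C′ ⟩
        (+ 4 ℤ.* Q′) ℤ.* Q′ ℤ.+ L′ ℤ.* ((+ 8 ℤ.* C′ ℤ.+ + 4) ℤ.* (+ 2 ℤ.* Q′))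
          ≤⟨ ℤ.+-monoˡ-≤ _ (mul-≤ (+ 4 ℤ.* Q′) (0≤* (0≤⁺ 4) (0≤⁺ Q)) (ℤ.+≤+ Q≤L)) ⟩
        (+ 4 ℤ.* Q′) ℤ.* L′ ℤ.+ L′ ℤ.* ((+ 8 ℤ.* C′ ℤ.+ + 4) ℤ.* (+ 2 ℤ.* Q′))
          ≡⟨ ℤ-identity6 Q′ L′ C′ ⟩
        Q′ ℤ.* (+ 16 ℤ.* C′ ℤ.+ + 12) ℤ.* L′ ∎
      step₃ : q ℤ.* (p′ ℤ.* p′) ℤ.≤ nQ ℤ.* (Q′ ℤ.* (+ 16 ℤ.* C′ ℤ.+ + 12))
      step₃ = cancel L L>0 (ℤ.≤-trans step₂ (ℤ.≤-trans (mul-≤ nQ 0≤nQ rhs≤)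
        (ℤ.≤-reflexive (sym (ℤ.*-assoc nQ (Q′ ℤ.* (+ 16 ℤ.* C′ ℤ.+ + 12)) L′)))))
      p>0 : 0 < p
      p>0 = ℕ.≤-trans (ℕ.*-mono-≤ (s≤s (z≤n {39})) (ℕ.*-mono-≤ C>0 (ℕ.*-mono-≤ n>0 (ℕ.*-mono-≤ n>0 n>0)))) p-large
      step₄ : q ℤ.≤ n′ ℤ.* (n′ ℤ.* n′) ℤ.* (+ 16 ℤ.* C′ ℤ.+ + 12)
      step₄ = cancel (p * p) (ℕ.*-mono-≤ p>0 p>0) (begin
        q ℤ.* + (p * p)                          ≡⟨ cong (q ℤ.*_) (ℤ.pos-* p p) ⟩
        q ℤ.* (p′ ℤ.* p′)                        ≤⟨ step₃ ⟩
        nQ ℤ.* (Q′ ℤ.* c)                        ≡⟨ ℤ-identity7 n′ Q′ c ⟩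
        (n′ ℤ.* c) ℤ.* (Q′ ℤ.* Q′)               ≤⟨ mul-≤ (n′ ℤ.* c) (0≤* (0≤⁺ n) 0≤c)
            (ℤ.≤-trans (mul-≤ Q′ (0≤⁺ Q) Q≤) (mul-≤ʳ (n′ ℤ.* p′) (0≤* (0≤⁺ n) (0≤⁺ p)) Q≤)) ⟩
        (n′ ℤ.* c) ℤ.* ((n′ ℤ.* p′) ℤ.* (n′ ℤ.* p′)) ≡⟨ ℤ-identity8 n′ c p′ ⟩
        n′ ℤ.* (n′ ℤ.* n′) ℤ.* c ℤ.* (p′ ℤ.* p′) ≡⟨ cong (n′ ℤ.* (n′ ℤ.* n′) ℤ.* c ℤ.*_) (ℤ.pos-* p p) ⟨
        n′ ℤ.* (n′ ℤ.* n′) ℤ.* c ℤ.* + (p * p)   ∎)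
        where
        c = + 16 ℤ.* C′ ℤ.+ + 12
        0≤c : 0ℤ ℤ.≤ c
        0≤c = 0≤+ (0≤* (0≤⁺ 16) (0≤⁺ C)) (0≤⁺ 12)
        Q≤ : Q′ ℤ.≤ n′ ℤ.* p′
        Q≤ = ℤ.≤-trans (ℤ.+≤+ Q≤np) (ℤ.≤-reflexive (ℤ.pos-* n p))
      N = n * (n * n)
      N>0 : 0 < N
      N>0 = ℕ.*-mono-≤ n>0 (ℕ.*-mono-≤ n>0 n>0)
      small : p ≤ N * (16 * C + 12) + 8 * C
      small = ℤ.drop‿+≤+ (begin
        p′                                              ≡⟨ ℤ-identity9 p′ (+ 8 ℤ.* C′) ⟩
        q ℤ.+ + 8 ℤ.* C′                                ≤⟨ ℤ.+-monoˡ-≤ (+ 8 ℤ.* C′) step₄ ⟩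
        n′ ℤ.* (n′ ℤ.* n′) ℤ.* (+ 16 ℤ.* C′ ℤ.+ + 12) ℤ.+ + 8 ℤ.* C′
          ≡⟨ cong₂ (λ x y → x ℤ.* (+ 16 ℤ.* C′ ℤ.+ + 12) ℤ.+ y)
               (trans (cong (n′ ℤ.*_) (sym (ℤ.pos-* n n))) (sym (ℤ.pos-* n (n * n)))) (sym (ℤ.pos-* 8 C)) ⟩
        + N ℤ.* (+ 16 ℤ.* C′ ℤ.+ + 12) ℤ.+ + (8 * C)
          ≡⟨ cong (λ x → + N ℤ.* (x ℤ.+ + 12) ℤ.+ + (8 * C)) (sym (ℤ.pos-* 16 C)) ⟩
        + N ℤ.* + (16 * C + 12) ℤ.+ + (8 * C)           ≡⟨ cong (ℤ._+ + (8 * C)) (sym (ℤ.pos-* N (16 * C + 12))) ⟩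
        + (N * (16 * C + 12) + 8 * C)                   ∎)
      too-big : N * (16 * C + 12) + 8 * C < p
      too-big = ℕ.<-≤-trans (lemma N C N>0 C>0) (ℕ.≤-trans (ℕ.≤-reflexive refl) p-large)
        where
        lemma : ∀ N C → 0 < N → 0 < C → N * (16 * C + 12) + 8 * C < 40 * (C * N)
        lemma (suc N) (suc C) _ _ = subst (suc (suc N * (16 * suc C + 12) + 8 * suc C) ≤_) (ℕ-identity1 N C) (ℕ.m≤m+n _ _)

  -- The three arithmetic progressions of the main argument satisfy
  -- A u + B w = (A + B) v, and u = e s x.
  module Progressions
    (χ : ℕ → ℕ) (n A B Q p : ℕ) (n>0 : 0 < n) (A>0 : 0 < A) (B>0 : 0 < B) (Q>0 : 0 < Q)
    (Q≤np : Q ≤ n * p) (p≤Ψ : p ≤ suc Q) (p-large : 40 * ((A + B) * (n * (n * n))) ≤ p)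
    (d a e S₀ x₀ J₀ : ℕ) (g σ τ : ℕ) (S H J : ℕ) (H>0 : 0 < H) (J>0 : 0 < J) where

    -- Moving u by `T` changes A u by C times A d B, which v absorbs by A steps of its own
    -- progression. `K` exceeds the largest shift A J by the factor Q + 1, the bound for `ψ`, so
    -- that boundary terms of order A J (Q + 1)² cost no more than K (Q + 1).
    C T K : ℕ
    C = A + B
    T = d * (B * C)
    K = A * suc Q * J

    s x w : ℕ → ℕ
    s i = 1 + T * (S₀ + i)
    x y = x₀ + T * y
    w k = a + d * C * k

    v : ℕ → ℕ
    v m = a + d * B * m

    -- The position of e s x in the progression of difference `T` starting at a. It is expanded so
    -- as to be visibly linear in y and in i separately.
    j : ℕ → ℕ → ℕ
    j i y = J₀ + e * s 0 * y + e * i * x y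

    ψ : ℕ → ℤ
    ψ m = + p ℤ.- + Q ℤ.* ind (χ (v m)) g

    -- The terms of `j` free of i cancel in a difference of two shifts. What remains is a
    -- progression in y of difference A e (i′ - i) T, to which the density bound can be applied.
    β : ℕ → ℕ → ℕ → ℕ
    β i i′ y = A * (e * (i′ ∸ i) * x y)

    u≡ : e * s 0 * x₀ ≡ a + T * J₀ → ∀ i y → e * s i * x y ≡ a + T * j i y
    u≡ base i y = begin
      e * s i * x y                                              ≡⟨ ℕ-identity2 e T S₀ i x₀ y ⟩
      e * s 0 * x₀ + T * (e * s 0 * y + e * i * x y)             ≡⟨ cong (_+ T * (e * s 0 * y + e * i * x y)) base ⟩
      a + T * J₀ + T * (e * s 0 * y + e * i * x y)               ≡⟨ ℕ-identity3 a T J₀ (e * s 0 * y) (e * i * x y) ⟩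
      a + T * j i y ∎
      where
      open ≡-Reasoning

    equation : ∀ i y k → A * (a + T * j i y) + B * w k ≡ C * v (k + A * j i y)
    equation i y k = ℕ-identity4 A B d a (j i y) k

    Solution : ℕ → ℕ → ℕ → Set
    Solution k i y = χ (w k) ≡ g × χ (s i) ≡ σ × χ (x y) ≡ τ × χ (v (k + A * j i y)) ≡ g

  module Search
    (χ : ℕ → ℕ) (n A B Q p : ℕ) (n>0 : 0 < n) (A>0 : 0 < A) (B>0 : 0 < B) (Q>0 : 0 < Q)
    (Q≤np : Q ≤ n * p) (p≤Ψ : p ≤ suc Q) (p-large : 40 * ((A + B) * (n * (n * n))) ≤ p)
    (d a e S₀ x₀ J₀ : ℕ) (g σ τ : ℕ) (S H J : ℕ) (H>0 : 0 < H) (J>0 : 0 < J) where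

    open Progressions χ n A B Q p n>0 A>0 B>0 Q>0 Q≤np p≤Ψ p-large d a e S₀ x₀ J₀ g σ τ S H J H>0 J>0

    module _
      (j≤J : ∀ i y → i < S → y < H → j i y ≤ J)
      (Λ-large : + Q ℤ.≤ Σ S (λ i → ind (χ (s i)) σ))
      (X-large : + H ℤ.≤ + n ℤ.* Σ H (λ y → ind (χ (x y)) τ))
      (w-sum : Σ K (λ k → + p ℤ.- + Q ℤ.* ind (χ (w k)) g) ℤ.≤ + (8 * (C * K)))
      (v-sum : Σ K ψ ℤ.≤ + (8 * (C * K)))
      (pos : ∀ i i′ k → i < i′ → i′ < S → k < K → 0ℤ ℤ.≤ Σ H (λ y → ψ (k + β i i′ y))) where

      -- All conditions are decidable, so a bounded search produces the witnesses, and counting is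
      -- only used to refute that the search fails.
      solution : ∃ λ k → k < K × ∃ λ i → i < S × ∃ λ y → y < H × Solution k i y
      solution with ℕ.anyUpTo? (λ k → ℕ.anyUpTo? (λ i → ℕ.anyUpTo? (λ y →
                      (χ (w k) ℕ.≟ g) ×-dec (χ (s i) ℕ.≟ σ) ×-dec (χ (x y) ℕ.≟ τ) ×-dec
                      (χ (v (k + A * j i y)) ℕ.≟ g)) H) S) K
      ... | yes found = found
      ... | no  none  = ⊥-elim (
        counts-contradict n C Q p n>0 (ℕ.<-≤-trans A>0 (ℕ.m≤m+n A B)) Q>0 Q≤np p-large K H
          (ℕ.*-mono-≤ (ℕ.*-mono-≤ A>0 (s≤s (z≤n {Q}))) J>0) H>0 W X Λ
          (Σ-nonneg K λ k _ → 0≤ind (χ (w k)) g) (Σ-nonneg H λ y _ → 0≤ind (χ (x y)) τ)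
          (ℤ.≤-trans (ℤ.≤-reflexive (sym w-total)) w-sum) X-large Λ-large bound)
        where
        open ℤ.≤-Reasoning
        Ψ : ℤ
        Ψ = + suc Q
        W X : ℤ
        W = Σ K (λ k → ind (χ (w k)) g)
        X = Σ H (λ y → ind (χ (x y)) τ)
        θ : ℕ → ℤ
        θ i = ind (χ (s i)) σ

        w-total : Σ K (λ k → + p ℤ.- + Q ℤ.* ind (χ (w k)) g) ≡ + p ℤ.* + K ℤ.- + Q ℤ.* W
        w-total = trans (Σ-cong K λ k _ → cong (ℤ._+_ (+ p)) (ℤ.neg-distribˡ-* (+ Q) (ind (χ (w k)) g)))
          (trans (Σ-+ K (λ _ → + p) (λ k → (ℤ.- (+ Q)) ℤ.* ind (χ (w k)) g))
          (cong₂ ℤ._+_ (trans (Σ-const K (+ p)) (ℤ.*-comm (+ K) (+ p)))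
            (trans (Σ-*ˡ K (ℤ.- (+ Q)) (λ k → ind (χ (w k)) g)) (sym (ℤ.neg-distribˡ-* (+ Q) W)))))

        bounded : Bounded Ψ ψ
        bounded m with ind-01 (χ (v m)) g
        ... | inj₁ (e , _) = subst (λ z → ℤ.- Ψ ℤ.≤ + p ℤ.- + Q ℤ.* z × + p ℤ.- + Q ℤ.* z ℤ.≤ Ψ) (sym e)
          (subst (λ z → ℤ.- Ψ ℤ.≤ z × z ℤ.≤ Ψ) (sym (trans (cong (λ z → + p ℤ.- z) (ℤ.*-zeroʳ (+ Q))) (ℤ.+-identityʳ (+ p))))
            (ℤ.≤-trans ℤ.-≤+ (0≤⁺ p) , ℤ.+≤+ p≤Ψ))
        ... | inj₂ (e , _) = subst (λ z → ℤ.- Ψ ℤ.≤ + p ℤ.- + Q ℤ.* z × + p ℤ.- + Q ℤ.* z ℤ.≤ Ψ) (sym e)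
          (subst (λ z → ℤ.- Ψ ℤ.≤ + p ℤ.- z × + p ℤ.- z ℤ.≤ Ψ) (sym (ℤ.*-identityʳ (+ Q)))
            ( ℤ.≤-trans (ℤ.neg-mono-≤ (ℤ.+≤+ (ℕ.n≤1+n Q)))
                (ℤ.≤-trans (ℤ.≤-reflexive (sym (ℤ.+-identityˡ _))) (ℤ.+-monoˡ-≤ (ℤ.- (+ Q)) (0≤⁺ p)))
            , ℤ.≤-trans (ℤ.i-j≤i (+ p) (+ Q)) (ℤ.+≤+ p≤Ψ)))

        α+β : ∀ i i′ y → i < i′ → A * j i′ y ≡ A * j i y + β i i′ y
        α+β i i′ y i<i′ = trans (cong (λ z → A * (J₀ + e * s 0 * y + e * z * x y)) (sym (ℕ.m+[n∸m]≡n (ℕ.<⇒≤ i<i′))))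
          (ℕ-identity5 A J₀ (e * s 0 * y) e i (i′ ∸ i) (x y))

        open Variance ψ Ψ (0≤⁺ (suc Q)) bounded K H S (A * J) θ
          (λ i → 0≤ind (χ (s i)) σ) (λ i → ind≤1 (χ (s i)) σ)
          (λ i y → A * j i y) (λ i y i<S y<H → ℕ.*-monoʳ-≤ A (j≤J i y i<S y<H))
          β α+β pos (+ (8 * (C * K))) (0≤⁺ (8 * (C * K))) v-sum

        b : ℤ
        b = (+ p ℤ.* Λ) ℤ.* (+ p ℤ.* Λ)

        -- If there is no solution, none of the shifts with s in the class σ takes v into g, so each
        -- `ψ` in the average has its maximal value p.
        missed : ∀ k y → k < K → y < H → χ (w k) ≡ g → χ (x y) ≡ τ → average k y ≡ + p ℤ.* Λ
        missed k y k<K y<H wg xτ = trans (Σ-cong S term) (trans (Σ-*ʳ S (+ p) θ) (ℤ.*-comm Λ (+ p)))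
          where
          term : ∀ i → i < S → θ i ℤ.* ψ (k + A * j i y) ≡ θ i ℤ.* + p
          term i i<S with ind-01 (χ (s i)) σ | ind-01 (χ (v (k + A * j i y))) g
          ... | inj₁ (θ0 , _) | _ = trans (cong (ℤ._* ψ (k + A * j i y)) θ0) (sym (cong (ℤ._* + p) θ0))
          ... | inj₂ _ | inj₁ (v0 , _) = cong (θ i ℤ.*_) (trans (cong (λ z → + p ℤ.- + Q ℤ.* z) v0)
            (trans (cong (λ z → + p ℤ.- z) (ℤ.*-zeroʳ (+ Q))) (ℤ.+-identityʳ (+ p))))
          ... | inj₂ (_ , sσ) | inj₂ (_ , vg) = contradiction (k , k<K , i , i<S , y , y<H , wg , sσ , xτ , vg) none

        lower : ∀ k y → k < K → y < H → ind (χ (w k)) g ℤ.* (ind (χ (x y)) τ ℤ.* b) ℤ.≤ average k y ℤ.* average k y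
        lower k y k<K y<H with ind-01 (χ (w k)) g | ind-01 (χ (x y)) τ
        ... | inj₁ (w0 , _) | _ = ℤ.≤-trans (ℤ.≤-reflexive (cong (ℤ._* (ind (χ (x y)) τ ℤ.* b)) w0)) (square≥0 (average k y))
        ... | inj₂ _ | inj₁ (x0 , _) = ℤ.≤-trans (ℤ.≤-reflexive (trans (cong (λ z → ind (χ (w k)) g ℤ.* (z ℤ.* b)) x0)
                                         (ℤ.*-zeroʳ (ind (χ (w k)) g)))) (square≥0 (average k y))
        ... | inj₂ (w1 , wg) | inj₂ (x1 , xτ) = ℤ.≤-reflexive (trans (cong₂ (λ z z′ → z ℤ.* (z′ ℤ.* b)) w1 x1)
          (trans (ℤ.*-identityˡ _) (trans (ℤ.*-identityˡ b) (sym (cong (λ z → z ℤ.* z) (missed k y k<K y<H wg xτ))))))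

        bound : W ℤ.* (X ℤ.* b) ℤ.≤
          Λ ℤ.* (+ K ℤ.* (+ H ℤ.* (Ψ ℤ.* Ψ))) ℤ.+
          Λ ℤ.* (Λ ℤ.* (+ H ℤ.* (+ K ℤ.* ((+ 8 ℤ.* + C ℤ.+ + 4) ℤ.* Ψ))))
        bound = begin
          W ℤ.* (X ℤ.* b)
            ≡⟨ trans (sym (Σ-*ʳ K (X ℤ.* b) _)) (Σ-cong K λ k _ → trans (cong (ind (χ (w k)) g ℤ.*_) (sym (Σ-*ʳ H b _)))
                 (sym (Σ-*ˡ H (ind (χ (w k)) g) (λ y → ind (χ (x y)) τ ℤ.* b)))) ⟩
          Σ K (λ k → Σ H (λ y → ind (χ (w k)) g ℤ.* (ind (χ (x y)) τ ℤ.* b)))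
            ≤⟨ Σ-mono K (λ k k<K → Σ-mono H λ y y<H → lower k y k<K y<H) ⟩
          Σ K (λ k → Σ H (λ y → average k y ℤ.* average k y))
            ≤⟨ second-moment ⟩
          Λ ℤ.* (+ K ℤ.* (+ H ℤ.* (Ψ ℤ.* Ψ))) ℤ.+
            Λ ℤ.* (Λ ℤ.* (+ H ℤ.* (Ψ ℤ.* (+ (8 * (C * K)) ℤ.+ + (A * J) ℤ.* (Ψ ℤ.+ Ψ)) ℤ.+ + (A * J) ℤ.* (Ψ ℤ.* Ψ ℤ.+ Ψ ℤ.* Ψ))))
            ≡⟨ cong (λ z → Λ ℤ.* (+ K ℤ.* (+ H ℤ.* (Ψ ℤ.* Ψ))) ℤ.+ Λ ℤ.* (Λ ℤ.* (+ H ℤ.* z))) regroup ⟩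
          Λ ℤ.* (+ K ℤ.* (+ H ℤ.* (Ψ ℤ.* Ψ))) ℤ.+
            Λ ℤ.* (Λ ℤ.* (+ H ℤ.* (+ K ℤ.* ((+ 8 ℤ.* + C ℤ.+ + 4) ℤ.* Ψ)))) ∎
          where
          K≡ : + K ≡ + (A * J) ℤ.* Ψ
          K≡ = trans (cong +_ (ℕ-identity6 A (suc Q) J)) (ℤ.pos-* (A * J) (suc Q))
          regroup : Ψ ℤ.* (+ (8 * (C * K)) ℤ.+ + (A * J) ℤ.* (Ψ ℤ.+ Ψ)) ℤ.+ + (A * J) ℤ.* (Ψ ℤ.* Ψ ℤ.+ Ψ ℤ.* Ψ) ≡
                    + K ℤ.* ((+ 8 ℤ.* + C ℤ.+ + 4) ℤ.* Ψ)
          regroup = trans (cong (λ z → Ψ ℤ.* (z ℤ.+ + (A * J) ℤ.* (Ψ ℤ.+ Ψ)) ℤ.+ + (A * J) ℤ.* (Ψ ℤ.* Ψ ℤ.+ Ψ ℤ.* Ψ))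
                             (trans (ℤ.pos-* 8 (C * K)) (cong (+ 8 ℤ.*_) (ℤ.pos-* C K))))
            (trans (ℤ-identity10 Ψ (+ C) (+ K) (+ (A * J)))
            (trans (cong (λ z → (+ 8 ℤ.* + C ℤ.* Ψ) ℤ.* + K ℤ.+ (+ 4 ℤ.* Ψ) ℤ.* z) (sym K≡)) (ℤ-identity11 Ψ (+ C) (+ K))))

-- Classes found close to 1, and windows of nearly maximal density.

module Density where
  open Sums
  open import Data.Integer.Base as ℤ using (ℤ; +_; 1ℤ)
  import Data.Integer.Properties as ℤ
  open import Data.Nat.Base using (ℕ; zero; suc; _+_; _*_; _⊔_; _≤_; _<_; s≤s; z≤n; >-nonZero)
  import Data.Nat.Properties as ℕ
  open import Data.Nat.Divisibility using (_∣_; divides; ∣-refl; m∣m*n; n∣m*n)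
  open import Data.Nat.Tactic.RingSolver using (solve-∀)
  open import Data.Product.Base using (∃; ∃₂; _×_; _,_; proj₁; proj₂)
  open import Data.Sum.Base using (_⊎_; inj₁; inj₂)
  open import Data.Empty using (⊥; ⊥-elim)
  open import Relation.Binary.PropositionalEquality
  open import Relation.Nullary using (Dec; yes; no)

  -- Membership in R need not be decidable, but for a goal R one may argue
  -- classically with falsity replaced by R.
  Cont : Set → Set → Set
  Cont R P = (P → R) → R

  module _ {R : Set} where
    return : ∀ {P} → P → Cont R P
    return x k = k x

    infixl 1 _>>=_
    _>>=_ : ∀ {P Q} → Cont R P → (P → Cont R Q) → Cont R Q
    (m >>= f) k = m λ x → f x k

    excluded-middle : ∀ {P} → Cont R (P ⊎ (P → R))
    excluded-middle k = k (inj₂ λ x → k (inj₁ x))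

    all-below : ∀ m {P : ℕ → Set} → (∀ c → c < m → Cont R (P c)) → Cont R (∀ c → c < m → P c)
    all-below zero    h = return λ c ()
    all-below (suc m) {P} h =
      h m ℕ.≤-refl >>= λ Pm → all-below m (λ c c<m → h c (ℕ.m<n⇒m<1+n c<m)) >>= λ rest →
      return λ c c<sm → extend rest Pm c (ℕ.m≤n⇒m<n∨m≡n (ℕ.≤-pred c<sm))
      where
      extend : (∀ c → c < m → P c) → P m → ∀ c → c < m ⊎ c ≡ m → P c
      extend rest Pm c (inj₁ c<m)  = rest c c<m
      extend rest Pm c (inj₂ refl) = Pm

    climb : (D : ℕ → Set) → ∀ k q → D q → (D (k + q) → R) →
            Cont R (∃ λ r → q ≤ r × D r × (D (suc r) → R))
    climb D zero    q Dq no-D _ = no-D Dq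
    climb D (suc k) q Dq no-D = excluded-middle >>= λ
      { (inj₁ next) → climb D k (suc q) next (λ Dk → no-D (subst D (ℕ.+-suc k q) Dk)) >>= λ (r , q<r , rest) →
                      return (r , ℕ.<⇒≤ q<r , rest)
      ; (inj₂ stop) → return (q , ℕ.≤-refl , Dq , stop) }

  -- Congruence to 1 modulo M with a natural quotient, so that positivity is included.
  One : ℕ → ℕ → Set
  One M x = ∃ λ k → x ≡ 1 + M * k

  One-* : ∀ {M x y} → One M x → One M y → One M (x * y)
  One-* {M} (k , refl) (l , refl) = k + l + M * (k * l) , eq M k l
    where
    eq : ∀ M k l → (1 + M * k) * (1 + M * l) ≡ 1 + M * (k + l + M * (k * l))
    eq = solve-∀

  One-+ : ∀ {M a} b → One M a → M ∣ b → One M (a + b)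
  One-+ {M} _ (k , refl) (divides q refl) = k + q , eq M k q
    where
    eq : ∀ M k q → 1 + M * k + q * M ≡ 1 + M * (k + q)
    eq = solve-∀

  One-∣ : ∀ {M M′ x} → M ∣ M′ → One M′ x → One M x
  One-∣ {M} (divides q refl) (k , refl) = q * k , eq M q k
    where
    eq : ∀ M q k → 1 + q * M * k ≡ 1 + M * (q * k)
    eq = solve-∀

  -- Both ratios p / q and q / p are at most 1 + 1 / M, in a form free of division. This is
  -- closeness to 1 at the archimedean place, measured by the same M as in `One`.
  Near : ℕ → ℕ → ℕ → Set
  Near M p q = M * p ≤ suc M * q × M * q ≤ suc M * p

  Near-refl : ∀ M p → Near M p p
  Near-refl M p = ℕ.m≤n+m _ p , ℕ.m≤n+m _ p

  Near-*ˡ : ∀ {M p q} c → Near M p q → Near M (c * p) (c * q)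
  Near-*ˡ {M} {p} {q} c (l , r) = scale p q l , scale q p r
    where
    swap : ∀ M c p → c * (M * p) ≡ M * (c * p)
    swap = solve-∀
    scale : ∀ p q → M * p ≤ suc M * q → M * (c * p) ≤ suc M * (c * q)
    scale p q h = subst₂ _≤_ (swap M c p) (swap (suc M) c q) (ℕ.*-monoʳ-≤ c h)

  Near-coarsen : ∀ {M t p q} → 0 < t → Near (t * M) p q → Near M p q
  Near-coarsen {M} {suc t} {p} {q} _ (l , r) = coarse p q l , coarse q p r
    where
    eq : ∀ t M q → suc (suc t * M) * q + t * q ≡ suc t * (suc M * q)
    eq = solve-∀
    coarse : ∀ p q → suc t * M * p ≤ suc (suc t * M) * q → M * p ≤ suc M * q
    coarse p q h = ℕ.*-cancelˡ-≤ (suc t) (begin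
      suc t * (M * p)              ≡⟨ ℕ.*-assoc (suc t) M p ⟨
      suc t * M * p                ≤⟨ h ⟩
      suc (suc t * M) * q          ≤⟨ ℕ.m≤m+n _ (t * q) ⟩
      suc (suc t * M) * q + t * q  ≡⟨ eq t M q ⟩
      suc t * (suc M * q)          ∎)
      where open ℕ.≤-Reasoning

  -- By (4 M + 1)² ≤ 16 M (M + 1), two factors 1 + 1 / 4M multiply to at most 1 + 1 / M. This is why
  -- closeness at the level 4 M is required of the ingredients later on.
  Near-trans : ∀ M {p q r} → 0 < M → Near (4 * M) p q → Near (4 * M) q r → Near M p r
  Near-trans M {p} {q} {r} M>0 (l , l′) (m , m′) = chain p q r l m , chain r q p m′ l′
    where
    N = 4 * M
    eq : ∀ M r → suc (4 * M) * (suc (4 * M) * r) + (8 * M) * r ≡ 16 * (M * (suc M * r)) + r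
    eq = solve-∀
    eq′ : ∀ M p → 4 * M * (4 * M * p) ≡ 16 * M * (M * p)
    eq′ = solve-∀
    chain : ∀ p q r → N * p ≤ suc N * q → N * q ≤ suc N * r → M * p ≤ suc M * r
    chain p q r h k = ℕ.*-cancelˡ-≤ (16 * M) {{>-nonZero (ℕ.*-mono-≤ (s≤s (z≤n {15})) M>0)}} (ℕ.+-cancelʳ-≤ r _ _ (begin
      16 * M * (M * p) + r       ≡⟨ cong (_+ r) (eq′ M p) ⟨
      N * (N * p) + r            ≤⟨ ℕ.+-mono-≤ (ℕ.*-monoʳ-≤ N h) (r≤ r) ⟩
      N * (suc N * q) + 8 * M * r ≡⟨ cong (_+ 8 * M * r) (swap N q) ⟩
      suc N * (N * q) + 8 * M * r ≤⟨ ℕ.+-monoˡ-≤ _ (ℕ.*-monoʳ-≤ (suc N) k) ⟩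
      suc N * (suc N * r) + 8 * M * r ≡⟨ eq M r ⟩
      16 * (M * (suc M * r)) + r ≡⟨ cong (_+ r) (ℕ.*-assoc 16 M (suc M * r)) ⟨
      16 * M * (suc M * r) + r   ∎))
      where
      open ℕ.≤-Reasoning
      swap : ∀ N q → N * (suc N * q) ≡ suc N * (N * q)
      swap = solve-∀
      r≤ : ∀ r → r ≤ 8 * M * r
      r≤ r = ℕ.m≤n*m r (8 * M) {{>-nonZero (ℕ.*-mono-≤ (s≤s (z≤n {7})) M>0)}}

  Near-interval : ∀ {N x y a} → N * x ≤ N * a + a → N * y ≤ N * a + a → a ≤ x → a ≤ y → Near N x y
  Near-interval {N} {x} {y} {a} hx hy ax ay = side x y hx ay , side y x hy ax
    where
    side : ∀ x y → N * x ≤ N * a + a → a ≤ y → N * x ≤ suc N * y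
    side x y hx ay = ℕ.≤-trans hx (ℕ.≤-trans (ℕ.≤-reflexive (ℕ.+-comm (N * a) a)) (ℕ.*-monoʳ-≤ (suc N) ay))

  module Colouring
    (n : ℕ) (col : ℕ → ℕ → ℕ) (col<n : ∀ p q → col p q < n) (R : Set) where

    χ : ℕ → ℕ
    χ x = col x 1

    n>0 : 0 < n
    n>0 = ℕ.≤-<-trans z≤n (col<n 1 1)

    -- The colour c contains a quotient p / q which is close to 1 at ∞ and
    -- at the primes dividing M.
    Pair : ℕ → ℕ → Set
    Pair M c = ∃₂ λ p q → One M p × One M q × Near M p q × col p q ≡ c

    Pair-∣ : ∀ {M M′ c} → 0 < M′ → M ∣ M′ → Pair M′ c → Pair M c
    Pair-∣ M′>0 M∣M′@(divides t refl) (p , q , p1 , q1 , near , eq) =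
      p , q , One-∣ M∣M′ p1 , One-∣ M∣M′ q1 , Near-coarsen (positive t M′>0) near , eq
      where
      positive : ∀ t {M} → 0 < t * M → 0 < t
      positive (suc t) _ = s≤s z≤n

    -- A colour found close to 1 at the level M is found arbitrarily close
    -- to 1.
    Table : ℕ → Set
    Table M = ∀ c → c < n → (∀ M′ → 0 < M′ → Cont R (Pair M′ c)) ⊎ (Pair M c → R)

    -- Each class either occurs at every level or fails at some level. Failure passes to multiples
    -- of the level, so the product of the finitely many failing levels serves all classes.
    table : Cont R (∃ λ M → 0 < M × Table M)
    table = build n ℕ.≤-refl
      where
      Partial : ℕ → ℕ → Set
      Partial m M = ∀ c → c < m → (∀ M′ → 0 < M′ → Cont R (Pair M′ c)) ⊎ (Pair M c → R)

      coarser : ∀ {M M′} c → 0 < M′ → M ∣ M′ → (∀ L → 0 < L → Cont R (Pair L c)) ⊎ (Pair M c → R) →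
                (∀ L → 0 < L → Cont R (Pair L c)) ⊎ (Pair M′ c → R)
      coarser c M′>0 M∣M′ (inj₁ h) = inj₁ h
      coarser c M′>0 M∣M′ (inj₂ h) = inj₂ λ π → h (Pair-∣ M′>0 M∣M′ π)

      decide : ∀ c → Cont R ((∀ M → 0 < M → Cont R (Pair M c)) ⊎ (∃ λ M → 0 < M × (Pair M c → R)))
      -- It is safe to claim that c occurs at every level: if the claim is ever challenged at a
      -- level M, the challenge is itself a refutation at M, and the continuation is called again
      -- with it.
      decide c k = k (inj₁ λ M M>0 no-pair → k (inj₂ (M , M>0 , no-pair)))

      combine : ∀ m M → 0 < M → Partial m M →
                (∀ L → 0 < L → Cont R (Pair L m)) ⊎ (∃ λ L → 0 < L × (Pair L m → R)) →
                ∃ λ M′ → 0 < M′ × Partial (suc m) M′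
      combine m M M>0 part (inj₁ h) = M , M>0 , λ c c<sm → case c (ℕ.m≤n⇒m<n∨m≡n (ℕ.≤-pred c<sm))
        where
        case : ∀ c → c < m ⊎ c ≡ m → (∀ M′ → 0 < M′ → Cont R (Pair M′ c)) ⊎ (Pair M c → R)
        case c (inj₁ c<m)  = part c c<m
        case c (inj₂ refl) = inj₁ h
      combine m M M>0 part (inj₂ (L , L>0 , h)) = M * L , ML>0 , λ c c<sm → case c (ℕ.m≤n⇒m<n∨m≡n (ℕ.≤-pred c<sm))
        where
        ML>0 : 0 < M * L
        ML>0 = ℕ.*-mono-≤ M>0 L>0
        case : ∀ c → c < m ⊎ c ≡ m → (∀ M′ → 0 < M′ → Cont R (Pair M′ c)) ⊎ (Pair (M * L) c → R)
        case c (inj₁ c<m)  = coarser {M} c ML>0 (m∣m*n L) (part c c<m)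
        case c (inj₂ refl) = coarser {L} c ML>0 (n∣m*n M) (inj₂ h)

      build : ∀ m → m ≤ n → Cont R (∃ λ M → 0 < M × Partial m M)
      build zero    _ = return (1 , s≤s z≤n , λ c ())
      build (suc m) h = build m (ℕ.<⇒≤ h) >>= λ (M , M>0 , part) → decide m >>= λ d →
        return (combine m M M>0 part d)

    count : ℕ → ℕ → ℕ → ℕ → ℤ
    count g a d ℓ = Σ ℓ (λ i → ind (χ (a + d * i)) g)

    count≤ : ∀ g a d ℓ → count g a d ℓ ℤ.≤ + ℓ
    count≤ g a d ℓ = ℤ.≤-trans (Σ-≤const ℓ 1ℤ λ i _ → ind≤1 (χ (a + d * i)) g) (ℤ.≤-reflexive (ℤ.*-identityʳ (+ ℓ)))

    module Extremal (M : ℕ) (M>0 : 0 < M) (p₀ : ℕ) where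

      -- The common denominator of all densities. The density 1 / n, which some class always
      -- attains, is p₀ / Q.
      Q : ℕ
      Q = n * p₀

      -- The progression a, a + d, … of length ℓ is short compared with a,
      -- so that its terms are Near each other, but not shorter than a / C.
      record Window (C d a ℓ : ℕ) : Set where
        constructor window
        field
          one  : One M a
          low  : 4 * M * (d * ℓ) ≤ a
          high : a ≤ C * (d * ℓ)

      record DenseWindow (q C d L : ℕ) : Set where
        field
          a ℓ g : ℕ
          long  : L ≤ ℓ
          ℓ>0   : 0 < ℓ
          win   : Window C d a ℓ
          dense : + (q * ℓ) ℤ.≤ + Q ℤ.* count g a d ℓ

      -- The step d and the shape C come before the length L, so one pair d, C has to serve windows
      -- of unbounded length. The class g may change with the window.
      Dense : ℕ → Set
      Dense q = ∃₂ λ d C → 0 < d × M ∣ d × (∀ L → Cont R (DenseWindow q C d L))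

      Sparse : ℕ → ℕ → ℕ → ℕ → Set
      Sparse p C d L = DenseWindow p C d L → R

      dense-p₀ : Dense p₀
      dense-p₀ = M , suc (4 * M) , M>0 , ∣-refl , λ L → return (dense-window L)
        where
        dense-window : ∀ L → DenseWindow p₀ (suc (4 * M)) M L
        dense-window L =
          let ℓ = suc L
              a = 1 + 4 * M * (M * ℓ)
              g , _ , g-popular = popular n ℓ (λ i → χ (a + M * i)) (s≤s z≤n) (λ i → col<n (a + M * i) 1)
          in record
            { a = a ; ℓ = ℓ ; g = g ; long = ℕ.n≤1+n L ; ℓ>0 = s≤s z≤n
            ; win = window (4 * (M * ℓ) , cong suc (swap M ℓ)) (ℕ.n≤1+n _) (ℕ.+-monoˡ-≤ _ (ℕ.*-mono-≤ M>0 (s≤s (z≤n {L}))))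
            ; dense = begin
                + (p₀ * ℓ)                     ≡⟨ ℤ.pos-* p₀ ℓ ⟩
                + p₀ ℤ.* + ℓ                   ≤⟨ mul-≤ (+ p₀) (0≤⁺ p₀) g-popular ⟩
                + p₀ ℤ.* (+ n ℤ.* count g a M ℓ) ≡⟨ ℤ.*-assoc (+ p₀) (+ n) _ ⟨
                + p₀ ℤ.* + n ℤ.* count g a M ℓ ≡⟨ cong (ℤ._* count g a M ℓ) (trans (ℤ.*-comm (+ p₀) (+ n)) (sym (ℤ.pos-* n p₀))) ⟩
                + Q ℤ.* count g a M ℓ          ∎ }
          where
          open ℤ.≤-Reasoning
          swap : ∀ M ℓ → 4 * M * (M * ℓ) ≡ M * (4 * (M * ℓ))
          swap = solve-∀

      not-dense : ∀ q → Q < q → Dense q → R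
      not-dense q Q<q (d , C , _ , _ , h) = h 0 λ D → ⊥-elim (absurd D)
        where
        absurd : DenseWindow q C d 0 → ⊥
        absurd D = ℕ.<⇒≱ (ℕ.*-monoˡ-< ℓ {{>-nonZero ℓ>0}} Q<q)
          (ℤ.drop‿+≤+ (ℤ.≤-trans dense (ℤ.≤-trans (mul-≤ (+ Q) (0≤⁺ Q) (count≤ g a d ℓ)) (ℤ.≤-reflexive (sym (ℤ.pos-* Q ℓ))))))
          where open DenseWindow D

      extremal : Cont R (∃ λ q → p₀ ≤ q × q ≤ Q × Dense q × (Dense (suc q) → R))
      -- After Q + 1 steps the index is larger than Q, where the density would exceed 1.
      extremal = climb Dense (suc Q) p₀ dense-p₀ (not-dense (suc Q + p₀) (ℕ.m≤m+n (suc Q) p₀)) >>=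
        λ (q , p₀≤q , Dq , stop) → bounded q p₀≤q Dq stop (q ℕ.≤? Q)
        where
        bounded : ∀ q → p₀ ≤ q → Dense q → (Dense (suc q) → R) → Dec (q ≤ Q) →
                  Cont R (∃ λ q → p₀ ≤ q × q ≤ Q × Dense q × (Dense (suc q) → R))
        bounded q p₀≤q Dq stop (yes q≤Q) = return (q , p₀≤q , q≤Q , Dq , stop)
        bounded q p₀≤q Dq stop (no q≰Q) _ = not-dense q (ℕ.≰⇒> q≰Q) Dq

      -- For a single step the failure of `Dense p` yields a threshold for the length. The second
      -- moment involves many steps at once, and finitely many of them have a common threshold.
      sparse : ∀ p C → (Dense p → R) → ∀ m → Cont R (∃ λ L → ∀ d → d < m → 0 < d → M ∣ d → Sparse p C d L)
      sparse p C no-dense zero    = return (0 , λ d ())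
      sparse p C no-dense (suc m) =
        sparse p C no-dense m >>= λ (L , h) → at-m >>= λ (L′ , h′) →
        return (L ⊔ L′ , λ d d<sm d>0 M∣d W → case d (ℕ.m≤n⇒m<n∨m≡n (ℕ.≤-pred d<sm)) L L′ h h′ d>0 M∣d W)
        where
        weaken : ∀ {d L L′} → L ≤ L′ → DenseWindow p C d L′ → DenseWindow p C d L
        weaken L≤L′ W = record { DenseWindow W ; long = ℕ.≤-trans L≤L′ (DenseWindow.long W) }
        at-m : Cont R (∃ λ L → 0 < m → M ∣ m → Sparse p C m L)
        -- The threshold 0 is offered first. A window contradicting it is answered by `no-dense`;
        -- this asks for windows of every length, and a length L without windows is then the
        -- threshold to offer instead.
        at-m k = k (0 , λ m>0 M∣m _ → no-dense (m , C , m>0 , M∣m , λ L no-window → k (L , λ _ _ → no-window)))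
        case : ∀ d → d < m ⊎ d ≡ m → ∀ L L′ → (∀ d → d < m → 0 < d → M ∣ d → Sparse p C d L) →
               (0 < m → M ∣ m → Sparse p C m L′) → 0 < d → M ∣ d → DenseWindow p C d (L ⊔ L′) → R
        case d (inj₁ d<m)  L L′ h h′ d>0 M∣d W = h d d<m d>0 M∣d (weaken (ℕ.m≤m⊔n L L′) W)
        case d (inj₂ refl) L L′ h h′ d>0 M∣d W = h′ d>0 M∣d (weaken (ℕ.m≤n⊔m L L′) W)

-- Placing the products e s x inside a window.

module Scale where
  open Density using (One; Near; One-*)
  open import Data.Nat.Base using (ℕ; suc; _+_; _*_; _∸_; _≤_; _<_; s≤s; z≤n; NonZero; >-nonZero)
  import Data.Nat.Properties as ℕ
  open import Data.Nat.DivMod using (_/_; _%_; m/n*n≤m; m%n<n; m≡m%n+[m/n]*n)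
  open import Data.Nat.Tactic.RingSolver using (solve-∀)
  open import Data.Product.Base using (∃; _,_; proj₁; proj₂)
  open import Relation.Binary.PropositionalEquality using (_≡_; refl; sym; trans; cong; subst; subst₂; module ≡-Reasoning)

  private
    scale-identity1 : ∀ N e T X → N * e + X * (N * e * T) ≡ N * e * (1 + T * X)
    scale-identity1 = solve-∀

    scale-identity2 : ∀ N e T X → N * e * (1 + T * (1 + X)) ≡ X * (N * e * T) + N * e * (1 + T)
    scale-identity2 = solve-∀

    scale-identity3 : ∀ N ρ Π t → N * (ρ * Π * t) ≡ ρ * t * (N * Π)
    scale-identity3 = solve-∀

    scale-identity4 : ∀ N ρ P T S → ρ * (1 + T * S) * (suc N * P) ≡ suc N * (ρ * P * (1 + T * (S + 0)))
    scale-identity4 = solve-∀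

    scale-identity5 : ∀ ρ T b c → ρ + T * (b + c) ≡ ρ + T * b + T * c
    scale-identity5 = solve-∀

    scale-identity6 : ∀ ρ P s x → ρ * P * s * x ≡ ρ * (P * s * x)
    scale-identity6 = solve-∀

    scale-identity7 : ∀ ρ T l → ρ * (1 + T * l) ≡ ρ + T * (ρ * l)
    scale-identity7 = solve-∀

    scale-identity8 : ∀ N ρ P s → N * (N * (ρ * P * s)) ≡ ρ * (N * s) * (N * P)
    scale-identity8 = solve-∀

    scale-identity9 : ∀ N ρ Π t → ρ * (suc N * t) * (suc N * Π) ≡ (N * (N + 2) + 1) * (ρ * Π * t)
    scale-identity9 = solve-∀

    scale-identity10 : ∀ N e → (N * (N + 2) + N) * e ≡ N * ((N + 3) * e)
    scale-identity10 = solve-∀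

    scale-identity11 : ∀ N T S → N * (1 + T * (N * S + S)) + 1 ≡ suc N * (1 + T * (N * S))
    scale-identity11 = solve-∀

    scale-identity12 : ∀ N u x → N * N * 2 * (u * x) ≡ N * 2 * (N * u * x)
    scale-identity12 = solve-∀

    scale-identity13 : ∀ N e x T H → N * 2 * ((N + 3) * e * (x + T * H)) ≡ 2 * (N + 3) * (N * e * x + N * e * (T * H))
    scale-identity13 = solve-∀

    scale-identity14 : ∀ N a e T H → 2 * (N + 3) * (suc N * a + N * e * (1 + T) + N * e * (T * H)) ≡ 2 * (N * N * a + (4 * N + 3) * a) + 2 * (N + 3) * (N * e * (1 + T + T * H))
    scale-identity14 = solve-∀

    scale-identity15 : ∀ N a c J E t → 2 * (N * N * a + 5 * (N * (c * J))) + 2 * (N + N) * (N * E * t) ≡ 2 * (N * N * a) + N * (10 * c * J) + N * N * (4 * E * t)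
    scale-identity15 = solve-∀

    scale-identity16 : ∀ N a T E H → 2 * (N * N * a) + N * (N * (T * (4 * E * (H + 2)))) + N * N * (4 * E * (T * (H + 2))) ≡ N * N * 2 * (a + T * (4 * E * (H + 2)))
    scale-identity16 = solve-∀

    scale-identity17 : ∀ N z → (4 * N + N) * z ≡ 5 * (N * z)
    scale-identity17 = solve-∀

    scale-identity18 : ∀ T H → T + T + T * H ≡ T * (H + 2)
    scale-identity18 = solve-∀

    scale-identity19 : ∀ e T S₀ i x y → e * (1 + T * (S₀ + i)) * (x + T * y) ≡ e * (1 + T * (S₀ + 0)) * x + T * (e * (1 + T * (S₀ + 0)) * y + e * i * (x + T * y))
    scale-identity19 = solve-∀

    scale-identity20 : ∀ a T J b c → a + T * J + T * (b + c) ≡ a + T * (J + b + c)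
    scale-identity20 = solve-∀

  -- Here a is the start of the window, known only after Π and E. Just its residue ρ modulo T enters
  -- e, which therefore stays bounded independently of a; the magnitude of a is supplied by `x₀`.
  module Rescaling
    (T N S Π ρ a b E H c : ℕ)
    (T>0 : 0 < T) (N-large : 10 * c ≤ N) (3≤N : 3 ≤ N)
    (Π>0 : 0 < Π) (ρ>0 : 0 < ρ) (a≡ : a ≡ ρ + T * b)
    (e≤E : ρ * Π * (1 + T * (N * S)) ≤ E) (a≤cJ : a ≤ c * (4 * E * (H + 2))) where

    -- As `S₀` is N S, all `s i` with i ≤ S agree up to the factor 1 + 1 / N. `e₀` is the value of e
    -- s 0 in the reference case P = Π. In `J`, half of the factor 4 pays for the ranges of s and x,
    -- the other half for errors of order a / N.
    S₀ J e₀ m : ℕ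
    S₀ = N * S
    J = 4 * E * (H + 2)
    e₀ = ρ * Π * (1 + T * S₀)
    m = N * e₀ * T

    s : ℕ → ℕ
    s i = 1 + T * (S₀ + i)

    private
      N>0 : 0 < N
      N>0 = ℕ.≤-trans (s≤s z≤n) 3≤N
      instance
        m≢0 : NonZero m
        m≢0 = >-nonZero (ℕ.*-mono-≤ (ℕ.*-mono-≤ N>0 (ℕ.*-mono-≤ (ℕ.*-mono-≤ ρ>0 Π>0) (s≤s (z≤n {T * S₀})))) T>0)
        N≢0 : NonZero N
        N≢0 = >-nonZero N>0

    -- Chosen congruent to 1 modulo T and just large enough for e₀ x₀ to exceed a by the factor (N +
    -- 1) / N. This surplus compensates for P possibly falling short of Π by the same factor.
    x₀ : ℕ
    x₀ = 1 + T * suc (suc N * a / m)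

    private
      X = suc (suc N * a / m)

      x₀-low : suc N * a ≤ N * e₀ * x₀
      x₀-low = begin
        suc N * a              ≡⟨ m≡m%n+[m/n]*n (suc N * a) m ⟩
        suc N * a % m + suc N * a / m * m ≤⟨ ℕ.+-monoˡ-≤ _ (ℕ.<⇒≤ (m%n<n (suc N * a) m)) ⟩
        X * m                  ≤⟨ ℕ.m≤n+m (X * m) (N * e₀) ⟩
        N * e₀ + X * m         ≡⟨ scale-identity1 N e₀ T X ⟩
        N * e₀ * x₀            ∎
        where
        open ℕ.≤-Reasoning

      x₀-high : N * e₀ * x₀ ≤ suc N * a + N * e₀ * (1 + T)
      x₀-high = begin
        N * e₀ * x₀                                       ≡⟨ scale-identity2 N e₀ T (suc N * a / m) ⟩
        suc N * a / m * m + N * e₀ * (1 + T)              ≤⟨ ℕ.+-monoˡ-≤ _ (m/n*n≤m (suc N * a) m) ⟩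
        suc N * a + N * e₀ * (1 + T)                      ∎
        where
        open ℕ.≤-Reasoning

    module _ (P : ℕ) (near : Near N P Π) where

      e : ℕ
      e = ρ * P

      j : ℕ → ℕ → ℕ → ℕ
      j J₀ i y = J₀ + e * s 0 * y + e * i * (x₀ + T * y)

      private
        e-low : N * e₀ ≤ suc N * (e * s 0)
        e-low = begin
          N * (ρ * Π * (1 + T * S₀))         ≡⟨ scale-identity3 N ρ Π (1 + T * S₀) ⟩
          ρ * (1 + T * S₀) * (N * Π)         ≤⟨ ℕ.*-monoʳ-≤ (ρ * (1 + T * S₀)) (proj₂ near) ⟩
          ρ * (1 + T * S₀) * (suc N * P)     ≡⟨ scale-identity4 N ρ P T S₀ ⟩
          suc N * (e * s 0)                  ∎
          where
          open ℕ.≤-Reasoning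

        a≤u : a ≤ e * s 0 * x₀
        a≤u = ℕ.*-cancelˡ-≤ (suc N) (begin
          suc N * a                    ≤⟨ x₀-low ⟩
          N * e₀ * x₀                  ≤⟨ ℕ.*-monoˡ-≤ x₀ e-low ⟩
          suc N * (e * s 0) * x₀       ≡⟨ ℕ.*-assoc (suc N) (e * s 0) x₀ ⟩
          suc N * (e * s 0 * x₀)       ∎)
          where open ℕ.≤-Reasoning

      -- P, `s 0` and `x₀` are 1 modulo T, so the product is congruent to ρ and hence to a. By `a≤u`
      -- the quotient of the difference by T is a natural number.
      base : One T P → ∃ λ J₀ → e * s 0 * x₀ ≡ a + T * J₀
      base (k , refl) = solve-for-J₀ (One-* {T} (One-* {T} (k , refl) (S₀ + 0 , refl)) (X , refl))
        where
        solve-for-J₀ : One T (P * s 0 * x₀) → ∃ λ J₀ → e * s 0 * x₀ ≡ a + T * J₀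
        solve-for-J₀ (l , eq) = ρ * l ∸ b , (begin
          e * s 0 * x₀                   ≡⟨ u≡ ⟩
          ρ + T * (ρ * l)                ≡⟨ cong (λ z → ρ + T * z) (sym (ℕ.m+[n∸m]≡n b≤)) ⟩
          ρ + T * (b + (ρ * l ∸ b))      ≡⟨ scale-identity5 ρ T b (ρ * l ∸ b) ⟩
          ρ + T * b + T * (ρ * l ∸ b)    ≡⟨ cong (_+ T * (ρ * l ∸ b)) a≡ ⟨
          a + T * (ρ * l ∸ b)            ∎)
          where
          open ≡-Reasoning
          u≡ : e * s 0 * x₀ ≡ ρ + T * (ρ * l)
          u≡ = trans (scale-identity6 ρ P (s 0) x₀) (trans (cong (ρ *_) eq) (scale-identity7 ρ T l))
          b≤ : b ≤ ρ * l
          b≤ = ℕ.*-cancelˡ-≤ T {{>-nonZero T>0}} (ℕ.+-cancelˡ-≤ ρ _ _ (subst₂ _≤_ a≡ u≡ a≤u))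

      private
        e-high : N * (e * s S) ≤ (N + 3) * e₀
        e-high = ℕ.*-cancelˡ-≤ N (begin
          N * (N * (e * s S))                        ≡⟨ scale-identity8 N ρ P (s S) ⟩
          ρ * (N * s S) * (N * P)                    ≤⟨ ℕ.*-mono-≤ (ℕ.*-monoʳ-≤ ρ s-high) (proj₁ near) ⟩
          ρ * (suc N * (1 + T * S₀)) * (suc N * Π)   ≡⟨ scale-identity9 N ρ Π (1 + T * S₀) ⟩
          (N * (N + 2) + 1) * e₀                     ≤⟨ ℕ.*-monoˡ-≤ e₀ (ℕ.+-monoʳ-≤ (N * (N + 2)) N>0) ⟩
          (N * (N + 2) + N) * e₀                     ≡⟨ scale-identity10 N e₀ ⟩
          N * ((N + 3) * e₀)                         ∎)
          where
          open ℕ.≤-Reasoning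
          s-high : N * s S ≤ suc N * (1 + T * S₀)
          s-high = ℕ.≤-trans (ℕ.m≤m+n _ 1) (ℕ.≤-reflexive (scale-identity11 N T S))

        -- In units where N² is divided out, (1 + 3 / N) (1 + 1 / N) a exceeds a by at most 5 a / N,
        -- which is at most J / 2 by `N-large`. The remaining terms are at most 2 E T (H + 2), which
        -- is half of T J.
        u-high : e * s S * (x₀ + T * H) ≤ a + T * J
        u-high = ℕ.*-cancelˡ-≤ (N * N * 2) {{>-nonZero (ℕ.*-mono-≤ (ℕ.*-mono-≤ N>0 N>0) (s≤s (z≤n {1})))}} (begin
          N * N * 2 * (e * s S * (x₀ + T * H))
            ≡⟨ scale-identity12 N (e * s S) (x₀ + T * H) ⟩
          N * 2 * (N * (e * s S) * (x₀ + T * H))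
            ≤⟨ ℕ.*-monoʳ-≤ (N * 2) (ℕ.*-monoˡ-≤ (x₀ + T * H) e-high) ⟩
          N * 2 * ((N + 3) * e₀ * (x₀ + T * H))
            ≡⟨ scale-identity13 N e₀ x₀ T H ⟩
          2 * (N + 3) * (N * e₀ * x₀ + N * e₀ * (T * H))
            ≤⟨ ℕ.*-monoʳ-≤ (2 * (N + 3)) (ℕ.+-monoˡ-≤ (N * e₀ * (T * H)) x₀-high) ⟩
          2 * (N + 3) * (suc N * a + N * e₀ * (1 + T) + N * e₀ * (T * H))
            ≡⟨ scale-identity14 N a e₀ T H ⟩
          2 * (N * N * a + (4 * N + 3) * a) + 2 * (N + 3) * (N * e₀ * (1 + T + T * H))
            ≤⟨ ℕ.+-mono-≤ (ℕ.*-monoʳ-≤ 2 (ℕ.+-monoʳ-≤ (N * N * a) small-a))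
                 (ℕ.*-mono-≤ (ℕ.*-monoʳ-≤ 2 (ℕ.+-monoʳ-≤ N 3≤N)) small-e) ⟩
          2 * (N * N * a + 5 * (N * (c * J))) + 2 * (N + N) * (N * E * (T * (H + 2)))
            ≡⟨ scale-identity15 N a c J E (T * (H + 2)) ⟩
          2 * (N * N * a) + N * (10 * c * J) + N * N * (4 * E * (T * (H + 2)))
            ≤⟨ ℕ.+-monoˡ-≤ _ (ℕ.+-monoʳ-≤ (2 * (N * N * a)) (ℕ.*-monoʳ-≤ N (ℕ.≤-trans (ℕ.*-monoˡ-≤ J N-large)
                 (ℕ.*-monoʳ-≤ N (ℕ.m≤n*m J T {{>-nonZero T>0}}))))) ⟩
          2 * (N * N * a) + N * (N * (T * J)) + N * N * (4 * E * (T * (H + 2)))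
            ≡⟨ scale-identity16 N a T E H ⟩
          N * N * 2 * (a + T * J) ∎)
          where
          open ℕ.≤-Reasoning
          small-a : (4 * N + 3) * a ≤ 5 * (N * (c * J))
          small-a = begin
            (4 * N + 3) * a       ≤⟨ ℕ.*-mono-≤ (ℕ.+-monoʳ-≤ (4 * N) 3≤N) a≤cJ ⟩
            (4 * N + N) * (c * J) ≡⟨ scale-identity17 N (c * J) ⟩
            5 * (N * (c * J))     ∎
          small-e : N * e₀ * (1 + T + T * H) ≤ N * E * (T * (H + 2))
          small-e = ℕ.*-mono-≤ (ℕ.*-monoʳ-≤ N e≤E) (begin
            1 + T + T * H       ≤⟨ ℕ.+-monoˡ-≤ (T * H) (ℕ.+-monoˡ-≤ T T>0) ⟩
            T + T + T * H       ≡⟨ scale-identity18 T H ⟩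
            T * (H + 2)         ∎)

      -- `j` increases in i and in y, so the corner S, H decides, and there the bound is `u-high`.
      j≤J : ∀ {J₀} → e * s 0 * x₀ ≡ a + T * J₀ → ∀ i y → i ≤ S → y ≤ H → j J₀ i y ≤ J
      j≤J {J₀} base i y i≤S y≤H = ℕ.≤-trans (ℕ.+-mono-≤ (ℕ.+-monoʳ-≤ J₀ (ℕ.*-monoʳ-≤ (e * s 0) y≤H))
          (ℕ.*-mono-≤ (ℕ.*-monoʳ-≤ e i≤S) (ℕ.+-monoʳ-≤ x₀ (ℕ.*-monoʳ-≤ T y≤H))))
        (ℕ.*-cancelˡ-≤ T {{>-nonZero T>0}} (ℕ.+-cancelˡ-≤ a _ _ (subst (_≤ a + T * J) top u-high)))
        where
        top : e * s S * (x₀ + T * H) ≡ a + T * j J₀ S H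
        top = trans (scale-identity19 e T S₀ S x₀ H) (trans (cong (_+ T * (e * s 0 * H + e * S * (x₀ + T * H))) base)
          (scale-identity20 a T J₀ (e * s 0 * H) (e * S * (x₀ + T * H))))

-- Solving A u + B w = (A + B) v in positive integers with prescribed relations between the classes.

module NaturalSolutions where
  open Sums
  open Density
  open Averaging using (module Progressions; module Search)
  open Scale using (module Rescaling)
  open import Data.Integer.Base as ℤ using (ℤ; +_; 0ℤ; 1ℤ)
  import Data.Integer.Properties as ℤ
  import Data.Integer.Tactic.RingSolver as ℤ-Solver
  open import Data.Nat.Base using (ℕ; zero; suc; _+_; _*_; _∸_; _≤_; _<_; s≤s; z≤n; >-nonZero)
  import Data.Nat.Properties as ℕ
  open import Data.Nat.Divisibility using (_∣_; n∣m*n; ∣m⇒∣m*n)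
  open import Data.Nat.DivMod using (_/_; _%_; m/n*n≤m; m%n<n; m≡m%n+[m/n]*n)
  open import Data.Nat.Tactic.RingSolver using (solve-∀)
  open import Data.Product.Base using (∃; ∃₂; _×_; _,_; proj₁; proj₂)
  open import Data.Sum.Base using (_⊎_; inj₁; inj₂)
  open import Relation.Binary.PropositionalEquality
    using (_≡_; refl; sym; trans; cong; cong₂; subst; subst₂; module ≡-Reasoning)
  open import Relation.Nullary using (yes; no; contradiction)

  private
    identity1 : ∀ a b c → a * b * c ≡ a * c * b
    identity1 = solve-∀

    identity2 : ∀ c H → c * (H + H + 4) ≡ 2 * (c * (H + 2))
    identity2 = solve-∀

    identity3 : ∀ c H → 2 * (c * (H + 2 * H)) + 2 * (c * H) ≡ 8 * (c * H)
    identity3 = solve-∀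

    identity4 : ∀ C A Ψ E H → 16 * (C * (A * Ψ)) * E * (H + 2) ≡ 4 * (C * (A * Ψ * (4 * E * (H + 2))))
    identity4 = solve-∀

    identity5 : ∀ z → 2 * (4 * z) ≡ 8 * z
    identity5 = solve-∀

    identity6 : ∀ c d C A J → c * (d * (8 * (C * (A * J)))) ≡ 8 * (c * d) * (C * A) * J
    identity6 = solve-∀

    identity7 : ∀ c d e ℓ → c * (d * (8 * (e * ℓ))) + c * (d * (8 * (e * ℓ))) ≡ 16 * (c * d) * e * ℓ
    identity7 = solve-∀

    identity8 : ∀ z → z + z + 2 * z ≡ 4 * z
    identity8 = solve-∀

    identity9 : ∀ d K D → d * (K * D) ≡ d * D * K
    identity9 = solve-∀

    identity10 : ∀ a d D k b → a + d * b + d * D * k ≡ a + d * (k * D + b)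
    identity10 = solve-∀

    identity11 : ∀ d D k → d * D * k ≡ d * (k * D + 0)
    identity11 = solve-∀

    identity12 : ∀ d B C J → d * (B * C) * J ≡ d * (C * (1 * B * J))
    identity12 = solve-∀

    identity13 : ∀ d B K → d * B * (2 * K) ≡ d * (2 * (B * K))
    identity13 = solve-∀

    identity14 : ∀ N Π → N * Π + N * Π ≡ N * (2 * Π)
    identity14 = solve-∀

    identity15 : ∀ a d B A k f x T y → a + d * B * (k + A * (f * x)) + d * B * (A * (f * T)) * y ≡ a + d * B * (k + A * (f * (x + T * y)))
    identity15 = solve-∀

    identity16 : ∀ D A f T H → D * (A * (f * T)) * H ≡ D * (A * (f * (T * H)))
    identity16 = solve-∀

    identity17 : ∀ t ρ P s x q → t * (ρ * P * s * x * q) ≡ ρ * (P * t) * q * (s * x)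
    identity17 = solve-∀

    identity18 : ∀ ρ Π r q s x → ρ * Π * r * q * (s * x) ≡ r * (q * (ρ * Π * s * x))
    identity18 = solve-∀

    identity19 : ∀ p v t → p * v * t ≡ t * p * v
    identity19 = solve-∀

  One⇒pos : ∀ {M x} → One M x → 0 < x
  One⇒pos (k , refl) = s≤s z≤n

  0<* : ∀ {a b} → 0 < a → 0 < b → 0 < a * b
  0<* = ℕ.*-mono-≤

  positive-count : ∀ {c} k → 0 < c → (x : ℤ) → + c ℤ.≤ + k ℤ.* x → 1ℤ ℤ.≤ x
  positive-count k c>0 (+ suc x) le = ℤ.+≤+ (s≤s z≤n)
  positive-count {c} k c>0 (+ zero)   le = contradiction (ℤ.drop‿+≤+ (ℤ.≤-trans le (ℤ.≤-reflexive (ℤ.*-zeroʳ (+ k))))) (ℕ.<⇒≱ c>0)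
  positive-count {c} k c>0 ℤ.-[1+ x ] le = contradiction (ℤ.drop‿+≤+ (ℤ.≤-trans le
    (ℤ.≤-trans (mul-≤ (+ k) (0≤⁺ k) ℤ.-≤+) (ℤ.≤-reflexive (ℤ.*-zeroʳ (+ k)))))) (ℕ.<⇒≱ c>0)

  -- The residue is taken between T and 2 T rather than below T: it becomes a factor of e and must
  -- be positive.
  residue : ∀ T a → 0 < T → T ≤ a → ∃₂ λ ρ b → a ≡ ρ + T * b × 0 < ρ × ρ ≤ 2 * T
  residue T@(suc _) a T>0 T≤a =
    (a ∸ T) % T + T , (a ∸ T) / T , eq , ℕ.≤-trans T>0 (ℕ.m≤n+m T _) ,
    ℕ.≤-trans (ℕ.+-monoˡ-≤ T (ℕ.<⇒≤ (m%n<n (a ∸ T) T))) (ℕ.≤-reflexive (double T))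
    where
    double : ∀ T → T + T ≡ 2 * T
    double = solve-∀
    regroup : ∀ r q T → r + q * T + T ≡ r + T + T * q
    regroup = solve-∀
    eq : a ≡ (a ∸ T) % T + T + T * ((a ∸ T) / T)
    eq = trans (sym (ℕ.m∸n+n≡m T≤a)) (trans (cong (_+ T) (m≡m%n+[m/n]*n (a ∸ T) T))
      (regroup ((a ∸ T) % T) ((a ∸ T) / T) T))

  quotient : ∀ c ℓ L → 0 < c → c * (L + 4) ≤ ℓ → ∃ λ H → L + 2 ≤ H × c * (H + 2) ≤ ℓ × ℓ ≤ c * (H + 3)
  quotient c@(suc _) ℓ L c>0 long = H , L+2≤H , subst (λ h → c * h ≤ ℓ) (sym H+2) (subst (_≤ ℓ) (ℕ.*-comm (ℓ / c) c) (m/n*n≤m ℓ c)) ,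
    subst (λ h → ℓ ≤ c * h) (trans (cong suc (sym H+2)) (sym (ℕ.+-suc H 2))) below
    where
    H = ℓ / c ∸ 2
    below : ℓ ≤ c * suc (ℓ / c)
    below = begin
      ℓ                      ≡⟨ m≡m%n+[m/n]*n ℓ c ⟩
      ℓ % c + ℓ / c * c      ≤⟨ ℕ.+-monoˡ-≤ _ (ℕ.<⇒≤ (m%n<n ℓ c)) ⟩
      suc (ℓ / c) * c        ≡⟨ ℕ.*-comm (suc (ℓ / c)) c ⟩
      c * suc (ℓ / c)        ∎
      where open ℕ.≤-Reasoning
    strictly-below : ℓ < c * suc (ℓ / c)
    strictly-below = begin-strict
      ℓ                      ≡⟨ m≡m%n+[m/n]*n ℓ c ⟩
      ℓ % c + ℓ / c * c      <⟨ ℕ.+-monoˡ-< (ℓ / c * c) (m%n<n ℓ c) ⟩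
      suc (ℓ / c) * c        ≡⟨ ℕ.*-comm (suc (ℓ / c)) c ⟩
      c * suc (ℓ / c)        ∎
      where open ℕ.≤-Reasoning
    L+4≤ : L + 4 ≤ ℓ / c
    L+4≤ = ℕ.≤-pred (ℕ.*-cancelˡ-< c _ _ (ℕ.≤-<-trans long strictly-below))
    4≤ : 2 ≤ ℓ / c
    4≤ = ℕ.≤-trans (ℕ.≤-trans (s≤s (s≤s z≤n)) (ℕ.m≤n+m 4 L)) L+4≤
    H+2 : H + 2 ≡ ℓ / c
    H+2 = ℕ.m∸n+n≡m 4≤
    L+2≤H : L + 2 ≤ H
    L+2≤H = ℕ.+-cancelʳ-≤ 2 _ _ (ℕ.≤-trans (ℕ.≤-reflexive (ℕ.+-assoc L 2 2)) (ℕ.≤-trans L+4≤ (ℕ.≤-reflexive (sym H+2))))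

  -- Only three consequences of the group structure enter: multiplication by x preserves and
  -- reflects equality of classes, and an equality between classes of quotients may be
  -- cross-multiplied.
  module Theorem
    (n : ℕ) (col : ℕ → ℕ → ℕ) (col<n : ∀ p q → col p q < n) (R : Set)
    (χ-cong : ∀ x {y z} → 0 < x → 0 < y → 0 < z → col y 1 ≡ col z 1 → col (x * y) 1 ≡ col (x * z) 1)
    (χ-cancel : ∀ x {y z} → 0 < x → 0 < y → 0 < z → col (x * y) 1 ≡ col (x * z) 1 → col y 1 ≡ col z 1)
    (col-χ : ∀ {p q r s} → 0 < p → 0 < q → 0 < r → 0 < s → col p q ≡ col r s → col (p * s) 1 ≡ col (r * q) 1)
    where
    open Colouring n col col<n R public

    module Equation
      (M : ℕ) (M>0 : 0 < M) (tab : Table M) (A B : ℕ) (A>0 : 0 < A) (B>0 : 0 < B)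
      (p₁ q₁ : ℕ) (p₁-one : One M p₁) (q₁-one : One M q₁) (near₁ : Near (4 * M) p₁ q₁) where

      C : ℕ
      C = A + B

      C>0 : 0 < C
      C>0 = ℕ.<-≤-trans A>0 (ℕ.m≤m+n A B)

      abstract
        p₀ : ℕ
        p₀ = 40 * (C * (n * (n * n)))

        p₀≡ : p₀ ≡ 40 * (C * (n * (n * n)))
        p₀≡ = refl

      open Extremal M M>0 p₀

      -- The last condition says that u / v has the class of p₁ / q₁. In the application p₁ / q₁ is
      -- X / (X - E), so u compensates for the replacement of X by X - E.
      Solution : Set
      Solution = ∃₂ λ u v → ∃ λ w → 0 < u × 0 < v × 0 < w ×
        A * u + B * w ≡ C * v × χ w ≡ χ v × χ (u * q₁) ≡ χ (p₁ * v)

      Q>0 : 0 < Q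
      Q>0 = 0<* n>0 (subst (0 <_) (sym p₀≡) (0<* (s≤s (z≤n {39})) (0<* C>0 (0<* n>0 (0<* n>0 n>0)))))

      module Progression
        (q : ℕ) (p₀≤q : p₀ ≤ q) (q≤Q : q ≤ Q)
        (d c : ℕ) (d>0 : 0 < d) (M∣d : M ∣ d) where

        p T : ℕ
        p = suc q
        T = d * (B * C)

        T>0 : 0 < T
        T>0 = 0<* d>0 (0<* B>0 C>0)

        abstract
          -- `c₃` is a bound for a / J that is available before the window. `N` is the closeness
          -- demanded of the candidates for e: at least 10 c₃ and 3 for the rescaling, and a
          -- multiple of T so that congruences modulo N hold modulo T.
          c₃ N : ℕ
          c₃ = 8 * (c * d) * (C * (A * suc Q))
          N = (10 * c₃ + 3) * T

          c₃≡ : c₃ ≡ 8 * (c * d) * (C * (A * suc Q))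
          c₃≡ = refl

          T∣N : T ∣ N
          T∣N = n∣m*n (10 * c₃ + 3)

          10c₃≤N : 10 * c₃ ≤ N
          10c₃≤N = ℕ.≤-trans (ℕ.m≤m+n (10 * c₃) 3) (ℕ.m≤m*n (10 * c₃ + 3) T {{>-nonZero T>0}})

          3≤N : 3 ≤ N
          3≤N = ℕ.≤-trans (ℕ.m≤n+m 3 (10 * c₃)) (ℕ.m≤m*n (10 * c₃ + 3) T {{>-nonZero T>0}})

        N>0 : 0 < N
        N>0 = ℕ.≤-trans (s≤s z≤n) 3≤N

        -- In the second case P = Π r / s is an integer, so replacing Π by P multiplies the class of
        -- e by γ and hardly changes its size.
        Candidate : ℕ → ℕ → Set
        Candidate Π γ = (Pair M γ → R) ⊎
          (∃ λ P → ∃₂ λ r s → One N P × Near N P Π × One N r × One N s × P * s ≡ Π * r × col r s ≡ γ)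

        -- `Π` is the product of the denominators s of one pair for each available class. This makes
        -- all the quotients Π r / s integral simultaneously.
        candidates : ∀ m → (∀ γ → γ < m → Pair N γ ⊎ (Pair M γ → R)) →
                     ∃ λ Π → One N Π × (∀ γ → γ < m → Candidate Π γ)
        candidates zero    _ = 1 , (0 , cong suc (sym (ℕ.*-zeroʳ N))) , λ γ ()
        candidates (suc m) h with candidates m (λ γ γ<m → h γ (ℕ.m<n⇒m<1+n γ<m)) | h m ℕ.≤-refl
        ... | Π , Π-one , old | inj₂ none = Π , Π-one , λ γ γ<sm → case γ (ℕ.m≤n⇒m<n∨m≡n (ℕ.≤-pred γ<sm))
          where
          case : ∀ γ → γ < m ⊎ γ ≡ m → Candidate Π γ
          case γ (inj₁ γ<m)  = old γ γ<m
          case γ (inj₂ refl) = inj₁ none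
        ... | Π , Π-one , old | inj₁ (r , s , r-one , s-one , near , eq) =
          Π * s , One-* {N} Π-one s-one , λ γ γ<sm → case γ (ℕ.m≤n⇒m<n∨m≡n (ℕ.≤-pred γ<sm))
          where
          enlarge : ∀ {γ} → Candidate Π γ → Candidate (Π * s) γ
          enlarge (inj₁ none) = inj₁ none
          enlarge (inj₂ (P , r′ , s′ , P-one , near′ , r′-one , s′-one , Ps≡Πr , eq′)) =
            inj₂ (P * s , r′ , s′ , One-* {N} P-one s-one ,
                  subst₂ (Near N) (ℕ.*-comm s P) (ℕ.*-comm s Π) (Near-*ˡ {N} s near′) , r′-one , s′-one ,
                  trans (identity1 P s s′) (trans (cong (_* s) Ps≡Πr) (identity1 Π r′ s)) , eq′)
          case : ∀ γ → γ < m ⊎ γ ≡ m → Candidate (Π * s) γ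
          case γ (inj₁ γ<m)  = enlarge (old γ γ<m)
          case γ (inj₂ refl) = inj₂ (Π * r , r , s , One-* {N} Π-one r-one , Near-*ˡ {N} Π near , r-one , s-one , identity1 Π r s , eq)

        module Scaled (Π : ℕ) (Π-one : One N Π) (cand : ∀ γ → γ < n → Candidate Π γ) where

          -- With n Q values of s, the most popular class contains at least Q of them, which is the
          -- size of Λ needed against the diagonal.
          S : ℕ
          S = n * Q

          abstract
            -- These must not depend on the window, since the threshold `L` is obtained from `c′`
            -- and `step`. `E` bounds e₀ through ρ ≤ 2 T, and `c₄` makes c₄ (H + 2) equal to 4 C K.
            -- `c′` is the shape of all subwindows. The two summands of `step` bound the differences
            -- for the residue classes and for the progressions in y, where P ≤ 2 Π.
            E c₄ c′ step : ℕ
            E = 2 * T * Π * (1 + T * (N * S))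
            c₄ = 16 * (C * (A * suc Q)) * E
            c′ = 16 * (c * d) * c₄
            step = d * C + d * B * (A * (2 * T * (2 * Π) * S * T))

            E≡ : E ≡ 2 * T * Π * (1 + T * (N * S))
            E≡ = refl

            c₄≡ : c₄ ≡ 16 * (C * (A * suc Q)) * E
            c₄≡ = refl

            c′≡ : c′ ≡ 16 * (c * d) * c₄
            c′≡ = refl

            step≡ : step ≡ d * C + d * B * (A * (2 * T * (2 * Π) * S * T))
            step≡ = refl

          Π>0 : 0 < Π
          Π>0 = One⇒pos {N} Π-one

          T≤E : T ≤ E
          T≤E = begin
            T                                ≤⟨ ℕ.m≤n*m T 2 ⟩
            2 * T                            ≤⟨ ℕ.m≤m*n (2 * T) Π {{>-nonZero Π>0}} ⟩
            2 * T * Π                        ≤⟨ ℕ.m≤m*n (2 * T * Π) (1 + T * (N * S)) ⟩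
            2 * T * Π * (1 + T * (N * S))    ≡⟨ E≡ ⟨
            E                                ∎
            where open ℕ.≤-Reasoning

          E>0 : 0 < E
          E>0 = ℕ.≤-trans T>0 T≤E

          E≤c₄ : E ≤ c₄
          E≤c₄ = subst (E ≤_) (sym c₄≡) (ℕ.m≤n*m E (16 * (C * (A * suc Q))) {{>-nonZero (0<* (s≤s (z≤n {15})) (0<* C>0 (0<* A>0 (s≤s (z≤n {Q})))))}})

          c₄>0 : 0 < c₄
          c₄>0 = ℕ.≤-trans E>0 E≤c₄

          module Windowed
            (L : ℕ) (sp : ∀ d′ → d′ < suc step → 0 < d′ → M ∣ d′ → Sparse p c′ d′ L)
            (a ℓ g : ℕ) (long : c₄ * (L + 4) ≤ ℓ) (win : Window c d a ℓ)
            (dense : + (q * ℓ) ℤ.≤ + Q ℤ.* count g a d ℓ) where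

            open Window win

            private
              quot = quotient c₄ ℓ L c₄>0 long

            H : ℕ
            H = proj₁ quot

            L+2≤H : L + 2 ≤ H
            L+2≤H = proj₁ (proj₂ quot)

            ℓ-low : c₄ * (H + 2) ≤ ℓ
            ℓ-low = proj₁ (proj₂ (proj₂ quot))

            L≤H : L ≤ H
            L≤H = ℕ.≤-trans (ℕ.m≤m+n L 2) L+2≤H

            H>0 : 0 < H
            H>0 = ℕ.≤-trans (ℕ.≤-trans (s≤s z≤n) (ℕ.m≤n+m 2 L)) L+2≤H

            ℓ-high : ℓ ≤ 2 * (c₄ * (H + 2))
            ℓ-high = begin
              ℓ                      ≤⟨ proj₂ (proj₂ (proj₂ quot)) ⟩
              c₄ * (H + 3)           ≤⟨ ℕ.*-monoʳ-≤ c₄ (ℕ.≤-trans (ℕ.+-monoʳ-≤ H (s≤s (s≤s (s≤s (z≤n {1}))))) (ℕ.+-monoˡ-≤ 4 (ℕ.m≤m+n H H))) ⟩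
              c₄ * (H + H + 4)       ≡⟨ identity2 c₄ H ⟩
              2 * (c₄ * (H + 2))     ∎
              where
              open ℕ.≤-Reasoning

            ℓ≤8c₄H : ℓ ≤ 8 * (c₄ * H)
            ℓ≤8c₄H = begin
              ℓ                        ≤⟨ ℓ-high ⟩
              2 * (c₄ * (H + 2))       ≤⟨ ℕ.*-monoʳ-≤ 2 (ℕ.*-monoʳ-≤ c₄ (ℕ.+-monoʳ-≤ H (ℕ.*-monoʳ-≤ 2 H>0))) ⟩
              2 * (c₄ * (H + 2 * H))   ≤⟨ ℕ.m≤m+n _ (2 * (c₄ * H)) ⟩
              2 * (c₄ * (H + 2 * H)) + 2 * (c₄ * H) ≡⟨ identity3 c₄ H ⟩
              8 * (c₄ * H)             ∎
              where
              open ℕ.≤-Reasoning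

            J K : ℕ
            J = 4 * E * (H + 2)
            K = A * suc Q * J

            c₄≡4CK : c₄ * (H + 2) ≡ 4 * (C * K)
            c₄≡4CK = trans (cong (_* (H + 2)) c₄≡) (identity4 C A (suc Q) E H)

            4CK≤ℓ : 4 * (C * K) ≤ ℓ
            4CK≤ℓ = ℕ.≤-trans (ℕ.≤-reflexive (sym c₄≡4CK)) ℓ-low

            ℓ≤8CK : ℓ ≤ 8 * (C * K)
            ℓ≤8CK = ℕ.≤-trans ℓ-high (ℕ.≤-reflexive (trans (cong (2 *_) c₄≡4CK) (identity5 (C * K))))

            a≤c₃J : a ≤ c₃ * J
            a≤c₃J = begin
              a                         ≤⟨ high ⟩
              c * (d * ℓ)               ≤⟨ ℕ.*-monoʳ-≤ c (ℕ.*-monoʳ-≤ d ℓ≤8CK) ⟩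
              c * (d * (8 * (C * K)))   ≡⟨ identity6 c d C (A * suc Q) J ⟩
              8 * (c * d) * (C * (A * suc Q)) * J ≡⟨ cong (_* J) c₃≡ ⟨
              c₃ * J                    ∎
              where
              open ℕ.≤-Reasoning

            dℓ≤a : d * ℓ ≤ a
            dℓ≤a = ℕ.≤-trans (ℕ.m≤n*m (d * ℓ) (4 * M) {{>-nonZero (0<* (s≤s (z≤n {3})) M>0)}}) low

            T≤a : T ≤ a
            T≤a = ℕ.≤-trans T≤E (ℕ.≤-trans E≤c₄ (ℕ.≤-trans (ℕ.m≤m*n c₄ (H + 2) {{>-nonZero (ℕ.≤-trans H>0 (ℕ.m≤m+n H 2))}})
              (ℕ.≤-trans ℓ-low (ℕ.≤-trans (ℕ.m≤n*m ℓ d {{>-nonZero d>0}}) dℓ≤a))))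

            J>0 : 0 < J
            J>0 = 0<* (0<* (s≤s (z≤n {3})) E>0) (ℕ.≤-trans H>0 (ℕ.m≤m+n H 2))

            H≤J : H ≤ J
            H≤J = ℕ.≤-trans (ℕ.m≤m+n H 2) (ℕ.m≤n*m (H + 2) (4 * E) {{>-nonZero (0<* (s≤s (z≤n {3})) E>0)}})

            AJ≤K : A * J ≤ K
            AJ≤K = ℕ.*-monoˡ-≤ J (ℕ.m≤m*n A (suc Q))

            J≤K : J ≤ K
            J≤K = ℕ.≤-trans (ℕ.m≤n*m J A {{>-nonZero A>0}}) AJ≤K

            defect≡ : ∀ a′ d′ ℓ′ → Σ ℓ′ (λ i → + p ℤ.- + Q ℤ.* ind (χ (a′ + d′ * i)) g) ≡
                                   + (p * ℓ′) ℤ.- + Q ℤ.* count g a′ d′ ℓ′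
            defect≡ a′ d′ ℓ′ = trans (Σ-cong ℓ′ λ i _ → cong (ℤ._+_ (+ p)) (ℤ.neg-distribˡ-* (+ Q) (hit i)))
              (trans (Σ-+ ℓ′ (λ _ → + p) (λ i → (ℤ.- (+ Q)) ℤ.* hit i))
              (cong₂ ℤ._+_ (trans (Σ-const ℓ′ (+ p)) (trans (ℤ.*-comm (+ ℓ′) (+ p)) (sym (ℤ.pos-* p ℓ′))))
                (trans (Σ-*ˡ ℓ′ (ℤ.- (+ Q)) hit) (sym (ℤ.neg-distribˡ-* (+ Q) (Σ ℓ′ hit))))))
              where
              hit : ℕ → ℤ
              hit i = ind (χ (a′ + d′ * i)) g

            -- Every progression inside the window, of length comparable to
            -- that of the window, meets each colour with density below p / Q.
            module Inside (d′ δ ℓ′ : ℕ) (d′>0 : 0 < d′) (M∣d′ : M ∣ d′) (M∣δ : M ∣ δ) (d′≤ : d′ ≤ step)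
                          (δ≤ : δ ≤ d * ℓ) (d′ℓ′≤ : d′ * ℓ′ ≤ d * ℓ) (H≤ℓ′ : H ≤ ℓ′) where

              inside : Window c′ d′ (a + δ) ℓ′
              inside = window (One-+ δ one M∣δ)
                (ℕ.≤-trans (ℕ.*-monoʳ-≤ (4 * M) d′ℓ′≤) (ℕ.≤-trans low (ℕ.m≤m+n a δ))) (begin
                  a + δ                          ≤⟨ ℕ.+-monoʳ-≤ a (ℕ.≤-trans δ≤ dℓ≤a) ⟩
                  a + a                          ≤⟨ ℕ.+-mono-≤ high′ high′ ⟩
                  c * (d * (8 * (c₄ * ℓ′))) + c * (d * (8 * (c₄ * ℓ′))) ≡⟨ identity7 c d c₄ ℓ′ ⟩
                  16 * (c * d) * c₄ * ℓ′         ≡⟨ cong (_* ℓ′) c′≡ ⟨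
                  c′ * ℓ′                        ≤⟨ ℕ.*-monoʳ-≤ c′ (ℕ.m≤n*m ℓ′ d′ {{>-nonZero d′>0}}) ⟩
                  c′ * (d′ * ℓ′)                 ∎)
                where
                open ℕ.≤-Reasoning
                high′ : a ≤ c * (d * (8 * (c₄ * ℓ′)))
                high′ = ℕ.≤-trans high (ℕ.*-monoʳ-≤ c (ℕ.*-monoʳ-≤ d (ℕ.≤-trans ℓ≤8c₄H
                  (ℕ.*-monoʳ-≤ 8 (ℕ.*-monoʳ-≤ c₄ H≤ℓ′)))))

              defect : ℤ
              defect = Σ ℓ′ (λ i → + p ℤ.- + Q ℤ.* ind (χ (a + δ + d′ * i)) g)

              nonneg : Cont R (0ℤ ℤ.≤ defect)
              nonneg with + (p * ℓ′) ℤ.≤? + Q ℤ.* count g (a + δ) d′ ℓ′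
              -- A progression of density at least p / Q would be a window excluded by `sp`, which
              -- proves R outright.
              ... | yes too-dense = λ _ → sp d′ (s≤s d′≤) d′>0 M∣d′ record
                { a = a + δ ; ℓ = ℓ′ ; g = g ; long = ℕ.≤-trans L≤H H≤ℓ′ ; ℓ>0 = ℕ.≤-trans H>0 H≤ℓ′
                ; win = inside ; dense = too-dense }
              ... | no ok = return (subst (0ℤ ℤ.≤_) (sym (defect≡ (a + δ) d′ ℓ′)) (ℤ.i≤j⇒0≤j-i (ℤ.<⇒≤ (ℤ.≰⇒> ok))))

            H≤K : H ≤ K
            H≤K = ℕ.≤-trans H≤J J≤K

            -- The other residue classes, and the part of the window beyond
            -- d D K, have nonnegative defect.
            class-sum : ∀ D → 0 < D → D ≤ C → Cont R (Σ K (λ k → + p ℤ.- + Q ℤ.* ind (χ (a + d * D * k)) g) ℤ.≤ + (8 * (C * K)))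
            class-sum D D>0 D≤C =
              all-below D class >>= λ classes → rest >>= λ rest≥0 → return (conclude classes rest≥0)
              where
              ψ : ℕ → ℤ
              ψ i = + p ℤ.- + Q ℤ.* ind (χ (a + d * i)) g
              KD≤ℓ : 4 * (K * D) ≤ ℓ
              KD≤ℓ = ℕ.≤-trans (ℕ.*-monoʳ-≤ 4 (ℕ.≤-trans (ℕ.*-monoʳ-≤ K D≤C) (ℕ.≤-reflexive (ℕ.*-comm K C)))) 4CK≤ℓ
              KD≤ : K * D ≤ ℓ
              KD≤ = ℕ.≤-trans (ℕ.m≤n*m (K * D) 4) KD≤ℓ
              K≤KD : K ≤ K * D
              K≤KD = ℕ.m≤m*n K D {{>-nonZero D>0}}
              r = ℓ ∸ K * D
              ℓ≡ : K * D + r ≡ ℓ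
              ℓ≡ = ℕ.m+[n∸m]≡n KD≤
              H≤r : H ≤ r
              H≤r = ℕ.+-cancelˡ-≤ (K * D) _ _ (begin
                K * D + H          ≤⟨ ℕ.+-monoʳ-≤ (K * D) (ℕ.≤-trans H≤K K≤KD) ⟩
                K * D + K * D      ≤⟨ ℕ.m≤m+n _ (2 * (K * D)) ⟩
                K * D + K * D + 2 * (K * D) ≡⟨ identity8 (K * D) ⟩
                4 * (K * D)        ≤⟨ KD≤ℓ ⟩
                ℓ                  ≡⟨ ℓ≡ ⟨
                K * D + r          ∎)
                where
                open ℕ.≤-Reasoning
              step≥ : d * D ≤ step
              step≥ = ℕ.≤-trans (ℕ.*-monoʳ-≤ d D≤C) (ℕ.≤-trans (ℕ.m≤m+n (d * C) _) (ℕ.≤-reflexive (sym step≡)))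
              assoc : ∀ D k b → a + d * b + d * D * k ≡ a + d * (k * D + b)
              assoc D k b = identity10 a d D k b
              class : ∀ b → b < D → Cont R (0ℤ ℤ.≤ Σ K (λ k → ψ (k * D + b)))
              class b b<D = nonneg >>= λ h →
                return (subst (0ℤ ℤ.≤_) (Σ-cong K λ k _ → cong (λ z → + p ℤ.- + Q ℤ.* ind (χ z) g) (assoc D k b)) h)
                where
                open Inside (d * D) (d * b) K (0<* d>0 D>0) (∣m⇒∣m*n D M∣d) (∣m⇒∣m*n b M∣d) step≥
                  (ℕ.*-monoʳ-≤ d (ℕ.≤-trans (ℕ.≤-trans (ℕ.<⇒≤ b<D) (ℕ.m≤n*m D K {{>-nonZero (ℕ.≤-trans H>0 H≤K)}})) KD≤))
                  (subst (_≤ d * ℓ) (identity9 d K D) (ℕ.*-monoʳ-≤ d KD≤)) H≤K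
              rest : Cont R (0ℤ ℤ.≤ Σ r (λ i → ψ (K * D + i)))
              rest = nonneg >>= λ h →
                return (subst (0ℤ ℤ.≤_) (Σ-cong r λ i _ → cong (λ z → + p ℤ.- + Q ℤ.* ind (χ z) g)
                  (trans (ℕ.+-assoc a (d * (K * D)) (d * i)) (cong (_+_ a) (sym (ℕ.*-distribˡ-+ d (K * D) i))))) h)
                where
                open Inside d (d * (K * D)) r d>0 M∣d (∣m⇒∣m*n (K * D) M∣d)
                  (ℕ.≤-trans (ℕ.m≤m*n d D {{>-nonZero D>0}}) step≥)
                  (ℕ.*-monoʳ-≤ d KD≤) (ℕ.*-monoʳ-≤ d (ℕ.m∸n≤m ℓ (K * D))) H≤r
              -- The density of the window is at least q / Q and p is q + 1, so the defect is at
              -- most 1 per term, although single values of ψ may have size about Q.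
              total : Σ ℓ ψ ℤ.≤ + ℓ
              total = ℤ.≤-trans (ℤ.≤-reflexive (defect≡ a d ℓ)) (ℤ.≤-trans (ℤ.+-monoʳ-≤ (+ (p * ℓ)) (ℤ.neg-mono-≤ dense))
                (ℤ.≤-reflexive (trans (cong (ℤ._- + (q * ℓ)) (ℤ.pos-+ ℓ (q * ℓ))) (eq (+ ℓ) (+ (q * ℓ))))))
                where
                eq : ∀ x y → (x ℤ.+ y) ℤ.- y ≡ x
                eq = ℤ-Solver.solve-∀
              conclude : (∀ b → b < D → 0ℤ ℤ.≤ Σ K (λ k → ψ (k * D + b))) → 0ℤ ℤ.≤ Σ r (λ i → ψ (K * D + i)) →
                         Σ K (λ k → + p ℤ.- + Q ℤ.* ind (χ (a + d * D * k)) g) ℤ.≤ + (8 * (C * K))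
              conclude classes rest≥0 = begin
                Σ K (λ k → + p ℤ.- + Q ℤ.* ind (χ (a + d * D * k)) g)
                  ≡⟨ Σ-cong K (λ k _ → cong (λ z → + p ℤ.- + Q ℤ.* ind (χ (a + z)) g) (identity11 d D k)) ⟩
                Σ K (λ k → ψ (k * D + 0))                          ≤⟨ Σ-first D {f = λ b → Σ K (λ k → ψ (k * D + b))} D>0 classes ⟩
                Σ D (λ b → Σ K (λ k → ψ (k * D + b)))              ≡⟨ Σ-block D K ψ ⟨
                Σ (K * D) ψ                                        ≡⟨ ℤ.+-identityʳ _ ⟨
                Σ (K * D) ψ ℤ.+ 0ℤ                                 ≤⟨ ℤ.+-monoʳ-≤ (Σ (K * D) ψ) rest≥0 ⟩
                Σ (K * D) ψ ℤ.+ Σ r (λ i → ψ (K * D + i))          ≡⟨ Σ-split (K * D) r ψ ⟨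
                Σ (K * D + r) ψ                                    ≡⟨ cong (λ z → Σ z ψ) ℓ≡ ⟩
                Σ ℓ ψ                                              ≤⟨ total ⟩
                + ℓ                                                ≤⟨ ℤ.+≤+ ℓ≤8CK ⟩
                + (8 * (C * K))                                    ∎
                where
                open ℤ.≤-Reasoning

            B≤C : B ≤ C
            B≤C = ℕ.m≤n+m B A

            C≤Q : C ≤ Q
            C≤Q = begin
              C                         ≤⟨ ℕ.m≤m*n C (n * (n * n)) {{>-nonZero (0<* n>0 (0<* n>0 n>0))}} ⟩
              C * (n * (n * n))         ≤⟨ ℕ.m≤n*m _ 40 ⟩
              40 * (C * (n * (n * n)))  ≡⟨ p₀≡ ⟨
              p₀                        ≤⟨ ℕ.m≤n*m p₀ n {{>-nonZero n>0}} ⟩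
              Q                         ∎
              where open ℕ.≤-Reasoning

            M∣T : M ∣ T
            M∣T = ∣m⇒∣m*n (B * C) M∣d

            TJ≤dℓ : T * J ≤ d * ℓ
            TJ≤dℓ = begin
              T * J                    ≡⟨ identity12 d B C J ⟩
              d * (C * (1 * B * J))    ≤⟨ ℕ.*-monoʳ-≤ d (ℕ.*-monoʳ-≤ C (ℕ.*-monoˡ-≤ J
                                            (ℕ.*-mono-≤ A>0 (ℕ.≤-trans B≤C (ℕ.≤-trans C≤Q (ℕ.n≤1+n Q)))))) ⟩
              d * (C * K)              ≤⟨ ℕ.*-monoʳ-≤ d (ℕ.≤-trans (ℕ.m≤n*m (C * K) 4) 4CK≤ℓ) ⟩
              d * ℓ                    ∎
              where
              open ℕ.≤-Reasoning

            -- The positions in the progression of v stay below 2 K, because k and the shifts are at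
            -- most K each.
            dB2K≤dℓ : d * B * (2 * K) ≤ d * ℓ
            dB2K≤dℓ = begin
              d * B * (2 * K)          ≡⟨ identity13 d B K ⟩
              d * (2 * (B * K))        ≤⟨ ℕ.*-monoʳ-≤ d (ℕ.*-mono-≤ (s≤s (s≤s (z≤n {2}))) (ℕ.*-monoˡ-≤ K B≤C)) ⟩
              d * (4 * (C * K))        ≤⟨ ℕ.*-monoʳ-≤ d 4CK≤ℓ ⟩
              d * ℓ                    ∎
              where
              open ℕ.≤-Reasoning

            private
              res = residue T a T>0 T≤a

            ρ b : ℕ
            ρ = proj₁ res
            b = proj₁ (proj₂ res)

            ρ>0 : 0 < ρ
            ρ>0 = proj₁ (proj₂ (proj₂ (proj₂ res)))

            ρ≤2T : ρ ≤ 2 * T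
            ρ≤2T = proj₂ (proj₂ (proj₂ (proj₂ res)))

            e≤E : ρ * Π * (1 + T * (N * S)) ≤ E
            e≤E = ℕ.≤-trans (ℕ.*-monoˡ-≤ (1 + T * (N * S)) (ℕ.*-monoˡ-≤ Π ρ≤2T)) (ℕ.≤-reflexive (sym E≡))

            module Sc = Rescaling T N S Π ρ a b E H c₃ T>0 10c₃≤N 3≤N Π>0 ρ>0 (proj₁ (proj₂ (proj₂ res))) e≤E a≤c₃J

            x₀ : ℕ
            x₀ = Sc.x₀

            s x v w : ℕ → ℕ
            s i = 1 + T * (N * S + i)
            x y = x₀ + T * y
            v m = a + d * B * m
            w k = a + d * C * k

            S>0 : 0 < S
            S>0 = 0<* n>0 Q>0

            private
              pop-s = popular n S (λ i → χ (s i)) S>0 (λ i → col<n (s i) 1)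
              pop-x = popular n H (λ y → χ (x y)) H>0 (λ y → col<n (x y) 1)

            σ τ : ℕ
            σ = proj₁ pop-s
            τ = proj₁ pop-x

            Λ-large : + Q ℤ.≤ Σ S (λ i → ind (χ (s i)) σ)
            Λ-large = ℤ.*-cancelˡ-≤-pos _ _ (+ n) {{pos n>0}}
              (subst (ℤ._≤ + n ℤ.* Σ S (λ i → ind (χ (s i)) σ)) (ℤ.pos-* n Q) (proj₂ (proj₂ pop-s)))
              where
              pos : ∀ {m} → 0 < m → ℤ.Positive (+ m)
              pos (s≤s _) = _

            p-large : 40 * (C * (n * (n * n))) ≤ p
            p-large = ℕ.≤-trans (ℕ.≤-reflexive (sym p₀≡)) (ℕ.≤-trans p₀≤q (ℕ.n≤1+n q))

            Q≤np : Q ≤ n * p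
            Q≤np = ℕ.*-monoʳ-≤ n (ℕ.≤-trans p₀≤q (ℕ.n≤1+n q))

            module At (P : ℕ) (P-one : One N P) (near : Near N P Π) where

              private
                J₀ : ℕ
                J₀ = proj₁ (Sc.base P near (One-∣ T∣N P-one))

                base : ρ * P * s 0 * x₀ ≡ a + T * J₀
                base = proj₂ (Sc.base P near (One-∣ T∣N P-one))

                e : ℕ
                e = ρ * P

                P>0 : 0 < P
                P>0 = One⇒pos {N} P-one

                P≤2Π : P ≤ 2 * Π
                P≤2Π = ℕ.*-cancelˡ-≤ N {{>-nonZero N>0}} (begin
                  N * P         ≤⟨ proj₁ near ⟩
                  Π + N * Π     ≤⟨ ℕ.+-monoˡ-≤ (N * Π) (ℕ.m≤n*m Π N {{>-nonZero N>0}}) ⟩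
                  N * Π + N * Π ≡⟨ identity14 N Π ⟩
                  N * (2 * Π)   ∎)
                  where
                  open ℕ.≤-Reasoning

              module Pr = Progressions χ n A B Q p n>0 A>0 B>0 Q>0 Q≤np (s≤s q≤Q) p-large
                            d a e (N * S) x₀ J₀ g σ τ S H J H>0 J>0

              j≤J : ∀ i y → i ≤ S → y ≤ H → Pr.j i y ≤ J
              j≤J = Sc.j≤J P near base

              u≡ : ∀ i y → e * s i * x y ≡ a + T * Pr.j i y
              u≡ = Pr.u≡ base

              private
                -- For fixed i, i′ and k, the values of v form a progression in y. Its extent is
                -- controlled by A e (i′ - i) x, where e (i′ - i) x is at most j i′ H ≤ J, so it
                -- lies inside the window.
                progression : ∀ i i′ k → i < i′ → i′ < S → k < K → Cont R (0ℤ ℤ.≤ Σ H (λ y → Pr.ψ (k + Pr.β i i′ y)))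
                progression i i′ k i<i′ i′<S k<K = nonneg >>= λ h →
                  return (subst (0ℤ ℤ.≤_) (Σ-cong H λ y _ → cong (λ z → + p ℤ.- + Q ℤ.* ind (χ z) g)
                    (identity15 a d B A k (e * δ) x₀ T y)) h)
                  where
                  open ℕ.≤-Reasoning
                  δ d′ offset : ℕ
                  δ = i′ ∸ i
                  d′ = d * B * (A * (e * δ * T))
                  offset = d * B * (k + A * (e * δ * x₀))
                  δ≤i′ : δ ≤ i′
                  δ≤i′ = ℕ.m∸n≤m i′ i
                  reach : e * δ * (x₀ + T * H) ≤ J
                  reach = begin
                    e * δ * (x₀ + T * H)     ≤⟨ ℕ.*-monoˡ-≤ (x₀ + T * H) (ℕ.*-monoʳ-≤ e δ≤i′) ⟩
                    e * i′ * (x₀ + T * H)    ≤⟨ ℕ.m≤n+m _ (J₀ + e * s 0 * H) ⟩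
                    Pr.j i′ H                ≤⟨ j≤J i′ H (ℕ.<⇒≤ i′<S) ℕ.≤-refl ⟩
                    J                        ∎
                  d′>0 : 0 < d′
                  d′>0 = 0<* (0<* d>0 B>0) (0<* A>0 (0<* (0<* (0<* ρ>0 P>0) (ℕ.m<n⇒0<n∸m i<i′)) T>0))
                  d′≤ : d′ ≤ step
                  d′≤ = ℕ.≤-trans (ℕ.*-monoʳ-≤ (d * B) (ℕ.*-monoʳ-≤ A (ℕ.*-monoˡ-≤ T
                    (ℕ.*-mono-≤ (ℕ.*-mono-≤ ρ≤2T P≤2Π) (ℕ.≤-trans δ≤i′ (ℕ.<⇒≤ i′<S))))))
                    (ℕ.≤-trans (ℕ.m≤n+m _ (d * C)) (ℕ.≤-reflexive (sym step≡)))
                  offset≤ : offset ≤ d * ℓ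
                  offset≤ = ℕ.≤-trans (ℕ.*-monoʳ-≤ (d * B) (begin
                    k + A * (e * δ * x₀)    ≤⟨ ℕ.+-mono-≤ (ℕ.<⇒≤ k<K) (ℕ.≤-trans (ℕ.*-monoʳ-≤ A
                                                 (ℕ.≤-trans (ℕ.*-monoʳ-≤ (e * δ) (ℕ.m≤m+n x₀ (T * H))) reach)) AJ≤K) ⟩
                    K + K                   ≡⟨ cong (_+_ K) (ℕ.+-identityʳ K) ⟨
                    2 * K                   ∎)) dB2K≤dℓ
                  d′H≤ : d′ * H ≤ d * ℓ
                  d′H≤ = ℕ.≤-trans (begin
                    d′ * H                          ≡⟨ identity16 (d * B) A (e * δ) T H ⟩
                    d * B * (A * (e * δ * (T * H))) ≤⟨ ℕ.*-monoʳ-≤ (d * B) (ℕ.≤-trans (ℕ.*-monoʳ-≤ A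
                                                         (ℕ.≤-trans (ℕ.*-monoʳ-≤ (e * δ) (ℕ.m≤n+m (T * H) x₀)) reach)) AJ≤K) ⟩
                    d * B * K                       ≤⟨ ℕ.*-monoʳ-≤ (d * B) (ℕ.m≤n*m K 2) ⟩
                    d * B * (2 * K)                 ∎) dB2K≤dℓ
                  open Inside d′ offset H d′>0
                    (∣m⇒∣m*n (A * (e * δ * T)) (∣m⇒∣m*n B M∣d))
                    (∣m⇒∣m*n (k + A * (e * δ * x₀)) (∣m⇒∣m*n B M∣d))
                    d′≤ offset≤ d′H≤ ℕ.≤-refl

                progressions : Cont R (∀ i′ → i′ < S → ∀ i → i < i′ → ∀ k → k < K →
                                       0ℤ ℤ.≤ Σ H (λ y → Pr.ψ (k + Pr.β i i′ y)))
                progressions = all-below S λ i′ i′<S → all-below i′ λ i i<i′ → all-below K λ k k<K →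
                  progression i i′ k i<i′ i′<S k<K

              found : Cont R (∃ λ k → k < K × ∃ λ i → i < S × ∃ λ y → y < H × Pr.Solution k i y)
              found = progressions >>= λ pos → class-sum C C>0 ℕ.≤-refl >>= λ w-sum → class-sum B B>0 B≤C >>= λ v-sum →
                return (Search.solution χ n A B Q p n>0 A>0 B>0 Q>0 Q≤np (s≤s q≤Q) p-large
                  d a e (N * S) x₀ J₀ g σ τ S H J H>0 J>0 (λ i y i<S y<H → j≤J i y (ℕ.<⇒≤ i<S) (ℕ.<⇒≤ y<H)) Λ-large (proj₂ (proj₂ pop-x))
                  w-sum v-sum (λ i i′ k i<i′ i′<S k<K → pos i′ i′<S i i<i′ k k<K))

            -- A reference solution of the shape u = ρ Π s x fixes the class γ
            -- by which Π must be changed.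
            result : Cont R Solution
            result = with-candidate (cand γ (col<n _ _))
              where
              i₁ y₁ i₂ u* v* γ : ℕ
              sσ : ∃ λ i → i < S × χ (s i) ≡ σ
              sσ = Σ-pos⇒∃ S (λ i → χ (s i)) σ (positive-count n S>0 _ (proj₂ (proj₂ pop-s)))
              xτ : ∃ λ y → y < H × χ (x y) ≡ τ
              xτ = Σ-pos⇒∃ H (λ y → χ (x y)) τ (positive-count n H>0 _ (proj₂ (proj₂ pop-x)))
              vg : ∃ λ i → i < ℓ × χ (a + d * i) ≡ g
              vg = Σ-pos⇒∃ ℓ (λ i → χ (a + d * i)) g (positive-count Q qℓ>0 _ dense)
                where
                ℓ>0 : 0 < ℓ
                ℓ>0 = ℕ.≤-trans (ℕ.≤-trans H>0 H≤K) (ℕ.≤-trans (ℕ.m≤n*m K (4 * C) {{>-nonZero (0<* (s≤s (z≤n {3})) C>0)}})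
                        (ℕ.≤-trans (ℕ.≤-reflexive (ℕ.*-assoc 4 C K)) 4CK≤ℓ))
                qℓ>0 : 0 < q * ℓ
                qℓ>0 = 0<* (ℕ.≤-trans (subst (0 <_) (sym p₀≡) (0<* (s≤s (z≤n {39})) (0<* C>0 (0<* n>0 (0<* n>0 n>0))))) p₀≤q) ℓ>0
              i₁ = proj₁ sσ
              y₁ = proj₁ xτ
              i₂ = proj₁ vg
              u* = ρ * Π * s i₁ * x y₁
              v* = a + d * i₂
              -- The class by which u* has to be multiplied for u* / v* to have the class of p₁ /
              -- q₁.
              γ = col (p₁ * v*) (q₁ * u*)

              u*≡ : u* ≡ a + T * At.Pr.j Π Π-one (Near-refl N Π) i₁ y₁
              u*≡ = At.u≡ Π Π-one (Near-refl N Π) i₁ y₁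

              a>0 : 0 < a
              a>0 = One⇒pos {M} one
              v*>0 : 0 < v*
              v*>0 = ℕ.≤-trans a>0 (ℕ.m≤m+n a (d * i₂))
              u*>0 : 0 < u*
              u*>0 = ℕ.≤-trans a>0 (ℕ.≤-trans (ℕ.m≤m+n a _) (ℕ.≤-reflexive (sym u*≡)))
              p₁>0 : 0 < p₁
              p₁>0 = One⇒pos {M} p₁-one
              q₁>0 : 0 < q₁
              q₁>0 = One⇒pos {M} q₁-one

              in-window : ∀ z → z ≤ d * ℓ → 4 * M * (a + z) ≤ 4 * M * a + a
              in-window z z≤ = ℕ.≤-trans (ℕ.≤-reflexive (ℕ.*-distribˡ-+ (4 * M) a z))
                (ℕ.+-monoʳ-≤ (4 * M * a) (ℕ.≤-trans (ℕ.*-monoʳ-≤ (4 * M) z≤) low))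

              v*-near-u* : Near (4 * M) v* u*
              v*-near-u* = Near-interval {4 * M} {v*} {u*} {a} (in-window (d * i₂) (ℕ.*-monoʳ-≤ d (ℕ.<⇒≤ (proj₁ (proj₂ vg)))))
                (subst (λ z → 4 * M * z ≤ 4 * M * a + a) (sym u*≡) (in-window _ (ℕ.≤-trans (ℕ.*-monoʳ-≤ T
                  (At.j≤J Π Π-one (Near-refl N Π) i₁ y₁ (ℕ.<⇒≤ (proj₁ (proj₂ sσ))) (ℕ.<⇒≤ (proj₁ (proj₂ xτ))))) TJ≤dℓ)))
                (ℕ.m≤m+n a (d * i₂)) (ℕ.≤-trans (ℕ.m≤m+n a _) (ℕ.≤-reflexive (sym u*≡)))

              -- Both v* and u* belong to the window, so they are 1 modulo M and differ by a factor
              -- of at most 1 + 1 / 4M, just as p₁ and q₁ do. Hence γ occurs at the level M, which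
              -- rules out the first case of `Candidate`.
              pair : Pair M γ
              pair = p₁ * v* , q₁ * u* , One-* {M} p₁-one (One-+ (d * i₂) one (∣m⇒∣m*n i₂ M∣d)) ,
                One-* {M} q₁-one (subst (One M) (sym u*≡) (One-+ _ one (∣m⇒∣m*n _ M∣T))) ,
                Near-trans M {p₁ * v*} {q₁ * v*} {q₁ * u*} M>0
                  (subst₂ (Near (4 * M)) (ℕ.*-comm v* p₁) (ℕ.*-comm v* q₁) (Near-*ˡ {4 * M} v* near₁))
                  (Near-*ˡ {4 * M} q₁ v*-near-u*) , refl

              with-candidate : Candidate Π γ → Cont R Solution
              with-candidate (inj₁ none) _ = none pair
              with-candidate (inj₂ (P , r , t , P-one , near , r-one , t-one , Pt≡Πr , col≡)) =
                At.found P P-one near >>= λ (k , _ , i , _ , y , _ , wg , si , xy , vg′) →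
                return (solution k i y wg si xy vg′)
                where
                j : ℕ → ℕ → ℕ
                j = At.Pr.j P P-one near
                solution : ∀ k i y → χ (w k) ≡ g → χ (s i) ≡ σ → χ (x y) ≡ τ →
                           χ (v (k + A * j i y)) ≡ g → Solution
                solution k i y wg si xy vg′ =
                  a + T * j i y , v (k + A * j i y) , w k ,
                  ℕ.≤-trans a>0 (ℕ.m≤m+n a _) , v>0 , ℕ.≤-trans a>0 (ℕ.m≤m+n a _) ,
                  At.Pr.equation P P-one near i y k , trans wg (sym vg′) ,
                  χ-cancel t t>0 (0<* u>0 q₁>0) (0<* p₁>0 v>0) colours
                  where
                  v₁ = v (k + A * j i y)
                  u = a + T * j i y
                  u>0 : 0 < u
                  u>0 = ℕ.≤-trans a>0 (ℕ.m≤m+n a _)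
                  v>0 : 0 < v₁
                  v>0 = ℕ.≤-trans a>0 (ℕ.m≤m+n a _)
                  t>0 : 0 < t
                  t>0 = One⇒pos {N} t-one
                  r>0 : 0 < r
                  r>0 = One⇒pos {N} r-one
                  x>0 : ∀ y → 0 < x y
                  x>0 y = s≤s z≤n
                  s>0 : ∀ i → 0 < s i
                  s>0 i = s≤s z≤n
                  f = ρ * Π * r * q₁
                  f>0 : 0 < f
                  f>0 = 0<* (0<* (0<* ρ>0 Π>0) r>0) q₁>0
                  open ≡-Reasoning
                  regroup : t * (u * q₁) ≡ f * (s i * x y)
                  regroup = begin
                    t * (u * q₁)                         ≡⟨ cong (λ z → t * (z * q₁)) (sym (At.u≡ P P-one near i y)) ⟩
                    t * (ρ * P * s i * x y * q₁)         ≡⟨ identity17 t ρ P (s i) (x y) q₁ ⟩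
                    ρ * (P * t) * q₁ * (s i * x y)       ≡⟨ cong (λ z → ρ * z * q₁ * (s i * x y)) Pt≡Πr ⟩
                    ρ * (Π * r) * q₁ * (s i * x y)       ≡⟨ cong (λ z → z * q₁ * (s i * x y)) (ℕ.*-assoc ρ Π r) ⟨
                    f * (s i * x y)                      ∎
                  regroup′ : f * (s i₁ * x y₁) ≡ r * (q₁ * u*)
                  regroup′ = identity18 ρ Π r q₁ (s i₁) (x y₁)
                  sx : χ (s i * x y) ≡ χ (s i₁ * x y₁)
                  sx = begin
                    χ (s i * x y)     ≡⟨ χ-cong (s i) (s>0 i) (x>0 y) (x>0 y₁) (trans xy (sym (proj₂ (proj₂ xτ)))) ⟩
                    χ (s i * x y₁)    ≡⟨ cong χ (ℕ.*-comm (s i) (x y₁)) ⟩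
                    χ (x y₁ * s i)    ≡⟨ χ-cong (x y₁) (x>0 y₁) (s>0 i) (s>0 i₁) (trans si (sym (proj₂ (proj₂ sσ)))) ⟩
                    χ (x y₁ * s i₁)   ≡⟨ cong χ (ℕ.*-comm (x y₁) (s i₁)) ⟩
                    χ (s i₁ * x y₁)   ∎
                  -- Since s and x keep their classes σ and τ, t u has the class of r u*. As r / t
                  -- has the class γ, this turns q₁ u* into p₁ v*, and v* may be replaced by v
                  -- because both lie in g.
                  colours : χ (t * (u * q₁)) ≡ χ (t * (p₁ * v₁))
                  colours = begin
                    χ (t * (u * q₁))             ≡⟨ cong χ regroup ⟩
                    χ (f * (s i * x y))          ≡⟨ χ-cong f f>0 (0<* {s i} (s>0 i) (x>0 y)) (0<* {s i₁} (s>0 i₁) (x>0 y₁)) sx ⟩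
                    χ (f * (s i₁ * x y₁))        ≡⟨ cong χ regroup′ ⟩
                    χ (r * (q₁ * u*))            ≡⟨ col-χ r>0 t>0 (0<* p₁>0 v*>0) (0<* q₁>0 u*>0) col≡ ⟩
                    χ (p₁ * v* * t)              ≡⟨ cong χ (identity19 p₁ v* t) ⟩
                    χ (t * p₁ * v*)              ≡⟨ χ-cong (t * p₁) (0<* t>0 p₁>0) v*>0 v>0 (trans (proj₂ (proj₂ vg)) (sym vg′)) ⟩
                    χ (t * p₁ * v₁)               ≡⟨ cong χ (ℕ.*-assoc t p₁ v₁) ⟩
                    χ (t * (p₁ * v₁))             ∎

      solvable : Cont R Solution
      solvable = extremal >>= λ (q , p₀≤q , q≤Q , (d , c , d>0 , M∣d , dense) , stop) →
        let open Progression q p₀≤q q≤Q d c d>0 M∣d in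
        all-below n (λ γ γ<n → pairs N N>0 γ (tab γ γ<n)) >>= λ ps →
        let Π , Π-one , cand = candidates n ps
            open Scaled Π Π-one cand
        in
        -- The threshold L covers all steps up to `step`. Only now is a window requested, so long
        -- that even after division by c₄ its length exceeds L.
        sparse (suc q) c′ stop (suc step) >>= λ (L , sp) →
        dense (c₄ * (L + 4)) >>= λ W →
        Windowed.result L sp (DenseWindow.a W) (DenseWindow.ℓ W) (DenseWindow.g W)
          (DenseWindow.long W) (DenseWindow.win W) (DenseWindow.dense W)
        where
        pairs : ∀ N → 0 < N → ∀ γ → (∀ M′ → 0 < M′ → Cont R (Pair M′ γ)) ⊎ (Pair M γ → R) →
                Cont R (Pair N γ ⊎ (Pair M γ → R))
        pairs N N>0 γ (inj₁ h)    = h N N>0 >>= λ π → return (inj₁ π)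
        pairs N N>0 γ (inj₂ none) = return (inj₂ none)

-- Rational numbers close to 1 as quotients of integers congruent to 1.

module Fractions where
  open Density using (One; Near; Near-*ˡ)
  open import Data.Integer.Base as ℤ using (ℤ; +_; +[1+_]; -[1+_])
  import Data.Integer.Properties as ℤ
  open import Data.List.Base using ([]; _∷_)
  open import Data.List.Relation.Unary.All using (All; []; _∷_)
  open import Data.Nat.Base using (ℕ; zero; suc; _+_; _*_; _^_; _∸_; _≤_; _<_; s≤s; z≤n; NonZero; >-nonZero; >-nonZero⁻¹; ≢-nonZero)
  open import Data.Nat.Coprimality using (Coprime; coprime?; coprime-Bézout)
  open import Data.Nat.Divisibility using (_∣_; divides; ∣-trans; m∣m*n; 1∣_; ∣⇒≤; *-cancelˡ-∣; *-monoʳ-∣; ∣1⇒≡1; _∣0)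
  open import Data.Nat.GCD using (gcd; gcd[m,n]∣m; gcd[m,n]∣n; gcd-greatest; module Bézout)
  open import Data.Nat.Induction using (<-wellFounded)
  open import Data.Nat.Primality using (Prime; prime⇒nonZero; euclidsLemma)
  open import Data.Nat.Primality.Factorisation using (factorise; module PrimeFactorisation)
  import Data.Nat.Properties as ℕ
  open import Data.Nat.Tactic.RingSolver using (solve-∀)
  open import Data.Product.Base using (∃; ∃₂; _×_; _,_; proj₁; proj₂)
  open import Data.Rational.Base as ℚ using (ℚ; mkℚ; 1ℚ; _/_; toℚᵘ)
  import Data.Rational.Properties as ℚ
  import Data.Rational.Solver as ℚ-Solver
  import Data.Rational.Unnormalised.Base as ℚᵘ
  import Data.Rational.Unnormalised.Properties as ℚᵘ
  open import Data.Sum.Base using (inj₁; inj₂)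
  open import Relation.Binary.PropositionalEquality
    using (_≡_; _≢_; refl; sym; trans; cong; cong₂; subst; subst₂; module ≡-Reasoning)
  open import Relation.Nullary using (recompute; yes; no; ¬_; contradiction)

  prime-divisor : ∀ m .{{_ : NonZero m}} → m ≢ 1 → ∃ λ p → Prime p × p ∣ m
  prime-divisor m m≢1 = first (PrimeFactorisation.factors fs) (PrimeFactorisation.isFactorisation fs) (PrimeFactorisation.factorsPrime fs)
    where
    open import Data.Nat.ListAction using (product)
    fs = factorise m
    first : ∀ ps → m ≡ product ps → All Prime ps → ∃ λ p → Prime p × p ∣ m
    first []       eq _         = contradiction eq m≢1
    first (p ∷ ps) eq (pr ∷ _) = p , pr , subst (p ∣_) (sym eq) (m∣m*n (product ps))

  prime-power-∣ : ∀ {p} → Prime p → ∀ j g n → ¬ p ∣ n → p ^ j ∣ g * n → p ^ j ∣ g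
  prime-power-∣ pr zero    g n p∤n _ = 1∣ g
  prime-power-∣ {p} pr (suc j) g n p∤n h with euclidsLemma g n pr (∣-trans (m∣m*n (p ^ j)) h)
  ... | inj₂ p∣n = contradiction p∣n p∤n
  ... | inj₁ (divides q refl) = subst (p ^ suc j ∣_) (ℕ.*-comm p q) (*-monoʳ-∣ p
    (prime-power-∣ pr j q n p∤n (*-cancelˡ-∣ p {{prime⇒nonZero pr}} (subst (p ^ suc j ∣_) (regroup q p n) h))))
    where
    regroup : ∀ q p n → q * p * n ≡ p * (q * n)
    regroup = solve-∀

  -- Otherwise M / gcd has a prime factor p, which then does not divide N / gcd. So the power of p
  -- dividing N divides the gcd, which is impossible as it exceeds M.
  ∣-by-prime-powers : ∀ M N .{{_ : NonZero M}} →
    (∀ p → Prime p → p ∣ M → ∃ λ j → M < p ^ j × p ^ j ∣ N) → M ∣ N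
  ∣-by-prime-powers M N h with gcd[m,n]∣m M N | gcd[m,n]∣n M N
  ... | divides m M≡ | divides n N≡ with m ℕ.≟ 1
  ...   | yes refl = subst (_∣ N) (sym (trans M≡ (ℕ.*-identityˡ g))) (gcd[m,n]∣n M N)
    where g = gcd M N
  ...   | no m≢1 = contradiction (ℕ.<-≤-trans M<pʲ (ℕ.≤-trans (∣⇒≤ {{g≢0}} pʲ∣g) (∣⇒≤ (gcd[m,n]∣m M N)))) (ℕ.<-irrefl refl)
    where
    g = gcd M N
    M≢0 : M ≢ 0
    M≢0 M≡0 = contradiction (subst (0 <_) M≡0 (>-nonZero⁻¹ M)) (λ ())
    m≢0 : NonZero m
    m≢0 = ≢-nonZero λ { refl → M≢0 M≡ }
    g≢0 : NonZero g
    g≢0 = ≢-nonZero λ g≡0 → M≢0 (trans M≡ (trans (cong (m *_) g≡0) (ℕ.*-zeroʳ m)))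
    p = proj₁ (prime-divisor m {{m≢0}} m≢1)
    pr = proj₁ (proj₂ (prime-divisor m {{m≢0}} m≢1))
    p∣m = proj₂ (proj₂ (prime-divisor m {{m≢0}} m≢1))
    p∤n : ¬ p ∣ n
    p∤n p∣n = pg∤g (gcd-greatest (subst (p * g ∣_) (sym M≡) (mul p∣m)) (subst (p * g ∣_) (sym N≡) (mul p∣n)))
      where
      mul : ∀ {m} → p ∣ m → p * g ∣ m * g
      mul {m} (divides q refl) = divides q (ℕ.*-assoc q p g)
      pg∤g : ¬ p * g ∣ g
      pg∤g h = contradiction (∣1⇒≡1 (*-cancelˡ-∣ g {{g≢0}} (subst₂ _∣_ (ℕ.*-comm p g) (sym (ℕ.*-identityʳ g)) h))) p≢1
        where
        open import Data.Nat.Primality using (¬prime[1])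
        p≢1 : p ≢ 1
        p≢1 p≡1 = ¬prime[1] (subst Prime p≡1 pr)
    hp = h p pr (∣-trans p∣m (subst (m ∣_) (sym M≡) (m∣m*n g)))
    M<pʲ = proj₁ (proj₂ hp)
    pʲ∣g : p ^ proj₁ hp ∣ g
    pʲ∣g = prime-power-∣ pr (proj₁ hp) g n p∤n (subst (p ^ proj₁ hp ∣_) (trans N≡ (ℕ.*-comm n g)) (proj₂ (proj₂ hp)))

  inverse-mod : ∀ d M → 0 < d → Coprime d M → ∃ λ k → One M (d * k)
  inverse-mod d M d>0 c with coprime-Bézout c
  ... | Bézout.+- x y eq = x , y , trans (ℕ.*-comm d x) (trans (sym eq) (cong suc (ℕ.*-comm y M)))
  ... | Bézout.-+ x y eq with d * x in w
  ...   | zero  = 1 , d ∸ 1 , trans (ℕ.*-identityʳ d) (trans (sym (ℕ.m+[n∸m]≡n d>0)) (cong suc (sym (trans (cong (_* (d ∸ 1)) M≡1) (ℕ.*-identityˡ (d ∸ 1))))))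
    where
    M≡1 : M ≡ 1
    M≡1 = ∣1⇒≡1 (divides y (trans (cong suc (sym (trans (ℕ.*-comm x d) w))) eq))
  -- Here d x is -1 modulo M, so its square is 1 and x (d x) is an inverse of d.
  ...   | suc v = x * suc v , y * v , trans (sym (ℕ.*-assoc d x (suc v))) (trans (cong (_* suc v) w)
      (trans (square v) (cong suc (trans (cong (_* v) (trans (cong suc (trans (sym w) (ℕ.*-comm d x))) eq)) (rotate y M v)))))
    where
    square : ∀ v → suc v * suc v ≡ 1 + suc (suc v) * v
    square = solve-∀
    rotate : ∀ y M v → y * M * v ≡ M * (y * v)
    rotate = solve-∀

  ι : ℕ → ℚ
  ι n = + n / 1

  private
    toℚᵘ-/ : ∀ i n .{{_ : NonZero n}} → toℚᵘ (i / n) ℚᵘ.≃ i ℚᵘ./ n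
    toℚᵘ-/ i (suc n) = ℚ.toℚᵘ-fromℚᵘ (ℚᵘ.mkℚᵘ i n)

  ι-* : ∀ m n → ι (m * n) ≡ ι m ℚ.* ι n
  ι-* m n = ℚ.toℚᵘ-injective (ℚᵘ.≃-trans (toℚᵘ-/ (+ (m * n)) 1) (ℚᵘ.≃-trans
    (ℚᵘ.*≡* (cong (ℤ._* (+ 1)) (ℤ.pos-* m n)))
    (ℚᵘ.≃-sym (ℚᵘ.≃-trans (ℚ.toℚᵘ-homo-* (ι m) (ι n)) (ℚᵘ.*-cong (toℚᵘ-/ (+ m) 1) (toℚᵘ-/ (+ n) 1))))))

  ι-+ : ∀ m n → ι (m + n) ≡ ι m ℚ.+ ι n
  ι-+ m n = ℚ.toℚᵘ-injective (ℚᵘ.≃-trans (toℚᵘ-/ (+ (m + n)) 1) (ℚᵘ.≃-trans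
    (ℚᵘ.*≡* (cong (ℤ._* (+ 1)) (trans (ℤ.pos-+ m n) (sym (cong₂ ℤ._+_ (ℤ.*-identityʳ (+ m)) (ℤ.*-identityʳ (+ n)))))))
    (ℚᵘ.≃-sym (ℚᵘ.≃-trans (ℚ.toℚᵘ-homo-+ (ι m) (ι n)) (ℚᵘ.+-cong (toℚᵘ-/ (+ m) 1) (toℚᵘ-/ (+ n) 1))))))

  denominator : ∀ t → t ℚ.* ι (ℚ.↧ₙ t) ≡ ℚ.↥ t / 1
  denominator t@(mkℚ n d _) = ℚ.toℚᵘ-injective (ℚᵘ.≃-trans (ℚ.toℚᵘ-homo-* t (ι (suc d)))
    (ℚᵘ.≃-trans (ℚᵘ.*-congˡ {ℚᵘ.mkℚᵘ n d} (toℚᵘ-/ (+ suc d) 1)) (ℚᵘ.≃-trans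
      (ℚᵘ.*≡* eq) (ℚᵘ.≃-sym (toℚᵘ-/ n 1)))))
    where
    eq : (n ℤ.* + suc d) ℤ.* + 1 ≡ n ℤ.* + (suc d * 1)
    eq = trans (ℤ.*-identityʳ _) (cong (λ k → n ℤ.* + k) (sym (ℕ.*-identityʳ (suc d))))

  ∣∣<1/ : ∀ t z .{{_ : NonZero z}} → ℚ.∣ t ∣ ℚ.< + 1 / z → ℤ.∣ ℚ.↥ t ∣ * z < ℚ.↧ₙ t
  ∣∣<1/ (mkℚ n d _) z@(suc _) h with ℚᵘ.<-respʳ-≃ (toℚᵘ-/ (+ 1) z) (ℚ.toℚᵘ-mono-< h)
  ... | ℚᵘ.*<* lt = ℤ.drop‿+<+ (subst₂ ℤ._<_ (sym (ℤ.pos-* ℤ.∣ n ∣ z)) (ℤ.*-identityˡ (+ suc d)) lt)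

  /<1/ : ∀ x y z .{{_ : NonZero y}} .{{_ : NonZero z}} → + x / y ℚ.< + 1 / z → x * z < y
  /<1/ x y@(suc _) z@(suc _) h with ℚᵘ.<-respˡ-≃ (toℚᵘ-/ (+ x) y) (ℚᵘ.<-respʳ-≃ (toℚᵘ-/ (+ 1) z) (ℚ.toℚᵘ-mono-< h))
  ... | ℚᵘ.*<* lt = ℤ.drop‿+<+ (subst₂ ℤ._<_ (sym (ℤ.pos-* x z)) (ℤ.*-identityˡ (+ y)) lt)

  private
    large-power : ∀ M n d p (pr : Prime p) .{{_ : NonZero (8 * M)}} →
      (+ (p ^ ord p pr (suc d)) / (p ^ ord p pr (suc n))) {{ℕ.m^n≢0 p (ord p pr (suc n)) {{prime⇒nonZero pr}}}} ℚ.< + 1 / (8 * M) →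
      ∃ λ j → M < p ^ j × p ^ j ∣ suc n
    large-power M n d p pr h with primePowerFactor p pr (suc n) (<-wellFounded (suc n))
    ... | k , m , eq , _ = k , ℕ.≤-<-trans (ℕ.≤-trans (ℕ.m≤n*m M 8)
      (ℕ.m≤n*m (8 * M) (p ^ ord p pr (suc d)) {{ℕ.m^n≢0 p (ord p pr (suc d)) {{prime⇒nonZero pr}}}}))
        (/<1/ (p ^ ord p pr (suc d)) (p ^ k) (8 * M) {{ℕ.m^n≢0 p k {{prime⇒nonZero pr}}}} h) ,
      divides m (trans eq (ℕ.*-comm (p ^ k) m))

  -- A p-adic absolute value below 1 / 8M forces a power of p larger than M to divide the numerator.
  -- The proof of primality is quantified existentially because `padicAbs` refers to it and each
  -- place carries its own.
  numerator-∣ : ∀ M .{{_ : NonZero M}} .{{_ : NonZero (8 * M)}} t →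
    (∀ p → Prime p → p ∣ M → ∃ λ (pr : Prime p) → padicAbs p pr t ℚ.< + 1 / (8 * M)) → M ∣ ℤ.∣ ℚ.↥ t ∣
  numerator-∣ M (mkℚ (+ zero)  d _) h = M ∣0
  numerator-∣ M (mkℚ +[1+ n ] d _) h = ∣-by-prime-powers M (suc n) λ p pr p∣M → let pr′ , small = h p pr p∣M in large-power M n d p pr′ small
  numerator-∣ M (mkℚ -[1+ n ] d _) h = ∣-by-prime-powers M (suc n) λ p pr p∣M → let pr′ , small = h p pr p∣M in large-power M n d p pr′ small

  private
    halve : ∀ M m → 4 * M * m + 4 * M * m ≡ m * (8 * M)
    halve = solve-∀

    regroup⁻ : ∀ M m k z → 1 + M * (m * k + z) ≡ m * M * k + (1 + M * z)
    regroup⁻ = solve-∀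

    regroup⁺ : ∀ M l q k → 1 + M * l + q * M * k ≡ 1 + M * (l + q * k)
    regroup⁺ = solve-∀

    rotate : ∀ m M k → m * M * k ≡ M * (m * k)
    rotate = solve-∀

    0<k : ∀ D M k → One M (D * k) → 0 < k
    0<k D M zero    (l , eq) = contradiction (trans (sym (ℕ.*-zeroʳ D)) eq) λ ()
    0<k D M (suc k) _        = s≤s z≤n

    One-difference : ∀ M .{{_ : NonZero M}} m r k → 0 < r → M ∣ m → One M ((m + r) * k) → One M (r * k)
    One-difference M m r k r>0 (divides q refl) one@(l , eq) = l ∸ q * k , ℕ.+-cancelˡ-≡ (m * k) _ _ (begin
      m * k + r * k                     ≡⟨ ℕ.*-distribʳ-+ k m r ⟨
      (m + r) * k                       ≡⟨ eq ⟩
      1 + M * l                         ≡⟨ cong (λ z → 1 + M * z) (ℕ.m+[n∸m]≡n qk≤l) ⟨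
      1 + M * (q * k + (l ∸ q * k))     ≡⟨ regroup⁻ M q k (l ∸ q * k) ⟩
      m * k + (1 + M * (l ∸ q * k))     ∎)
      where
      open ≡-Reasoning
      k>0 : 0 < k
      k>0 = 0<k (m + r) M k one
      qk≤l : q * k ≤ l
      qk≤l = ℕ.*-cancelˡ-≤ M (ℕ.≤-pred (subst (suc (M * (q * k)) ≤_) eq
        (subst (_< (m + r) * k) (rotate q M k) (ℕ.*-monoˡ-< k {{>-nonZero k>0}} (ℕ.m<m+n m r>0)))))

    One-sum : ∀ M D m k → M ∣ m → One M (D * k) → One M ((D + m) * k)
    One-sum M D m k (divides q refl) (l , eq) = l + q * k ,
      trans (ℕ.*-distribʳ-+ k D m) (trans (cong (_+ m * k) eq) (regroup⁺ M l q k))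

    -- From m + 4 M m ≤ 8 M m ≤ m + r one gets 4 M m ≤ r. This is where the tolerance 1 / 8M
    -- produces closeness at the level 4 M.
    Near-sum : ∀ M .{{_ : NonZero M}} r m → m * (8 * M) ≤ m + r → Near (4 * M) (m + r) r
    Near-sum M r m h = (begin
      4 * M * (m + r)        ≡⟨ ℕ.*-distribˡ-+ (4 * M) m r ⟩
      4 * M * m + 4 * M * r  ≤⟨ ℕ.+-monoˡ-≤ (4 * M * r) (ℕ.+-cancelˡ-≤ m _ _ (begin
        m + 4 * M * m          ≤⟨ ℕ.+-monoˡ-≤ (4 * M * m) (ℕ.m≤n*m m (4 * M) {{ℕ.m*n≢0 4 M}}) ⟩
        4 * M * m + 4 * M * m  ≡⟨ halve M m ⟩
        m * (8 * M)            ≤⟨ h ⟩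
        m + r                  ∎)) ⟩
      r + 4 * M * r          ∎) , ℕ.≤-trans (ℕ.*-monoʳ-≤ (4 * M) (ℕ.m≤n+m r m)) (ℕ.m≤n+m _ (m + r))
      where open ℕ.≤-Reasoning

    Near-flip : ∀ {M p q} → Near M p q → Near M q p
    Near-flip (l , r) = r , l

    value : ∀ t q k → ι q ≡ ι (ℚ.↧ₙ t) ℚ.- ℚ.↥ t / 1 → ι (q * k) ≡ (1ℚ ℚ.- t) ℚ.* ι (ℚ.↧ₙ t * k)
    value t q k eq = begin
      ι (q * k)                             ≡⟨ ι-* q k ⟩
      ι q ℚ.* ι k                           ≡⟨ cong (ℚ._* ι k) (trans eq (cong (λ z → ι D ℚ.- z) (sym (denominator t)))) ⟩
      (ι D ℚ.- t ℚ.* ι D) ℚ.* ι k           ≡⟨ solve 3 (λ D t k → (D :- t :* D) :* k := (con 1ℚ :- t) :* (D :* k)) refl (ι D) t (ι k) ⟩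
      (1ℚ ℚ.- t) ℚ.* (ι D ℚ.* ι k)          ≡⟨ cong ((1ℚ ℚ.- t) ℚ.*_) (ι-* D k) ⟨
      (1ℚ ℚ.- t) ℚ.* ι (D * k)              ∎
      where
      open ≡-Reasoning
      open ℚ-Solver.+-*-Solver
      D = ℚ.↧ₙ t

    ι-difference : ∀ m r → ι r ≡ ι (m + r) ℚ.- ι m
    ι-difference m r = trans (solve 2 (λ m r → r := (m :+ r) :- m) refl (ι m) (ι r)) (cong (ℚ._- ι m) (sym (ι-+ m r)))
      where open ℚ-Solver.+-*-Solver

    ι-sum : ∀ D m → ι (D + m) ≡ ι D ℚ.- (ℚ.- ι m)
    ι-sum D m = trans (ι-+ D m) (solve 2 (λ D m → D :+ m := D :- (:- m)) refl (ι D) (ι m))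
      where open ℚ-Solver.+-*-Solver

    -- q is the numerator of 1 - t over the denominator of t.
    signed : ∀ M .{{_ : NonZero M}} n D → M ∣ ℤ.∣ n ∣ → ℤ.∣ n ∣ * (8 * M) < D →
             ∃ λ q → ι q ≡ ι D ℚ.- n / 1 × Near (4 * M) D q × (∀ k → One M (D * k) → One M (q * k))
    signed M (+ m) D M∣m lt = r ,
      subst (λ z → ι r ≡ ι z ℚ.- ι m) m+r (ι-difference m r) ,
      subst (λ z → Near (4 * M) z r) m+r (Near-sum M r m (ℕ.≤-trans (ℕ.<⇒≤ lt) (ℕ.≤-reflexive (sym m+r)))) ,
      λ k one → One-difference M m r k (ℕ.m<n⇒0<n∸m m<D) M∣m (subst (λ z → One M (z * k)) (sym m+r) one)
      where
      r = D ∸ m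
      m<D : m < D
      m<D = ℕ.≤-<-trans (ℕ.m≤m*n m (8 * M) {{ℕ.m*n≢0 8 M}}) lt
      m+r : m + r ≡ D
      m+r = ℕ.m+[n∸m]≡n (ℕ.<⇒≤ m<D)
    signed M -[1+ m′ ] D M∣m lt = D + suc m′ , ι-sum D (suc m′) ,
      Near-flip {4 * M} {D + suc m′} {D} (subst (λ z → Near (4 * M) z D) (ℕ.+-comm (suc m′) D)
        (Near-sum M D (suc m′) (ℕ.≤-trans (ℕ.<⇒≤ lt) (ℕ.m≤n+m D (suc m′))))) ,
      λ k → One-sum M D (suc m′) k M∣m

  -- For t = n / D in lowest terms, M divides n, so D is prime to M. If D k is 1 modulo M, so is (D
  -- - n) k, and these two numbers represent 1 / (1 - t).
  near-fraction : ∀ M .{{_ : NonZero M}} .{{_ : NonZero (8 * M)}} t →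
    (∀ p → Prime p → p ∣ M → ∃ λ (pr : Prime p) → padicAbs p pr t ℚ.< + 1 / (8 * M)) →
    ℚ.∣ t ∣ ℚ.< + 1 / (8 * M) →
    ∃₂ λ p q → One M p × One M q × Near (4 * M) p q × ι q ≡ (1ℚ ℚ.- t) ℚ.* ι p
  near-fraction M t@(mkℚ n d c) h small =
    let M∣n = numerator-∣ M t h
        q , ιq , near , one-q = signed M n (suc d) M∣n (∣∣<1/ t (8 * M) small)
        k , one = inverse-mod (suc d) M (s≤s z≤n) λ (e∣D , e∣M) → coprime (∣-trans e∣M M∣n , e∣D)
    in suc d * k , q * k , one , one-q k one ,
       subst₂ (Near (4 * M)) (ℕ.*-comm k (suc d)) (ℕ.*-comm k q) (Near-*ˡ {4 * M} k near) , value t q k ιq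
    where
    coprime : Coprime ℤ.∣ n ∣ (suc d)
    coprime = recompute (coprime? ℤ.∣ n ∣ (suc d)) c

-- From solutions in the closures to approximate solutions in G.

module Approximation where
  open import Algebra.Bundles using (AbelianGroup)
  open import Data.Fin.Base using (Fin)
  open import Data.List.Base using (List; length; lookup)
  open import Data.Nat.Base as ℕ using (ℕ)
  import Data.Nat.Properties as ℕ
  open import Data.Product.Base using (∃; ∃₂; _×_; _,_; proj₁; proj₂)
  open import Data.Rational.Base using (ℚ; 0ℚ; 1ℚ; ½; _+_; _*_; _-_; -_; _≤_; _<_; _⊓_; 1/_; Positive; positive; nonNegative; NonZero)
  import Data.Rational.Properties as ℚ
  open import Data.Rational.Solver using (module +-*-Solver)
  open import Data.Sum.Base using (_⊎_; inj₁; inj₂)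
  open import Level using (0ℓ)
  open import Relation.Binary.Definitions using (tri<; tri≈; tri>)
  open import Relation.Binary.PropositionalEquality
    using (_≡_; refl; sym; trans; cong; cong₂; subst; subst₂)
  open import Relation.Nullary using (contradiction)

  mulˡ-≤ : ∀ c {a b} → 0ℚ ≤ c → a ≤ b → c * a ≤ c * b
  mulˡ-≤ c 0≤c = ℚ.*-monoˡ-≤-nonNeg c {{nonNegative 0≤c}}

  mulˡ-< : ∀ c {a b} → 0ℚ < c → a < b → c * a < c * b
  mulˡ-< c 0<c = ℚ.*-monoʳ-<-pos c {{positive 0<c}}

  0<* : ∀ {a b} → 0ℚ < a → 0ℚ < b → 0ℚ < a * b
  0<* {a} {b} 0<a 0<b = subst (_< a * b) (ℚ.*-zeroʳ a) (mulˡ-< a 0<a 0<b)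

  0<-⊓ : ∀ {a b} → 0ℚ < a → 0ℚ < b → 0ℚ < a ⊓ b
  0<-⊓ {a} {b} 0<a 0<b with ℚ.⊓-sel a b
  ... | inj₁ eq = subst (0ℚ <_) (sym eq) 0<a
  ... | inj₂ eq = subst (0ℚ <_) (sym eq) 0<b

  0<½ : 0ℚ < ½
  0<½ = ℚ.positive⁻¹ ½

  reciprocal : ∀ {B} → 0ℚ < B → ∃ λ r → 0ℚ < r × B * r ≡ 1ℚ
  reciprocal {B} B>0 = 1/ B , ℚ.positive⁻¹ (1/ B) {{ℚ.1/pos⇒pos B}} , ℚ.*-inverseʳ B
    where
    instance
      B-pos : Positive B
      B-pos = positive B>0
      B≢0 : NonZero B
      B≢0 = ℚ.pos⇒nonZero B

  <-by : ∀ {p q} r → 0ℚ < r → q ≡ p + r → p < q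
  <-by {p} r 0<r eq = subst₂ _<_ (ℚ.+-identityʳ p) (sym eq) (ℚ.+-monoʳ-< p 0<r)

  Eventually : (ℕ → Set) → Set
  Eventually P = ∃ λ K → ∀ n → K ℕ.≤ n → P n

  infixr 2 _and_
  _and_ : ∀ {P Q} → Eventually P → Eventually Q → Eventually (λ n → P n × Q n)
  (K , h) and (L , k) = K ℕ.⊔ L , λ n ≤n →
    h n (ℕ.m⊔n≤o⇒m≤o K L ≤n) , k n (ℕ.m⊔n≤o⇒n≤o K L ≤n)

  eventually-map : ∀ {P Q : ℕ → Set} → (∀ n → P n → Q n) → Eventually P → Eventually Q
  eventually-map f (K , h) = K , λ n ≤n → f n (h n ≤n)

  module _ (A : AbsoluteValue) where
    open AbsoluteValue A
    open Completion A

    private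
      square≡1 : ∀ r → 0ℚ ≤ r → r * r ≡ 1ℚ → r ≡ 1ℚ
      square≡1 r 0≤r eq with ℚ.<-cmp r 1ℚ
      ... | tri≈ _ r≡1 _ = r≡1
      ... | tri< r<1 _ _ = contradiction eq (ℚ.<⇒≢ (ℚ.≤-<-trans
        (subst (r * r ≤_) (ℚ.*-identityʳ r) (mulˡ-≤ r 0≤r (ℚ.<⇒≤ r<1))) r<1))
      ... | tri> _ _ 1<r = contradiction (sym eq) (ℚ.<⇒≢ (ℚ.<-trans 1<r
        (subst (_< r * r) (ℚ.*-identityʳ r) (mulˡ-< r (ℚ.<-trans (ℚ.positive⁻¹ 1ℚ) 1<r) 1<r))))

      ∥1∥≡1 : ∥ 1ℚ ∥ ≡ 1ℚ
      ∥1∥≡1 = ℚ.≤-antisym (cancel (ℚ.≤-reflexive eq)) (cancel (ℚ.≤-reflexive (sym eq)))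
        where
        0<∥1∥ : 0ℚ < ∥ 1ℚ ∥
        0<∥1∥ with ℚ.<-cmp 0ℚ ∥ 1ℚ ∥
        ... | tri< h _ _ = h
        ... | tri≈ _ h _ = contradiction (∥x∥≡0⇒x≡0 1ℚ (sym h)) λ ()
        ... | tri> _ _ h = contradiction (ℚ.<-≤-trans h (0≤∥ 1ℚ ∥)) (ℚ.<-irrefl refl)
        eq : ∥ 1ℚ ∥ * ∥ 1ℚ ∥ ≡ ∥ 1ℚ ∥ * 1ℚ
        eq = trans (sym (*-homo 1ℚ 1ℚ)) (sym (ℚ.*-identityʳ ∥ 1ℚ ∥))
        cancel : ∀ {x y} → ∥ 1ℚ ∥ * x ≤ ∥ 1ℚ ∥ * y → x ≤ y
        cancel = ℚ.*-cancelˡ-≤-pos ∥ 1ℚ ∥ {{positive 0<∥1∥}}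

      ∥-x∥≡∥x∥ : ∀ x → ∥ - x ∥ ≡ ∥ x ∥
      ∥-x∥≡∥x∥ x = trans (cong ∥_∥ (solve 1 (λ x → :- x := (:- con 1ℚ) :* x) refl x))
        (trans (*-homo (- 1ℚ) x) (trans (cong (_* ∥ x ∥) (square≡1 ∥ - 1ℚ ∥ (0≤∥ - 1ℚ ∥)
          (trans (sym (*-homo (- 1ℚ) (- 1ℚ))) ∥1∥≡1))) (ℚ.*-identityˡ ∥ x ∥)))
        where open +-*-Solver

      triangle- : ∀ x y → ∥ x ∥ ≤ ∥ y ∥ + ∥ x - y ∥
      triangle- x y = ℚ.≤-trans (ℚ.≤-reflexive (cong ∥_∥ (solve 2 (λ x y → x := y :+ (x :- y)) refl x y))) (triangle y (x - y))
        where open +-*-Solver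

      ∥x-y∥≡∥y-x∥ : ∀ x y → ∥ x - y ∥ ≡ ∥ y - x ∥
      ∥x-y∥≡∥y-x∥ x y = trans (cong ∥_∥ (solve 2 (λ x y → x :- y := :- (y :- x)) refl x y)) (∥-x∥≡∥x∥ (y - x))
        where open +-*-Solver

    -- Eventually the inverse x′ is bounded by some B and x x′ has absolute value at least 1 / 2, so
    -- x stays above 1 / 2B.
    bounded-below : ∀ (x x′ : Point) → Null (λ n → proj₁ x n * proj₁ x′ n - 1ℚ) →
                    ∃ λ κ → 0ℚ < κ × Eventually (λ n → κ ≤ ∥ proj₁ x n ∥)
    bounded-below (x , _) (x′ , cauchy) null with cauchy 1ℚ (ℚ.positive⁻¹ 1ℚ)
    ... | K , close = ½ * r , 0<* 0<½ r>0 , eventually-map final (near-1 and bounded)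
      where
      B = ∥ x′ K ∥ + 1ℚ
      B>0 : 0ℚ < B
      B>0 = ℚ.<-≤-trans (ℚ.positive⁻¹ 1ℚ) (subst (_≤ B) (ℚ.+-identityˡ 1ℚ) (ℚ.+-monoˡ-≤ 1ℚ (0≤∥ x′ K ∥)))
      r = proj₁ (reciprocal B>0)
      r>0 = proj₁ (proj₂ (reciprocal B>0))
      Br≡1 = proj₂ (proj₂ (reciprocal B>0))
      bounded : Eventually (λ n → ∥ x′ n ∥ ≤ B)
      bounded = K , λ n K≤n → ℚ.≤-trans (triangle- (x′ n) (x′ K)) (ℚ.+-monoʳ-≤ ∥ x′ K ∥ (ℚ.<⇒≤ (close n K K≤n ℕ.≤-refl)))
      near-1 : Eventually (λ n → ∥ x n * x′ n - 1ℚ ∥ < ½)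
      near-1 = null ½ 0<½
      final : ∀ n → ∥ x n * x′ n - 1ℚ ∥ < ½ × ∥ x′ n ∥ ≤ B → ½ * r ≤ ∥ x n ∥
      final n (close₁ , bound) = begin
        ½ * r                    ≤⟨ ℚ.*-monoʳ-≤-nonNeg r {{nonNegative (ℚ.<⇒≤ r>0)}} half ⟩
        ∥ x n ∥ * B * r          ≡⟨ ℚ.*-assoc ∥ x n ∥ B r ⟩
        ∥ x n ∥ * (B * r)        ≡⟨ cong (∥ x n ∥ *_) Br≡1 ⟩
        ∥ x n ∥ * 1ℚ             ≡⟨ ℚ.*-identityʳ ∥ x n ∥ ⟩
        ∥ x n ∥                  ∎
        where
        open ℚ.≤-Reasoning
        half : ½ ≤ ∥ x n ∥ * B
        half = begin
          ½                                                  ≡⟨⟩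
          1ℚ - ½                                             ≤⟨ ℚ.+-monoˡ-≤ (- ½) (begin
            1ℚ                                                 ≡⟨ ∥1∥≡1 ⟨
            ∥ 1ℚ ∥                                             ≤⟨ triangle- 1ℚ (x n * x′ n) ⟩
            ∥ x n * x′ n ∥ + ∥ 1ℚ - x n * x′ n ∥               ≡⟨ cong₂ _+_ (*-homo (x n) (x′ n)) (∥x-y∥≡∥y-x∥ 1ℚ (x n * x′ n)) ⟩
            ∥ x n ∥ * ∥ x′ n ∥ + ∥ x n * x′ n - 1ℚ ∥           ≤⟨ ℚ.+-mono-≤ (mulˡ-≤ ∥ x n ∥ (0≤∥ x n ∥) bound) (ℚ.<⇒≤ close₁) ⟩
            ∥ x n ∥ * B + ½                                    ∎) ⟩
          ∥ x n ∥ * B + ½ - ½                                ≡⟨ solve 2 (λ u h → u :+ h :- h := u) refl (∥ x n ∥ * B) ½ ⟩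
          ∥ x n ∥ * B                                        ∎
          where open +-*-Solver

    -- The gap between δ and ε in `within` leaves room for the convergence of y to g.
    approximates : ∀ g (y x : Point) ε → Null (λ n → g - proj₁ y n) → y within ε of x →
                   Eventually (λ n → ∥ g - proj₁ x n ∥ < ε)
    approximates g (y , _) (x , _) ε null (δ , δ<ε , K , close) =
      eventually-map (λ n (h , k) → ℚ.≤-<-trans
        (ℚ.≤-trans (ℚ.≤-reflexive (cong ∥_∥ (solve 3 (λ g y x → g :- x := (g :- y) :+ (y :- x)) refl g (y n) (x n)))) (triangle (g - y n) (y n - x n)))
        (subst (∥ g - y n ∥ + ∥ y n - x n ∥ <_) (solve 2 (λ ε δ → (ε :- δ) :+ δ := ε) refl ε δ) (ℚ.+-mono-<-≤ h k)))
        (null (ε - δ) (subst (_< ε - δ) (ℚ.+-inverseʳ δ) (ℚ.+-monoˡ-< (- δ) δ<ε)) and (K , close))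
      where open +-*-Solver

    module Estimate
      (a b c g₁ g₂ g₃ : ℚ) (x y z : ℕ → ℚ) (ε μ η : ℚ)
      (0<ε : 0ℚ < ε) (0<η : 0ℚ < η) (η≤1 : η ≤ 1ℚ)
      (small : (∥ a ∥ + ∥ b ∥ + ∥ c ∥ + 1ℚ) * ε ≡ η * μ * (½ * ½)) where

      s : ℚ
      s = ∥ a ∥ + ∥ b ∥ + ∥ c ∥ + 1ℚ

      E : ℚ
      E = a * g₁ + b * g₂ + c * g₃

      private
        0<s : 0ℚ < s
        0<s = ℚ.<-≤-trans (ℚ.positive⁻¹ 1ℚ) (subst (_≤ s) (ℚ.+-identityˡ 1ℚ) (ℚ.+-monoˡ-≤ 1ℚ
          (ℚ.+-mono-≤ (ℚ.+-mono-≤ (0≤∥ a ∥) (0≤∥ b ∥)) (0≤∥ c ∥))))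

      error-bound : ∀ n → ∥ g₁ - x n ∥ < ε → ∥ g₂ - y n ∥ < ε → ∥ g₃ - z n ∥ < ε →
                    ∥ a * x n + b * y n + c * z n - 0ℚ ∥ < ε → ∥ E ∥ < s * ε
      error-bound n h₁ h₂ h₃ h₀ = begin-strict
        ∥ E ∥
          ≡⟨ cong ∥_∥ (solve 9 (λ a b c g h k x y z → a :* g :+ b :* h :+ c :* k :=
               ((a :* (g :- x) :+ b :* (h :- y)) :+ c :* (k :- z)) :+ (a :* x :+ b :* y :+ c :* z :- con 0ℚ))
               refl a b c g₁ g₂ g₃ (x n) (y n) (z n)) ⟩
        ∥ ((a * (g₁ - x n) + b * (g₂ - y n)) + c * (g₃ - z n)) + (a * x n + b * y n + c * z n - 0ℚ) ∥
          ≤⟨ ℚ.≤-trans (triangle _ _) (ℚ.+-monoˡ-≤ _ (ℚ.≤-trans (triangle _ _) (ℚ.+-monoˡ-≤ _ (triangle _ _)))) ⟩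
        ∥ a * (g₁ - x n) ∥ + ∥ b * (g₂ - y n) ∥ + ∥ c * (g₃ - z n) ∥ + ∥ a * x n + b * y n + c * z n - 0ℚ ∥
          <⟨ ℚ.+-mono-≤-< (ℚ.+-mono-≤ (ℚ.+-mono-≤ (term a h₁) (term b h₂)) (term c h₃)) h₀ ⟩
        ∥ a ∥ * ε + ∥ b ∥ * ε + ∥ c ∥ * ε + ε
          ≡⟨ solve 4 (λ a b c e → a :* e :+ b :* e :+ c :* e :+ e := (a :+ b :+ c :+ con 1ℚ) :* e) refl (∥ a ∥) (∥ b ∥) (∥ c ∥) ε ⟩
        s * ε ∎
        where
        open ℚ.≤-Reasoning
        open +-*-Solver
        term : ∀ a {u} → ∥ u ∥ < ε → ∥ a * u ∥ ≤ ∥ a ∥ * ε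
        term a {u} h = ℚ.≤-trans (ℚ.≤-reflexive (*-homo a u)) (mulˡ-≤ ∥ a ∥ (0≤∥ a ∥) (ℚ.<⇒≤ h))

      -- By `small`, s ε is η μ / 4. The term a′ g is at least μ - s ε, so η times it is at least 4
      -- s ε - s ε, more than the error.
      relative : ∀ a′ g x′ κ → ∥ a′ ∥ ≤ s → μ ≤ ∥ a′ ∥ * κ → κ ≤ ∥ x′ ∥ → ∥ g - x′ ∥ < ε →
                 ∥ E ∥ < s * ε → ∥ E ∥ < η * ∥ a′ * g ∥
      relative a′ g x′ κ a′≤s μ≤ κ≤ close E< = ℚ.<-≤-trans E< (begin
        s * ε                            ≤⟨ ℚ.<⇒≤ (<-by (s * ε + s * ε) (ℚ.+-mono-< 0<sε 0<sε) refl) ⟩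
        s * ε + (s * ε + s * ε)          ≡⟨ solve 1 (λ t → t :+ (t :+ t) := (t :+ t :+ t :+ t) :- con 1ℚ :* t) refl (s * ε) ⟩
        (s * ε + s * ε + s * ε + s * ε) - 1ℚ * (s * ε)
          ≤⟨ ℚ.+-monoʳ-≤ (s * ε + s * ε + s * ε + s * ε) (ℚ.neg-antimono-≤ (ℚ.*-monoʳ-≤-nonNeg (s * ε) {{nonNegative (ℚ.<⇒≤ 0<sε)}} η≤1)) ⟩
        (s * ε + s * ε + s * ε + s * ε) - η * (s * ε)
          ≡⟨ cong (λ t → (t + t + t + t) - η * (s * ε)) small ⟩
        (η * μ * (½ * ½) + η * μ * (½ * ½) + η * μ * (½ * ½) + η * μ * (½ * ½)) - η * (s * ε)
          ≡⟨ solve 3 (λ η μ t → (η :* μ :* (con ½ :* con ½) :+ η :* μ :* (con ½ :* con ½) :+ η :* μ :* (con ½ :* con ½) :+ η :* μ :* (con ½ :* con ½)) :- η :* t := η :* (μ :- t)) refl η μ (s * ε) ⟩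
        η * (μ - s * ε)                  ≤⟨ mulˡ-≤ η (ℚ.<⇒≤ 0<η) large ⟩
        η * ∥ a′ * g ∥                   ∎)
        where
        open ℚ.≤-Reasoning
        open +-*-Solver
        0<sε : 0ℚ < s * ε
        0<sε = 0<* 0<s 0<ε
        large : μ - s * ε ≤ ∥ a′ * g ∥
        large = begin
          μ - s * ε                                ≤⟨ ℚ.+-monoˡ-≤ (- (s * ε)) (begin
            μ                                        ≤⟨ μ≤ ⟩
            ∥ a′ ∥ * κ                               ≤⟨ mulˡ-≤ ∥ a′ ∥ (0≤∥ a′ ∥) κ≤ ⟩
            ∥ a′ ∥ * ∥ x′ ∥                          ≡⟨ *-homo a′ x′ ⟨
            ∥ a′ * x′ ∥                              ≤⟨ triangle- (a′ * x′) (a′ * g) ⟩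
            ∥ a′ * g ∥ + ∥ a′ * x′ - a′ * g ∥        ≡⟨ cong (∥ a′ * g ∥ +_) (trans (cong ∥_∥ (solve 3 (λ a x g → a :* x :- a :* g := a :* (x :- g)) refl a′ x′ g))
                                                          (trans (*-homo a′ (x′ - g)) (cong (∥ a′ ∥ *_) (∥x-y∥≡∥y-x∥ x′ g)))) ⟩
            ∥ a′ * g ∥ + ∥ a′ ∥ * ∥ g - x′ ∥         ≤⟨ ℚ.+-monoʳ-≤ ∥ a′ * g ∥ (ℚ.≤-trans (mulˡ-≤ ∥ a′ ∥ (0≤∥ a′ ∥) (ℚ.<⇒≤ close))
                                                          (ℚ.*-monoʳ-≤-nonNeg ε {{nonNegative (ℚ.<⇒≤ 0<ε)}} a′≤s)) ⟩
            ∥ a′ * g ∥ + s * ε                       ∎) ⟩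
          ∥ a′ * g ∥ + s * ε - s * ε               ≡⟨ solve 2 (λ u t → u :+ t :- t := u) refl ∥ a′ * g ∥ (s * ε) ⟩
          ∥ a′ * g ∥                               ∎

    0<∥unit∥ : ∀ (u : Unit ℚ-ring) → 0ℚ < ∥ proj₁ u ∥
    0<∥unit∥ (u , v , uv≡1) with ℚ.<-cmp 0ℚ ∥ u ∥
    ... | tri< h _ _ = h
    ... | tri≈ _ h _ = contradiction (trans (sym uv≡1) (trans (cong (_* v) (∥x∥≡0⇒x≡0 u (sym h))) (ℚ.*-zeroˡ v))) λ ()
    ... | tri> _ _ h = contradiction (ℚ.<-≤-trans h (0≤∥ u ∥)) (ℚ.<-irrefl refl)

  module _ (G : Subgroup (AbelianGroup.group ℚˣ) 0ℓ) (a b c : Unit ℚ-ring) where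
    open Subgroup G using (Member)

    error : (x y z : Unit ℚ-ring) → ℚ
    error x y z = proj₁ a * proj₁ x + proj₁ b * proj₁ y + proj₁ c * proj₁ z

    -- The error is compared with all three terms, because it is not known in advance which two of
    -- them will have the same sign.
    Approximate : ℚ → Place → (x y z : Unit ℚ-ring) → Set
    Approximate η v x y z = ∥ error x y z ∥ < η * ∥ proj₁ a * proj₁ x ∥ ×
                            ∥ error x y z ∥ < η * ∥ proj₁ b * proj₁ y ∥ ×
                            ∥ error x y z ∥ < η * ∥ proj₁ c * proj₁ z ∥
      where open AbsoluteValue (absoluteValue v)

    approximate : ∀ S η → 0ℚ < η → η ≤ 1ℚ →
      HasSolutionIn ℚ[ S ] (closureIn S G) (diagonal S (proj₁ a)) (diagonal S (proj₁ b)) (diagonal S (proj₁ c)) →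
      ∃ λ x → ∃₂ λ y z → Member x × Member y × Member z × (∀ i → Approximate η (lookup S i) x y z)
    approximate S η 0<η η≤1 (x , y , z , x∈ , y∈ , z∈ , eq) = x₁ , y₁ , z₁ , G-x , G-y , G-z , close
      where
      val : Fin (length S) → AbsoluteValue
      val i = absoluteValue (lookup S i)
      below : ∀ (u : Unit ℚ[ S ]) i → ∃ λ κ → 0ℚ < κ × Eventually (λ n → κ ≤ AbsoluteValue.∥_∥ (val i) (proj₁ (proj₁ u i) n))
      below (u , v , uv≈1) i = bounded-below (val i) (u i) (v i) (uv≈1 i)
      module Bound (i : Fin (length S)) where
        open AbsoluteValue (val i) public
        κ₁ κ₂ κ₃ μ₁ μ₂ μ₃ μ s r ε : ℚ
        κ₁ = proj₁ (below x i)
        κ₂ = proj₁ (below y i)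
        κ₃ = proj₁ (below z i)
        μ₁ = ∥ proj₁ a ∥ * κ₁
        μ₂ = ∥ proj₁ b ∥ * κ₂
        μ₃ = ∥ proj₁ c ∥ * κ₃
        μ = μ₁ ⊓ (μ₂ ⊓ μ₃)
        s = ∥ proj₁ a ∥ + ∥ proj₁ b ∥ + ∥ proj₁ c ∥ + 1ℚ
        0<μ : 0ℚ < μ
        0<μ = 0<-⊓ (0<* (0<∥unit∥ (val i) a) (proj₁ (proj₂ (below x i))))
          (0<-⊓ (0<* (0<∥unit∥ (val i) b) (proj₁ (proj₂ (below y i)))) (0<* (0<∥unit∥ (val i) c) (proj₁ (proj₂ (below z i)))))
        0≤sum : 0ℚ ≤ ∥ proj₁ a ∥ + ∥ proj₁ b ∥ + ∥ proj₁ c ∥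
        0≤sum = ℚ.+-mono-≤ (ℚ.+-mono-≤ (0≤∥ proj₁ a ∥) (0≤∥ proj₁ b ∥)) (0≤∥ proj₁ c ∥)
        0<s : 0ℚ < s
        0<s = ℚ.<-≤-trans (ℚ.positive⁻¹ 1ℚ) (subst (_≤ s) (ℚ.+-identityˡ 1ℚ) (ℚ.+-monoˡ-≤ 1ℚ 0≤sum))
        r = proj₁ (reciprocal 0<s)
        ε = η * μ * (½ * ½) * r
        0<ε : 0ℚ < ε
        0<ε = 0<* (0<* (0<* 0<η 0<μ) (0<* 0<½ 0<½)) (proj₁ (proj₂ (reciprocal 0<s)))
        small : s * ε ≡ η * μ * (½ * ½)
        small = trans (solve 3 (λ s m r → s :* (m :* r) := m :* (s :* r)) refl s (η * μ * (½ * ½)) r)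
          (trans (cong (η * μ * (½ * ½) *_) (proj₂ (proj₂ (reciprocal 0<s)))) (ℚ.*-identityʳ _))
          where open +-*-Solver
        a≤s : ∥ proj₁ a ∥ ≤ s
        a≤s = subst (_≤ s) (trans (ℚ.+-identityʳ _) (trans (ℚ.+-identityʳ _) (ℚ.+-identityʳ _)))
          (ℚ.+-mono-≤ (ℚ.+-mono-≤ (ℚ.+-monoʳ-≤ ∥ proj₁ a ∥ (0≤∥ proj₁ b ∥)) (0≤∥ proj₁ c ∥)) (ℚ.<⇒≤ (ℚ.positive⁻¹ 1ℚ)))
        b≤s : ∥ proj₁ b ∥ ≤ s
        b≤s = subst (_≤ s) (trans (ℚ.+-identityʳ _) (trans (ℚ.+-identityʳ _) (ℚ.+-identityˡ _)))
          (ℚ.+-mono-≤ (ℚ.+-mono-≤ (ℚ.+-monoˡ-≤ ∥ proj₁ b ∥ (0≤∥ proj₁ a ∥)) (0≤∥ proj₁ c ∥)) (ℚ.<⇒≤ (ℚ.positive⁻¹ 1ℚ)))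
        c≤s : ∥ proj₁ c ∥ ≤ s
        c≤s = subst (_≤ s) (trans (ℚ.+-identityʳ _) (ℚ.+-identityˡ _))
          (ℚ.+-mono-≤ (ℚ.+-monoˡ-≤ ∥ proj₁ c ∥ (ℚ.+-mono-≤ (0≤∥ proj₁ a ∥) (0≤∥ proj₁ b ∥))) (ℚ.<⇒≤ (ℚ.positive⁻¹ 1ℚ)))
      nx = x∈ Bound.ε Bound.0<ε
      ny = y∈ Bound.ε Bound.0<ε
      nz = z∈ Bound.ε Bound.0<ε
      x₁ y₁ z₁ : Unit ℚ-ring
      x₁ = proj₁ (proj₁ (proj₂ nx))
      y₁ = proj₁ (proj₁ (proj₂ ny))
      z₁ = proj₁ (proj₁ (proj₂ nz))
      G-x = proj₁ (proj₂ (proj₁ (proj₂ nx)))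
      G-y = proj₁ (proj₂ (proj₁ (proj₂ ny)))
      G-z = proj₁ (proj₂ (proj₁ (proj₂ nz)))
      close : ∀ i → Approximate η (lookup S i) x₁ y₁ z₁
      close i =
        Es.relative (proj₁ a) (proj₁ x₁) _ κ₁ a≤s (ℚ.p⊓q≤p μ₁ (μ₂ ⊓ μ₃)) kx hx E< ,
        Es.relative (proj₁ b) (proj₁ y₁) _ κ₂ b≤s (ℚ.≤-trans (ℚ.p⊓q≤q μ₁ (μ₂ ⊓ μ₃)) (ℚ.p⊓q≤p μ₂ μ₃)) ky hy E< ,
        Es.relative (proj₁ c) (proj₁ z₁) _ κ₃ c≤s (ℚ.≤-trans (ℚ.p⊓q≤q μ₁ (μ₂ ⊓ μ₃)) (ℚ.p⊓q≤q μ₂ μ₃)) kz hz E<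
        where
        open Bound i
        module Es = Estimate (val i) (proj₁ a) (proj₁ b) (proj₁ c) (proj₁ x₁) (proj₁ y₁) (proj₁ z₁)
          (proj₁ (proj₁ x i)) (proj₁ (proj₁ y i)) (proj₁ (proj₁ z i)) ε μ η 0<ε 0<η η≤1 small
        all = approximates (val i) (proj₁ x₁) (proj₁ (proj₁ nx) i) (proj₁ x i) ε (proj₂ (proj₂ (proj₁ (proj₂ nx))) i) (proj₂ (proj₂ nx) i)
          and approximates (val i) (proj₁ y₁) (proj₁ (proj₁ ny) i) (proj₁ y i) ε (proj₂ (proj₂ (proj₁ (proj₂ ny))) i) (proj₂ (proj₂ ny) i)
          and approximates (val i) (proj₁ z₁) (proj₁ (proj₁ nz) i) (proj₁ z i) ε (proj₂ (proj₂ (proj₁ (proj₂ nz))) i) (proj₂ (proj₂ nz) i)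
          and eq i ε 0<ε and proj₂ (proj₂ (below x i)) and proj₂ (proj₂ (below y i)) and proj₂ (proj₂ (below z i))
        -- A single index beyond all seven thresholds: three approximations, the equation, and three
        -- lower bounds.
        n = proj₁ all
        facts = proj₂ all n ℕ.≤-refl
        hx = proj₁ facts
        hy = proj₁ (proj₂ facts)
        hz = proj₁ (proj₂ (proj₂ facts))
        h₀ = proj₁ (proj₂ (proj₂ (proj₂ facts)))
        kx = proj₁ (proj₂ (proj₂ (proj₂ (proj₂ facts))))
        ky = proj₁ (proj₂ (proj₂ (proj₂ (proj₂ (proj₂ facts)))))
        kz = proj₂ (proj₂ (proj₂ (proj₂ (proj₂ (proj₂ facts)))))
        E< = Es.error-bound n hx hy hz h₀

-- Places, cosets and the two implications.

module LocalGlobal where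
  open Density using (Cont; return; _>>=_; One; Near)
  open NaturalSolutions using (module Theorem)
  open Fractions using (ι; ι-*; ι-+; denominator; near-fraction)
  open Approximation using (approximate; Approximate; error; 0<*)
  open import Algebra.Bundles using (AbelianGroup)
  open import Data.Fin.Base using (Fin; zero; suc; toℕ)
  import Data.Fin.Properties as Fin
  import Data.Integer.Base as ℤ
  import Data.Integer.Properties as ℤ
  open import Data.List.Base using (List; []; _∷_; length; lookup)
  open import Data.List.Relation.Unary.All as All using (All; []; _∷_)
  open import Data.List.Relation.Unary.AllPairs using ([]; _∷_)
  open import Data.List.Relation.Unary.Unique.Propositional using (Unique)
  open import Data.Nat.Base as ℕ using (ℕ; zero; suc; s≤s; z≤n; >-nonZero)
  open import Data.Nat.Divisibility using (_∣_; ∣⇒≤)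
  open import Data.Nat.Primality using (Prime; prime?)
  import Data.Nat.Properties as ℕ
  open import Data.Product.Base using (∃; ∃₂; _×_; _,_; proj₁; proj₂)
  open import Data.Rational.Base using (ℚ; mkℚ; 0ℚ; 1ℚ; _+_; _*_; _-_; -_; _≤_; _<_; _/_; ∣_∣; positive; nonNegative)
  import Data.Rational.Properties as ℚ
  open import Data.Rational.Solver using (module +-*-Solver)
  import Data.Rational.Unnormalised.Base as ℚᵘ
  import Data.Rational.Unnormalised.Properties as ℚᵘ
  open import Data.Sum.Base using (_⊎_; inj₁; inj₂)
  open import Data.Unit.Base using (⊤; tt)
  open import Function.Bundles using (_⇔_; mk⇔; Inverse)
  open import Level using (0ℓ)
  open import Relation.Binary.Bundles using (Setoid)
  open import Relation.Binary.Definitions using (tri<; tri≈; tri>)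
  open import Relation.Binary.PropositionalEquality
    using (_≡_; _≢_; refl; sym; trans; cong; cong₂; subst; module ≡-Reasoning)
  open import Relation.Nullary using (yes; no; contradiction)

  -- Every prime divisor of M is at most M, so `places M` contains all the places by which M
  -- measures closeness to 1.
  places : ℕ → List Place
  places zero    = ∞ ∷ []
  places (suc m) with prime? (suc m)
  ... | yes pr = prime (suc m) pr ∷ places m
  ... | no  _  = places m

  Below : ℕ → Place → Set
  Below k ∞           = ⊤
  Below k (prime p _) = p ℕ.< k

  places-below : ∀ m → All (Below (suc m)) (places m)
  places-below zero    = tt ∷ []
  places-below (suc m) with prime? (suc m)
  ... | yes pr = ℕ.≤-refl ∷ All.map weaken (places-below m)
    where
    weaken : ∀ {v} → Below (suc m) v → Below (suc (suc m)) v
    weaken {∞}         _   = tt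
    weaken {prime p _} p<m = ℕ.m<n⇒m<1+n p<m
  ... | no  _  = All.map weaken (places-below m)
    where
    weaken : ∀ {v} → Below (suc m) v → Below (suc (suc m)) v
    weaken {∞}         _   = tt
    weaken {prime p _} p<m = ℕ.m<n⇒m<1+n p<m

  places-unique : ∀ m → Unique (places m)
  places-unique zero    = [] ∷ []
  places-unique (suc m) with prime? (suc m)
  ... | yes pr = All.map distinct (places-below m) ∷ places-unique m
    where
    distinct : ∀ {v} → Below (suc m) v → prime (suc m) pr ≢ v
    distinct {∞}         _   ()
    distinct {prime p _} p<p refl = ℕ.<-irrefl refl p<p
  ... | no  _  = places-unique m

  ∞-index : ∀ m → ∃ λ i → lookup (places m) i ≡ ∞
  ∞-index zero    = zero , refl
  ∞-index (suc m) with prime? (suc m)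
  ... | yes _ = let i , eq = ∞-index m in suc i , eq
  ... | no  _ = ∞-index m

  prime-index : ∀ m p → Prime p → p ℕ.≤ m → ∃₂ λ i pr → lookup (places m) i ≡ prime p pr
  prime-index zero    zero pr _ = contradiction pr ¬prime[0]
    where open import Data.Nat.Primality using (¬prime[0])
  prime-index (suc m) p pr p≤ with prime? (suc m) | ℕ.m≤n⇒m<n∨m≡n p≤
  ... | yes pr′ | inj₂ refl = zero , pr′ , refl
  ... | no  ¬pr | inj₂ refl = contradiction pr ¬pr
  ... | yes _   | inj₁ p<   = let i , pr″ , eq = prime-index m p pr (ℕ.≤-pred p<) in suc i , pr″ , eq
  ... | no  _   | inj₁ p<   = prime-index m p pr (ℕ.≤-pred p<)

  -- The value 1 at zero is a default that makes the map total, so that colours are defined for all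
  -- pairs of natural numbers.
  unit : ℕ → Unit ℚ-ring
  unit zero      = AbelianGroup.ε ℚˣ
  unit n@(suc k) = ι n , ℤ.+ 1 / n , ℚ.toℚᵘ-injective (ℚᵘ.≃-trans (ℚ.toℚᵘ-homo-* (ι n) (ℤ.+ 1 / n))
    (ℚᵘ.≃-trans (ℚᵘ.*-cong (ℚ.toℚᵘ-fromℚᵘ (ℚᵘ.mkℚᵘ (ℤ.+ n) 0)) (ℚ.toℚᵘ-fromℚᵘ (ℚᵘ.mkℚᵘ (ℤ.+ 1) k)))
      (ℚᵘ.*≡* (cong (λ z → ℤ.+ z) (trans (ℕ.*-identityʳ (n ℕ.* 1)) (trans (ℕ.*-identityʳ n) (sym (trans (ℕ.*-identityˡ _) (ℕ.*-identityˡ n)))))))))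

  val inv : Unit ℚ-ring → ℚ
  val u = proj₁ u
  inv u = proj₁ (proj₂ u)

  val-unit : ∀ {x} → 0 ℕ.< x → val (unit x) ≡ ι x
  val-unit (s≤s _) = refl

  inverse-unique : ∀ {u v w : ℚ} → u * v ≡ 1ℚ → u * w ≡ 1ℚ → v ≡ w
  inverse-unique {u} {v} {w} p q = begin
    v              ≡⟨ ℚ.*-identityʳ v ⟨
    v * 1ℚ         ≡⟨ cong (v *_) q ⟨
    v * (u * w)    ≡⟨ solve 3 (λ u v w → v :* (u :* w) := (u :* v) :* w) refl u v w ⟩
    (u * v) * w    ≡⟨ cong (_* w) p ⟩
    1ℚ * w         ≡⟨ ℚ.*-identityˡ w ⟩
    w              ∎
    where
    open ≡-Reasoning
    open +-*-Solver

  module _ {x y : ℕ} (x>0 : 0 ℕ.< x) (y>0 : 0 ℕ.< y) where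
    xy>0 : 0 ℕ.< x ℕ.* y
    xy>0 = ℕ.*-mono-≤ x>0 y>0

    val-* : val (unit (x ℕ.* y)) ≡ val (unit x) * val (unit y)
    val-* = trans (val-unit xy>0) (trans (ι-* x y) (sym (cong₂ _*_ (val-unit x>0) (val-unit y>0))))

    inv-* : inv (unit (x ℕ.* y)) ≡ inv (unit x) * inv (unit y)
    inv-* = inverse-unique {val (unit (x ℕ.* y))} (proj₂ (proj₂ (unit (x ℕ.* y))))
      (trans (cong (_* (inv (unit x) * inv (unit y))) val-*)
        (trans (solve 4 (λ a b c d → (a :* b) :* (c :* d) := (a :* c) :* (b :* d)) refl
          (val (unit x)) (val (unit y)) (inv (unit x)) (inv (unit y)))
        (cong₂ _*_ (proj₂ (proj₂ (unit x))) (proj₂ (proj₂ (unit y))))))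
      where open +-*-Solver

  module Cosets (G : Subgroup (AbelianGroup.group ℚˣ) 0ℓ) (fin : FiniteIndex (AbelianGroup.group ℚˣ) G) where
    open Subgroup G
    open AbelianGroup ℚˣ using (_∙_; _⁻¹)

    n : ℕ
    n = proj₁ fin

    private
      module I = Inverse (proj₂ fin)
      module S = Setoid (leftCosets (AbelianGroup.group ℚˣ) G)

    same⇒ : ∀ {u v} → I.to u ≡ I.to v → Member (u ⁻¹ ∙ v)
    same⇒ {u} {v} eq = S.trans {u} {I.from (I.to u)} {v} (S.sym {I.from (I.to u)} {u} (I.strictlyInverseʳ u))
      (subst (λ w → Member (I.from w ⁻¹ ∙ v)) (sym eq) (I.strictlyInverseʳ v))

    ratio : ℕ → ℕ → Unit ℚ-ring
    ratio p q = unit p ∙ unit q ⁻¹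

    col : ℕ → ℕ → ℕ
    col p q = toℕ (I.to (ratio p q))

    col<n : ∀ p q → col p q ℕ.< n
    col<n p q = Fin.toℕ<n (I.to (ratio p q))

    col⇒ : ∀ {p q r s} → col p q ≡ col r s → Member (ratio p q ⁻¹ ∙ ratio r s)
    col⇒ {p} {q} {r} {s} eq = same⇒ {ratio p q} {ratio r s} (Fin.toℕ-injective eq)

    ⇒col : ∀ {p q r s} → Member (ratio p q ⁻¹ ∙ ratio r s) → col p q ≡ col r s
    ⇒col {p} {q} {r} {s} h = cong toℕ (I.to-cong {ratio p q} {ratio r s} h)

    private
      shift : ∀ x {y z} → 0 ℕ.< x → 0 ℕ.< y → 0 ℕ.< z →
              val (ratio y 1 ⁻¹ ∙ ratio z 1) ≡ val (ratio (x ℕ.* y) 1 ⁻¹ ∙ ratio (x ℕ.* z) 1)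
      shift x {y} {z} x>0 y>0 z>0 = sym (begin
        (inv (unit (x ℕ.* y)) * 1ℚ) * (val (unit (x ℕ.* z)) * 1ℚ)
          ≡⟨ cong₂ (λ i v → (i * 1ℚ) * (v * 1ℚ)) (inv-* x>0 y>0) (val-* x>0 z>0) ⟩
        (inv (unit x) * inv (unit y) * 1ℚ) * (val (unit x) * val (unit z) * 1ℚ)
          ≡⟨ solve 4 (λ a b c d → (a :* b :* con 1ℚ) :* (c :* d :* con 1ℚ) := (c :* a) :* ((b :* con 1ℚ) :* (d :* con 1ℚ))) refl
               (inv (unit x)) (inv (unit y)) (val (unit x)) (val (unit z)) ⟩
        (val (unit x) * inv (unit x)) * ((inv (unit y) * 1ℚ) * (val (unit z) * 1ℚ))
          ≡⟨ cong (_* ((inv (unit y) * 1ℚ) * (val (unit z) * 1ℚ))) (proj₂ (proj₂ (unit x))) ⟩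
        1ℚ * ((inv (unit y) * 1ℚ) * (val (unit z) * 1ℚ))
          ≡⟨ ℚ.*-identityˡ _ ⟩
        (inv (unit y) * 1ℚ) * (val (unit z) * 1ℚ) ∎)
        where
        open ≡-Reasoning
        open +-*-Solver

    χ-cong : ∀ x {y z} → 0 ℕ.< x → 0 ℕ.< y → 0 ℕ.< z → col y 1 ≡ col z 1 → col (x ℕ.* y) 1 ≡ col (x ℕ.* z) 1
    χ-cong x {y} {z} x>0 y>0 z>0 eq = ⇒col {x ℕ.* y} {1} {x ℕ.* z} {1} (resp (shift x x>0 y>0 z>0) (col⇒ {y} {1} {z} {1} eq))

    χ-cancel : ∀ x {y z} → 0 ℕ.< x → 0 ℕ.< y → 0 ℕ.< z → col (x ℕ.* y) 1 ≡ col (x ℕ.* z) 1 → col y 1 ≡ col z 1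
    χ-cancel x {y} {z} x>0 y>0 z>0 eq = ⇒col {y} {1} {z} {1} (resp (sym (shift x x>0 y>0 z>0)) (col⇒ {x ℕ.* y} {1} {x ℕ.* z} {1} eq))

    col-χ : ∀ {p q r s} → 0 ℕ.< p → 0 ℕ.< q → 0 ℕ.< r → 0 ℕ.< s → col p q ≡ col r s → col (p ℕ.* s) 1 ≡ col (r ℕ.* q) 1
    col-χ {p} {q} {r} {s} p>0 q>0 r>0 s>0 eq = ⇒col {p ℕ.* s} {1} {r ℕ.* q} {1} (resp cross (col⇒ {p} {q} {r} {s} eq))
      where
      open +-*-Solver
      cross : (inv (unit p) * val (unit q)) * (val (unit r) * inv (unit s)) ≡
              (inv (unit (p ℕ.* s)) * 1ℚ) * (val (unit (r ℕ.* q)) * 1ℚ)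
      cross = trans (solve 4 (λ a b c d → (a :* b) :* (c :* d) := (a :* d :* con 1ℚ) :* (c :* b :* con 1ℚ)) refl
          (inv (unit p)) (val (unit q)) (val (unit r)) (inv (unit s)))
        (sym (cong₂ (λ i v → (i * 1ℚ) * (v * 1ℚ)) (inv-* p>0 s>0) (val-* r>0 q>0)))

    χ⇒Member : ∀ p q → col p 1 ≡ col q 1 → Member (ratio p q)
    χ⇒Member p q eq = resp (solve 2 (λ a b → (a :* con 1ℚ) :* (b :* con 1ℚ) := a :* b) refl (val (unit p)) (inv (unit q)))
      (⁻¹-closed (col⇒ {p} {1} {q} {1} eq))
      where open +-*-Solver

  positive-fraction : ∀ q → 0ℚ < q → ∃₂ λ m d → 0 ℕ.< m × 0 ℕ.< d × q * ι d ≡ ι m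
  positive-fraction q@(mkℚ ℤ.+[1+ m ] d _) _ = suc m , suc d , s≤s z≤n , s≤s z≤n , denominator q
  positive-fraction (mkℚ (ℤ.+ 0) d _)   0<q with positive 0<q
  ... | ()
  positive-fraction (mkℚ ℤ.-[1+ m ] d _) 0<q with positive 0<q
  ... | ()

  1/n≤1 : ∀ n .{{_ : ℕ.NonZero n}} → ℤ.+ 1 / n ≤ 1ℚ
  1/n≤1 n@(suc k) = ℚ.toℚᵘ-cancel-≤ (ℚᵘ.≤-respˡ-≃ (ℚᵘ.≃-sym (ℚ.toℚᵘ-fromℚᵘ (ℚᵘ.mkℚᵘ (ℤ.+ 1) k)))
    (ℚᵘ.*≤* (ℤ.+≤+ (s≤s z≤n))))

  0<1/n : ∀ n .{{_ : ℕ.NonZero n}} → 0ℚ < ℤ.+ 1 / n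
  0<1/n n = ℚ.positive⁻¹ (ℤ.+ 1 / n) {{ℚ.normalize-pos 1 n}}

  sign : (u : Unit ℚ-ring) → 0ℚ < val u ⊎ val u < 0ℚ
  sign (u , v , uv≡1) with ℚ.<-cmp 0ℚ u
  ... | tri< h _ _ = inj₁ h
  ... | tri> _ _ h = inj₂ h
  ... | tri≈ _ h _ = contradiction (trans (sym uv≡1) (trans (cong (_* v) (sym h)) (ℚ.*-zeroˡ v))) λ ()

  neg : Unit ℚ-ring → Unit ℚ-ring
  neg (u , v , uv≡1) = - u , - v , trans (solve 2 (λ u v → (:- u) :* (:- v) := u :* v) refl u v) uv≡1
    where open +-*-Solver

  0<- : ∀ {q} → q < 0ℚ → 0ℚ < - q
  0<- q<0 = ℚ.neg-antimono-< q<0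

  relative-error : ∀ (A : AbsoluteValue) E u η → AbsoluteValue.∥_∥ A E < η * AbsoluteValue.∥_∥ A (val u) →
                   AbsoluteValue.∥_∥ A (E * inv u) < η
  relative-error A E u η h = ℚ.*-cancelʳ-<-nonNeg ∥ val u ∥ {{nonNegative (0≤∥ val u ∥)}}
    (subst (_< η * ∥ val u ∥) (trans (cong ∥_∥ E≡) (*-homo (E * inv u) (val u))) h)
    where
    open AbsoluteValue A
    open +-*-Solver
    E≡ : E ≡ E * inv u * val u
    E≡ = trans (sym (ℚ.*-identityʳ E)) (trans (cong (E *_) (sym (proj₂ (proj₂ u))))
      (solve 3 (λ e u v → e :* (u :* v) := e :* v :* u) refl E (val u) (inv u)))

  -- A solution (u, v, w) of α u + β w = (α + β) v, where (1 - t) X : Y = α : β,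
  -- adjusts X and Y.
  adjust : ∀ X Y Z t α β β⁻ u v v⁻ w p p⁻ →
    t * X ≡ X + Y + Z → (1ℚ - t) * X * β ≡ Y * α → β * β⁻ ≡ 1ℚ → p * p⁻ ≡ 1ℚ → v * v⁻ ≡ 1ℚ →
    α * u + β * w ≡ (α + β) * v →
    X * ((u * ((1ℚ - t) * p)) * (p⁻ * v⁻)) + Y * (w * v⁻) + Z ≡ 0ℚ
  adjust X Y Z t α β β⁻ u v v⁻ w p p⁻ tX≡ X̃β≡Yα ββ⁻≡1 pp⁻≡1 vv⁻≡1 αu+βw≡ = begin
    X * ((u * ((1ℚ - t) * p)) * (p⁻ * v⁻)) + Y * (w * v⁻) + Z
      ≡⟨ solve 9 (λ X Y Z t u w p p⁻ v⁻ → X :* ((u :* ((con 1ℚ :- t) :* p)) :* (p⁻ :* v⁻)) :+ Y :* (w :* v⁻) :+ Z :=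
           (con 1ℚ :- t) :* X :* u :* v⁻ :* (p :* p⁻) :+ Y :* w :* v⁻ :+ Z) refl X Y Z t u w p p⁻ v⁻ ⟩
    X̃ * u * v⁻ * (p * p⁻) + Y * w * v⁻ + Z
      ≡⟨ cong (λ g → X̃ * u * v⁻ * g + Y * w * v⁻ + Z) pp⁻≡1 ⟩
    X̃ * u * v⁻ * 1ℚ + Y * w * v⁻ + Z
      ≡⟨ cong₂ (λ g h → g * u * v⁻ * 1ℚ + h * w * v⁻ + Z) X̃≡κα Y≡κβ ⟩
    κ * α * u * v⁻ * 1ℚ + κ * β * w * v⁻ + Z
      ≡⟨ solve 7 (λ κ α u v⁻ β w Z → κ :* α :* u :* v⁻ :* con 1ℚ :+ κ :* β :* w :* v⁻ :+ Z := κ :* (α :* u :+ β :* w) :* v⁻ :+ Z) refl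
           κ α u v⁻ β w Z ⟩
    κ * (α * u + β * w) * v⁻ + Z
      ≡⟨ cong (λ g → κ * g * v⁻ + Z) αu+βw≡ ⟩
    κ * ((α + β) * v) * v⁻ + Z
      ≡⟨ solve 6 (λ κ α β v v⁻ Z → κ :* ((α :+ β) :* v) :* v⁻ :+ Z := (κ :* α :+ κ :* β) :* (v :* v⁻) :+ Z) refl κ α β v v⁻ Z ⟩
    (κ * α + κ * β) * (v * v⁻) + Z
      ≡⟨ cong₂ (λ g h → g * h + Z) (cong₂ _+_ (sym X̃≡κα) (sym Y≡κβ)) vv⁻≡1 ⟩
    (X̃ + Y) * 1ℚ + Z
      ≡⟨ solve 4 (λ t X Y Z → ((con 1ℚ :- t) :* X :+ Y) :* con 1ℚ :+ Z := (X :+ Y :+ Z) :- t :* X) refl t X Y Z ⟩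
    (X + Y + Z) - t * X              ≡⟨ cong (λ g → (X + Y + Z) - g) tX≡ ⟩
    (X + Y + Z) - (X + Y + Z)        ≡⟨ ℚ.+-inverseʳ (X + Y + Z) ⟩
    0ℚ                               ∎
    where
    open ≡-Reasoning
    open +-*-Solver
    X̃ κ : ℚ
    X̃ = (1ℚ - t) * X
    κ = Y * β⁻
    cancel-β : ∀ q → q ≡ q * β * β⁻
    cancel-β q = trans (sym (ℚ.*-identityʳ q)) (trans (cong (q *_) (sym ββ⁻≡1)) (sym (ℚ.*-assoc q β β⁻)))
    X̃≡κα : X̃ ≡ κ * α
    X̃≡κα = trans (cancel-β X̃) (trans (cong (_* β⁻) X̃β≡Yα) (solve 3 (λ y a b → y :* a :* b := y :* b :* a) refl Y α β⁻))
    Y≡κβ : Y ≡ κ * β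
    Y≡κβ = trans (cancel-β Y) (solve 3 (λ y a b → y :* a :* b := y :* b :* a) refl Y β β⁻)

  cross-multiply : ∀ X Y m d m′ d′ → X * ι d ≡ ι m → Y * ι d′ ≡ ι m′ → X * ι (m′ ℕ.* d) ≡ Y * ι (m ℕ.* d′)
  cross-multiply X Y m d m′ d′ X≡ Y≡ = begin
    X * ι (m′ ℕ.* d)     ≡⟨ cong (X *_) (ι-* m′ d) ⟩
    X * (ι m′ * ι d)     ≡⟨ solve 3 (λ x m d → x :* (m :* d) := m :* (x :* d)) refl X (ι m′) (ι d) ⟩
    ι m′ * (X * ι d)     ≡⟨ cong₂ _*_ (sym Y≡) X≡ ⟩
    Y * ι d′ * ι m       ≡⟨ solve 3 (λ y d m → y :* d :* m := y :* (m :* d)) refl Y (ι d′) (ι m) ⟩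
    Y * (ι m * ι d′)     ≡⟨ cong (Y *_) (ι-* m d′) ⟨
    Y * ι (m ℕ.* d′)     ∎
    where
    open ≡-Reasoning
    open +-*-Solver

  ι-equation : ∀ A B u v w → A ℕ.* u ℕ.+ B ℕ.* w ≡ (A ℕ.+ B) ℕ.* v → ι A * ι u + ι B * ι w ≡ (ι A + ι B) * ι v
  ι-equation A B u v w eq = begin
    ι A * ι u + ι B * ι w            ≡⟨ cong₂ _+_ (ι-* A u) (ι-* B w) ⟨
    ι (A ℕ.* u) + ι (B ℕ.* w)        ≡⟨ ι-+ (A ℕ.* u) (B ℕ.* w) ⟨
    ι (A ℕ.* u ℕ.+ B ℕ.* w)          ≡⟨ cong ι eq ⟩
    ι ((A ℕ.+ B) ℕ.* v)              ≡⟨ ι-* (A ℕ.+ B) v ⟩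
    ι (A ℕ.+ B) * ι v                ≡⟨ cong (_* ι v) (ι-+ A B) ⟩
    (ι A + ι B) * ι v                ∎
    where open ≡-Reasoning

  ι-inverse : ∀ {k} → 0 ℕ.< k → ι k * inv (unit k) ≡ 1ℚ
  ι-inverse {k} k>0 = trans (cong (_* inv (unit k)) (sym (val-unit k>0))) (proj₂ (proj₂ (unit k)))

  ∣t∣<1⇒0<1-t : ∀ t → ∣ t ∣ < 1ℚ → 0ℚ < 1ℚ - t
  ∣t∣<1⇒0<1-t t small = subst (_< 1ℚ - t) (ℚ.+-inverseʳ t) (ℚ.+-monoˡ-< (- t) t<1)
    where
    t<1 : t < 1ℚ
    t<1 with ℚ.∣p∣≡p∨∣p∣≡-p t
    ... | inj₁ eq = subst (_< 1ℚ) eq small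
    ... | inj₂ eq = ℚ.≤-<-trans (subst (_≤ 0ℚ) (solve 1 (λ t → :- (:- t) := t) refl t)
      (ℚ.neg-antimono-≤ (subst (0ℚ ≤_) eq (ℚ.0≤∣p∣ t)))) (ℚ.positive⁻¹ 1ℚ)
      where open +-*-Solver

  module Finish (G : Subgroup (AbelianGroup.group ℚˣ) 0ℓ) (fin : FiniteIndex (AbelianGroup.group ℚˣ) G) (R : Set) where
    open Subgroup G
    open AbelianGroup ℚˣ using (_∙_; _⁻¹)
    open Cosets G fin
    open Theorem n col col<n R χ-cong χ-cancel col-χ using (Table; table; module Equation)

    module _ (M : ℕ) (M>0 : 0 ℕ.< M) (tab : Table M) where

      private
        instance
          M≢0 : ℕ.NonZero M
          M≢0 = >-nonZero M>0
          8M≢0 : ℕ.NonZero (8 ℕ.* M)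
          8M≢0 = ℕ.m*n≢0 8 M

      η : ℚ
      η = ℤ.+ 1 / (8 ℕ.* M)

      -- a x is replaced by X - E = - (b y + c z), which has the same sign;
      -- the quotient X / (X - E) is adjusted by the solution found in
      -- natural numbers.
      solve-positive : ∀ (a b c x y z : Unit ℚ-ring) → Member x → Member y → Member z →
        ∀ t → t * (val a * val x) ≡ val a * val x + val b * val y + val c * val z →
        (∀ p → Prime p → p ∣ M → ∃ λ pr → padicAbs p pr t < η) → ∣ t ∣ < η →
        0ℚ < val a * val x → 0ℚ < val b * val y →
        Cont R (HasSolutionIn ℚ-ring Member (val a) (val b) (val c))
      solve-positive a b c x y z x∈ y∈ z∈ t t≡ small-p small-∞ X>0 Y>0 =
        with-fractions (near-fraction M t small-p small-∞) (positive-fraction X̃ X̃>0) (positive-fraction Y Y>0)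
        where
        X Y Z X̃ : ℚ
        X = val a * val x
        Y = val b * val y
        Z = val c * val z
        X̃ = (1ℚ - t) * X
        X̃>0 : 0ℚ < X̃
        X̃>0 = 0<* (∣t∣<1⇒0<1-t t (ℚ.<-≤-trans small-∞ (1/n≤1 (8 ℕ.* M)))) X>0
        with-fractions : (∃₂ λ p q → One M p × One M q × Near (4 ℕ.* M) p q × ι q ≡ (1ℚ - t) * ι p) →
                         (∃₂ λ m d → 0 ℕ.< m × 0 ℕ.< d × X̃ * ι d ≡ ι m) →
                         (∃₂ λ m d → 0 ℕ.< m × 0 ℕ.< d × Y * ι d ≡ ι m) →
                         Cont R (HasSolutionIn ℚ-ring Member (val a) (val b) (val c))
        with-fractions (p , q , p-one , q-one , near , ιq) (m , d , m>0 , d>0 , X̃≡) (m′ , d′ , m′>0 , d′>0 , Y≡) =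
          Equation.solvable M M>0 tab A B A>0 B>0 p q p-one q-one near >>= λ s → return (build s)
          where
          A B : ℕ
          -- With X - E = m / d and Y = m′ / d′, the integers A and B have the ratio of X - E to Y.
          A = m ℕ.* d′
          B = m′ ℕ.* d
          A>0 : 0 ℕ.< A
          A>0 = ℕ.*-mono-≤ m>0 d′>0
          B>0 : 0 ℕ.< B
          B>0 = ℕ.*-mono-≤ m′>0 d>0
          p>0 : 0 ℕ.< p
          p>0 = subst (0 ℕ.<_) (sym (proj₂ p-one)) (s≤s z≤n)
          q>0 : 0 ℕ.< q
          q>0 = subst (0 ℕ.<_) (sym (proj₂ q-one)) (s≤s z≤n)
          build : Equation.Solution M M>0 tab A B A>0 B>0 p q p-one q-one near →
                  HasSolutionIn ℚ-ring Member (val a) (val b) (val c)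
          build (u , v , w , u>0 , v>0 , w>0 , eq , wv , uv) =
            -- The factor q / p = 1 - t turns X into X - E, and u / v and w / v then adjust the two
            -- terms so that their sum X - E + Y is unchanged.
            x ∙ ratio (u ℕ.* q) (p ℕ.* v) , y ∙ ratio w v , z ,
            ∙-closed x∈ (χ⇒Member (u ℕ.* q) (p ℕ.* v) uv) , ∙-closed y∈ (χ⇒Member w v wv) , z∈ ,
            trans (cong₂ (λ g h → g + h + Z) first second)
              (adjust X Y Z t (ι A) (ι B) (inv (unit B)) (ι u) (ι v) (inv (unit v)) (ι w) (ι p) (inv (unit p)) t≡
                (cross-multiply X̃ Y m d m′ d′ X̃≡ Y≡) (ι-inverse B>0) (ι-inverse p>0) (ι-inverse v>0) (ι-equation A B u v w eq))
            where
            first : val a * (val x * (val (unit (u ℕ.* q)) * inv (unit (p ℕ.* v)))) ≡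
                    X * ((ι u * ((1ℚ - t) * ι p)) * (inv (unit p) * inv (unit v)))
            first = trans (sym (ℚ.*-assoc (val a) (val x) _)) (cong₂ (λ g h → X * (g * h))
              (trans (val-unit (ℕ.*-mono-≤ u>0 q>0)) (trans (ι-* u q) (cong (ι u *_) ιq))) (inv-* p>0 v>0))
            second : val b * (val y * (val (unit w) * inv (unit v))) ≡ Y * (ι w * inv (unit v))
            second = trans (sym (ℚ.*-assoc (val b) (val y) _)) (cong (λ g → Y * (g * inv (unit v))) (val-unit w>0))

      module _ (E : ℚ) where
        private
          E≡ : ∀ u → E * inv u * val u ≡ E
          E≡ u = trans (solve 3 (λ e v u → e :* v :* u := e :* (u :* v)) refl E (inv u) (val u))
            (trans (cong (E *_) (proj₂ (proj₂ u))) (ℚ.*-identityʳ E))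
            where open +-*-Solver

          negate : ∀ a x → val a * val x < 0ℚ → 0ℚ < - val a * val x
          negate a x h = subst (0ℚ <_) (solve 2 (λ a x → :- (a :* x) := (:- a) :* x) refl (val a) (val x)) (0<- h)
            where open +-*-Solver

        -- Negating a, b and c changes neither the solutions nor the relative error t, and it makes
        -- two negative terms positive.
        solve-same-sign : ∀ a b c x y z → Member x → Member y → Member z →
          val a * val x + val b * val y + val c * val z ≡ E →
          ∣ E ∣ < η * ∣ val a * val x ∣ →
          (∀ p → Prime p → p ∣ M → ∃ λ pr → padicAbs p pr E < η * padicAbs p pr (val a * val x)) →
          (0ℚ < val a * val x × 0ℚ < val b * val y) ⊎ (val a * val x < 0ℚ × val b * val y < 0ℚ) →
          Cont R (HasSolutionIn ℚ-ring Member (val a) (val b) (val c))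
        solve-same-sign a b c x y z x∈ y∈ z∈ sum small-∞ small-p (inj₁ (X>0 , Y>0)) =
          solve-positive a b c x y z x∈ y∈ z∈ (E * inv (a ∙ x)) (trans (E≡ (a ∙ x)) (sym sum))
            (λ p pr p∣M → let pr′ , h = small-p p pr p∣M in pr′ , relative-error (padic p pr′) E (a ∙ x) η h)
            (relative-error archimedean E (a ∙ x) η small-∞) X>0 Y>0
        solve-same-sign a b c x y z x∈ y∈ z∈ sum small-∞ small-p (inj₂ (X<0 , Y<0)) =
          solve-positive (neg a) (neg b) (neg c) x y z x∈ y∈ z∈ (E * inv (a ∙ x))
            (negated (E * inv (a ∙ x)) (trans (E≡ (a ∙ x)) (sym sum)))
            (λ p pr p∣M → let pr′ , h = small-p p pr p∣M in pr′ , relative-error (padic p pr′) E (a ∙ x) η h)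
            (relative-error archimedean E (a ∙ x) η small-∞) (negate a x X<0) (negate b y Y<0) >>=
          λ (x′ , y′ , z′ , x′∈ , y′∈ , z′∈ , eq) → return (x′ , y′ , z′ , x′∈ , y′∈ , z′∈ ,
            trans (minus x′ y′ z′) (cong -_ eq))
          where
          open +-*-Solver
          minus : ∀ x y z → val a * val x + val b * val y + val c * val z ≡ - (- val a * val x + - val b * val y + - val c * val z)
          minus x y z = solve 6 (λ a x b y c z → a :* x :+ b :* y :+ c :* z := :- ((:- a) :* x :+ (:- b) :* y :+ (:- c) :* z)) refl
            (val a) (val x) (val b) (val y) (val c) (val z)
          negated : ∀ t → t * (val a * val x) ≡ val a * val x + val b * val y + val c * val z →
                    t * (- val a * val x) ≡ - val a * val x + - val b * val y + - val c * val z
          negated t eq = trans (solve 3 (λ e a x → e :* ((:- a) :* x) := :- (e :* (a :* x))) refl t (val a) (val x))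
            (trans (cong -_ eq) (solve 6 (λ a x b y c z → :- (a :* x :+ b :* y :+ c :* z) := (:- a) :* x :+ (:- b) :* y :+ (:- c) :* z) refl
              (val a) (val x) (val b) (val y) (val c) (val z)))

        -- Two of the three terms have the same sign.
        solve-any-sign : ∀ a b c x y z → Member x → Member y → Member z →
          val a * val x + val b * val y + val c * val z ≡ E →
          ∣ E ∣ < η * ∣ val a * val x ∣ × ∣ E ∣ < η * ∣ val b * val y ∣ × ∣ E ∣ < η * ∣ val c * val z ∣ →
          (∀ p → Prime p → p ∣ M → ∃ λ pr → padicAbs p pr E < η * padicAbs p pr (val a * val x) ×
            padicAbs p pr E < η * padicAbs p pr (val b * val y) × padicAbs p pr E < η * padicAbs p pr (val c * val z)) →
          Cont R (HasSolutionIn ℚ-ring Member (val a) (val b) (val c))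
        solve-any-sign a b c x y z x∈ y∈ z∈ sum small-∞ small-p = by-sign (sign (a ∙ x)) (sign (b ∙ y)) (sign (c ∙ z))
          where
          open +-*-Solver
          Goal : Set
          Goal = Cont R (HasSolutionIn ℚ-ring Member (val a) (val b) (val c))
          X Y Z : ℚ
          X = val a * val x
          Y = val b * val y
          Z = val c * val z

          xzy : ∀ X Y Z → X + Z + Y ≡ X + Y + Z
          xzy = solve 3 (λ X Y Z → X :+ Z :+ Y := X :+ Y :+ Z) refl

          yzx : ∀ X Y Z → Y + Z + X ≡ X + Y + Z
          yzx = solve 3 (λ X Y Z → Y :+ Z :+ X := X :+ Y :+ Z) refl

          xy : (0ℚ < X × 0ℚ < Y) ⊎ (X < 0ℚ × Y < 0ℚ) → Goal
          xy = solve-same-sign a b c x y z x∈ y∈ z∈ sum (proj₁ small-∞)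
            (λ p pr p∣M → let pr′ , h = small-p p pr p∣M in pr′ , proj₁ h)

          xz : (0ℚ < X × 0ℚ < Z) ⊎ (X < 0ℚ × Z < 0ℚ) → Goal
          xz signs = solve-same-sign a c b x z y x∈ z∈ y∈ (trans (xzy X Y Z) sum) (proj₁ small-∞)
            (λ p pr p∣M → let pr′ , h = small-p p pr p∣M in pr′ , proj₁ h) signs >>=
            λ (x′ , z′ , y′ , x′∈ , z′∈ , y′∈ , eq) → return (x′ , y′ , z′ , x′∈ , y′∈ , z′∈ ,
              trans (sym (xzy (val a * val x′) (val b * val y′) (val c * val z′))) eq)

          yz : (0ℚ < Y × 0ℚ < Z) ⊎ (Y < 0ℚ × Z < 0ℚ) → Goal
          yz signs = solve-same-sign b c a y z x y∈ z∈ x∈ (trans (yzx X Y Z) sum) (proj₁ (proj₂ small-∞))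
            (λ p pr p∣M → let pr′ , h = small-p p pr p∣M in pr′ , proj₁ (proj₂ h)) signs >>=
            λ (y′ , z′ , x′ , y′∈ , z′∈ , x′∈ , eq) → return (x′ , y′ , z′ , x′∈ , y′∈ , z′∈ ,
              trans (sym (yzx (val a * val x′) (val b * val y′) (val c * val z′))) eq)

          by-sign : 0ℚ < X ⊎ X < 0ℚ → 0ℚ < Y ⊎ Y < 0ℚ → 0ℚ < Z ⊎ Z < 0ℚ → Goal
          by-sign (inj₁ X>0) (inj₁ Y>0) _          = xy (inj₁ (X>0 , Y>0))
          by-sign (inj₂ X<0) (inj₂ Y<0) _          = xy (inj₂ (X<0 , Y<0))
          by-sign (inj₁ X>0) (inj₂ Y<0) (inj₁ Z>0) = xz (inj₁ (X>0 , Z>0))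
          by-sign (inj₁ X>0) (inj₂ Y<0) (inj₂ Z<0) = yz (inj₂ (Y<0 , Z<0))
          by-sign (inj₂ X<0) (inj₁ Y>0) (inj₁ Z>0) = yz (inj₁ (Y>0 , Z>0))
          by-sign (inj₂ X<0) (inj₁ Y>0) (inj₂ Z<0) = xz (inj₂ (X<0 , Z<0))

  module _ (G : Subgroup (AbelianGroup.group ℚˣ) 0ℓ) (fin : FiniteIndex (AbelianGroup.group ℚˣ) G) where
    open Subgroup G

    module _ (a b c : Unit ℚ-ring) where

      Solvable : Set
      Solvable = HasSolutionIn ℚ-ring Member (val a) (val b) (val c)

      LocallySolvable : List Place → Set
      LocallySolvable S = HasSolutionIn ℚ[ S ] (closureIn S G) (diagonal S (val a)) (diagonal S (val b)) (diagonal S (val c))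

      local⇒global : (∀ S → Unique S → LocallySolvable S) → Solvable
      -- The goal itself serves as R, so the classical argument is closed by the identity
      -- continuation.
      local⇒global local = (table >>= at-modulus) λ s → s
        where
        open Finish G fin Solvable
        open Cosets G fin
        open Theorem n col col<n Solvable χ-cong χ-cancel col-χ using (Table; table)
        at-modulus : (∃ λ M → 0 ℕ.< M × Table M) → Cont Solvable Solvable
        at-modulus (M , M>0 , tab) = lift (approximate G a b c (places M) (η M M>0 tab)
          (0<1/n (8 ℕ.* M) {{8M≢0}}) (1/n≤1 (8 ℕ.* M) {{8M≢0}}) (local (places M) (places-unique M)))
          where
          8M≢0 : ℕ.NonZero (8 ℕ.* M)
          8M≢0 = ℕ.m*n≢0 8 M {{_}} {{>-nonZero M>0}}
          lift : (∃ λ x → ∃₂ λ y z → Member x × Member y × Member z × (∀ i → Approximate G a b c (η M M>0 tab) (lookup (places M) i) x y z)) →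
                 Cont Solvable Solvable
          lift (x , y , z , x∈ , y∈ , z∈ , close) =
            solve-any-sign M M>0 tab (error G a b c x y z) a b c x y z x∈ y∈ z∈ refl
              (let i , eq = ∞-index M in subst (λ v → Approximate G a b c (η M M>0 tab) v x y z) eq (close i))
              (λ p pr p∣M → let i , pr′ , eq = prime-index M p pr (∣⇒≤ {{>-nonZero M>0}} p∣M)
                            in pr′ , subst (λ v → Approximate G a b c (η M M>0 tab) v x y z) eq (close i))

      global⇒local : Solvable → ∀ S → Unique S → LocallySolvable S
      global⇒local (x , y , z , x∈ , y∈ , z∈ , eq) S _ =
        diagonalˣ S x , diagonalˣ S y , diagonalˣ S z , closed x x∈ , closed y y∈ , closed z z∈ ,
        λ i ε ε>0 → 0 , λ _ _ → subst (_< ε) (sym (trans (cong (AbsoluteValue.∥_∥ (value i)) (trans (ℚ.+-identityʳ _) eq)) (AbsoluteValue.∥0∥≡0 (value i)))) ε>0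
        where
        value : Fin (length S) → AbsoluteValue
        value i = absoluteValue (lookup S i)
        ∥u-u∥≡0 : ∀ i u → AbsoluteValue.∥_∥ (value i) (u - u) ≡ 0ℚ
        ∥u-u∥≡0 i u = trans (cong (AbsoluteValue.∥_∥ (value i)) (ℚ.+-inverseʳ u)) (AbsoluteValue.∥0∥≡0 (value i))
        closed : ∀ u → Member u → closureIn S G (diagonalˣ S u)
        closed u u∈ ε ε>0 = diagonalˣ S u ,
          (u , u∈ , λ i δ δ>0 → 0 , λ _ _ → subst (_< δ) (sym (∥u-u∥≡0 i (val u))) δ>0) ,
          λ i → 0ℚ , ε>0 i , 0 , λ _ _ → ℚ.≤-reflexive (∥u-u∥≡0 i (val u))

open LocalGlobal using (global⇒local; local⇒global)

theorem3 : (G : Subgroup (AbelianGroup.group ℚˣ) 0ℓ) →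
    FiniteIndex (AbelianGroup.group ℚˣ) G →
    (a b c : AbelianGroup.Carrier ℚˣ) →
    HasSolutionIn ℚ-ring (Subgroup.Member G) (proj₁ a) (proj₁ b) (proj₁ c) ⇔
    ((S : List Place) → Unique S →
    HasSolutionIn ℚ[ S ] (closureIn S G)
    (diagonal S (proj₁ a)) (diagonal S (proj₁ b)) (diagonal S (proj₁ c)))
theorem3 G fin a b c = mk⇔ (global⇒local G fin a b c) (local⇒global G fin a b c)
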